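{- (1) The theory $\mathrm{RCA}_0^{\Omega}$ proves $\mathrm{FAN}^{\mathrm{st}}\leftrightarrow\mathrm{UFAN}_2^{\mathrm{st}}\leftrightarrow\mathrm{FAN}^{*}$. (2) The theory $\mathrm{RCA}_0^{\Omega}+\mathrm{QF\text{ - }AC}^{2,0}$ proves $\mathrm{FAN}^{\mathrm{st}}\leftrightarrow\mathrm{FAN}\leftrightarrow\mathrm{UFAN}_2$.
   Context: BASE THEORY. Finite types: $0$ (natural numbers), $\sigma\to\tau$, and $\sigma^{*}$ (finite sequences of objects of type $\sigma$); $1=0\to 0$, $2=1\to 0$, $3=2\to 0$. Superscripts indicate types; tuples are coded as single objects where convenient. Equality $=_0$ is primitive; for $\tau=\tau_1\to\dots\to\tau_k\to 0$, $x=_\tau y$ means $(\forall z_1\dots z_k)(xz_1\dots z_k=_0 yz_1\dots z_k)$. $\mathrm{RCA}_0^{\omega}$ is Kohlenbach's higher-order base theory: classical arithmetic in all finite types with combinators, zero, successor, the recursor $R_0$ (primitive recursion with type $0$ values), quantifier-free induction, extensionality $x=_\rho y\to\varphi(x)=_\tau\varphi(y)$ for all $\varphi^{\rho\to\tau}$, and $\mathrm{QF\text{ - }AC}^{1,0}$, where $\mathrm{QF\text{ - }AC}^{\sigma,\tau}$ is $(\forall x^\sigma)(\exists y^\tau)A_0(x,y)\to(\exists F^{\sigma\to\tau})(\forall x)A_0(x,F(x))$ for quantifier-free $A_0$. $\mathrm{RCA}_0^{\Omega}$ extends $\mathrm{RCA}_0^{\omega}$ (with the types $\sigma^*$) by a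 predicate $\mathrm{st}$ ("is standard") for each type. A formula is internal if it does not contain $\mathrm{st}$; $(\forall^{\mathrm{st}}x)A$ is $(\forall x)(\mathrm{st}(x)\to A)$, $(\exists^{\mathrm{st}}x)A$ is $(\exists x)(\mathrm{st}(x)\wedge A)$; $N\in\Omega$ means $\neg\mathrm{st}(N^0)$; $A^{\mathrm{st}}$ is $A$ with all quantifiers (except bounded number quantifiers) relativised to $\mathrm{st}$. Axioms: (i) standardness respects equality, closed terms are standard, a standard functional applied to a standard object is standard, and numbers below a standard number are standard; (ii) Idealization: $(\forall^{\mathrm{st}}x^{\sigma^*})(\exists y^\tau)(\forall z\in x)\varphi(z,y)\to(\exists y)(\forall^{\mathrm{st}}z^{\sigma})\varphi(z,y)$ for internal $\varphi$; (iii) $\mathrm{HAC}_{\mathrm{int}}$: $(\forall^{\mathrm{st}}x^{\rho})(\exists^{\mathrm{st}}y^{\tau})\varphi(x,y)\to(\exists^{\mathrm{st}}\Phi^{\rho\to\tau^*})(\forall^{\mathrm{st}}x)(\exists y\in\Phi(x))\varphi(x,y)$ for internal $\varphi$; (iv) $\mathrm{PF\text{ - }TP}_\forall$: $(\forall^{\mathrm{st}}x^\tau)\varphi(x)\to(\forall x^\tau)\varphi(x)$ for internal $\varphi(x)$ with no parameters other than $x$; (v) for certain functionals uniquely specified by a parameter-free internal formula $D$, a constant $\Xi_0$ with the axiom $\mathrm{st}(\Xi_0)\wedge(\forall^{\mathrm{st}}\Xi)[D^{\mathrm{st}}(\Xi)\to \Xi_0$ and $\Xi$ agree on all standard inputs$]$;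 these constants do not count as parameters in (iv). NOTATION. $\alpha\leq_11$ means $\alpha^1$ is a $0$-$1$ sequence; $\overline{\alpha}n$ is the (code of the) initial segment of $\alpha$ of length $n$; "$T^1\leq_11$" means that $T$ represents a binary tree. PRINCIPLES. $\mathrm{FAN}$: for all binary trees $T^1\leq_11$, $(\forall\alpha^1\leq_11)(\exists n^0)(\overline{\alpha}n\notin T)\to(\exists k_0^0)(\forall\alpha^1\leq_11)(\exists n^0\leq k_0)(\overline{\alpha}n\notin T)$. $\mathrm{FAN}^*$: $\mathrm{FAN}^{\mathrm{st}}$ with the quantifier $(\forall^{\mathrm{st}}\alpha\leq_11)$ in the consequent replaced by $(\forall\alpha\leq_11)$. $\mathrm{UFAN}_2$: there is $\Phi^{(1\times2)\to0}$ such that for all $T^1\leq_11$ and $g^2$, $(\forall\alpha\leq_11)(\overline{\alpha}g(\alpha)\notin T)\to(\forall\alpha\leq_11)(\exists n\leq\Phi(T,g))(\overline{\alpha}n\notin T)$. -}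

module Defs where

open import Data.Empty using (⊥)
open import Data.List.Base using (List; []; _∷_; map)
open import Data.List.Membership.Propositional using (_∈_)
open import Data.List.Relation.Unary.Any using (here; there)
open import Data.Product.Base using (_×_)
open import Data.Unit.Base using (⊤)
open import Relation.Binary.PropositionalEquality.Core using (refl)

infixr 30 _⇒_
infixl 31 _*
infixl 40 _·_
infix  45 _[_]
infix  45 _ˢᵗ
infix  25 _∈̇_
infix  26 ¬̇_
infixl 20 _▸_
infix  25 _≐_ _≤̇_ _<̇_
infixr 24 _∧̇_
infixr 23 _∨̇_
infixr 22 _⊃_
infix  21 _⇔_

data Ty : Set where
  nat : Ty
  _⇒_ : Ty → Ty → Ty
  _*  : Ty → Ty

𝟙 𝟚 : Ty
𝟙 = nat ⇒ nat
𝟚 = 𝟙 ⇒ nat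

Ctx : Set
Ctx = List Ty

-- The constants of each type in excess of those of the base theory.
Language : Set₁
Language = Ty → Set

ω-language : Language
ω-language _ = ⊥

-- A finite sequence of type σ * is given by its length and its entries:
-- seq f n is ⟨f 0, …, f (n ∸ 1)⟩, len s is its length and elt s i is its entry
-- with index i < len s.  R₀ is the recursor with values of type 0.
data Tm (L : Language) (Γ : Ctx) : Ty → Set where
  var  : ∀ {σ} → σ ∈ Γ → Tm L Γ σ
  _·_  : ∀ {σ τ} → Tm L Γ (σ ⇒ τ) → Tm L Γ σ → Tm L Γ τ
  K    : ∀ {σ τ} → Tm L Γ (σ ⇒ τ ⇒ σ)
  S    : ∀ {ρ σ τ} → Tm L Γ ((ρ ⇒ σ ⇒ τ) ⇒ (ρ ⇒ σ) ⇒ ρ ⇒ τ)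
  zero : Tm L Γ nat
  suc  : Tm L Γ (nat ⇒ nat)
  R₀   : Tm L Γ (nat ⇒ (nat ⇒ nat ⇒ nat) ⇒ nat ⇒ nat)
  len  : ∀ {σ} → Tm L Γ (σ * ⇒ nat)
  elt  : ∀ {σ} → Tm L Γ (σ * ⇒ nat ⇒ σ)
  seq  : ∀ {σ} → Tm L Γ ((nat ⇒ σ) ⇒ nat ⇒ σ *)
  con  : ∀ {σ} → L σ → Tm L Γ σ

-- The bounded number quantifiers ∀<̇ t and ∃<̇ t (the bound variable ranges over
-- numbers below t) are primitive, because relativisation to st skips them.
data Fm (L : Language) : Ctx → Set where
  _≐_  : ∀ {Γ} → Tm L Γ nat → Tm L Γ nat → Fm L Γ
  st   : ∀ {Γ σ} → Tm L Γ σ → Fm L Γ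
  ⊥̇    : ∀ {Γ} → Fm L Γ
  _∧̇_  : ∀ {Γ} → Fm L Γ → Fm L Γ → Fm L Γ
  _∨̇_  : ∀ {Γ} → Fm L Γ → Fm L Γ → Fm L Γ
  _⊃_  : ∀ {Γ} → Fm L Γ → Fm L Γ → Fm L Γ
  ∀̇    : ∀ {Γ} (σ : Ty) → Fm L (σ ∷ Γ) → Fm L Γ
  ∃̇    : ∀ {Γ} (σ : Ty) → Fm L (σ ∷ Γ) → Fm L Γ
  ∀<̇   : ∀ {Γ} → Tm L Γ nat → Fm L (nat ∷ Γ) → Fm L Γ
  ∃<̇   : ∀ {Γ} → Tm L Γ nat → Fm L (nat ∷ Γ) → Fm L Γ

¬̇_ : ∀ {L Γ} → Fm L Γ → Fm L Γ
¬̇ A = A ⊃ ⊥̇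

_⇔_ : ∀ {L Γ} → Fm L Γ → Fm L Γ → Fm L Γ
A ⇔ B = (A ⊃ B) ∧̇ (B ⊃ A)

v0 : ∀ {L Γ σ} → Tm L (σ ∷ Γ) σ
v0 = var (here refl)

v1 : ∀ {L Γ σ τ} → Tm L (τ ∷ σ ∷ Γ) σ
v1 = var (there (here refl))

v2 : ∀ {L Γ ρ σ τ} → Tm L (ρ ∷ τ ∷ σ ∷ Γ) σ
v2 = var (there (there (here refl)))

v3 : ∀ {L Γ ρ₁ ρ₂ ρ₃ σ} → Tm L (ρ₁ ∷ ρ₂ ∷ ρ₃ ∷ σ ∷ Γ) σ
v3 = var (there (there (there (here refl))))

Ren : Ctx → Ctx → Set
Ren Γ Δ = ∀ {σ} → σ ∈ Γ → σ ∈ Δ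

empty : ∀ {Γ} → Ren [] Γ
empty ()

only : ∀ {Γ σ} → Ren (σ ∷ []) (σ ∷ Γ)
only (here e) = here e

insert₂ : ∀ {Γ ρ σ τ} → Ren (σ ∷ τ ∷ Γ) (σ ∷ τ ∷ ρ ∷ Γ)
insert₂ (here e)          = here e
insert₂ (there (here e))  = there (here e)
insert₂ (there (there x)) = there (there (there x))

Sub : Language → Ctx → Ctx → Set
Sub L Γ Δ = ∀ {σ} → σ ∈ Γ → Tm L Δ σ

subTm : ∀ {L Γ Δ σ} → Sub L Γ Δ → Tm L Γ σ → Tm L Δ σ
subTm θ (var x) = θ x
subTm θ (t · u) = subTm θ t · subTm θ u
subTm θ K       = K
subTm θ S       = S
subTm θ zero    = zero
subTm θ suc     = suc
subTm θ R₀      = R₀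
subTm θ len     = len
subTm θ elt     = elt
subTm θ seq     = seq
subTm θ (con c) = con c

renTm : ∀ {L Γ Δ σ} → Ren Γ Δ → Tm L Γ σ → Tm L Δ σ
renTm r = subTm (λ x → var (r x))

wkTm : ∀ {L Γ σ τ} → Tm L Γ σ → Tm L (τ ∷ Γ) σ
wkTm = renTm there

_▸_ : ∀ {L Γ Δ σ} → Sub L Γ Δ → Tm L Δ σ → Sub L (σ ∷ Γ) Δ
(θ ▸ t) (here refl) = t
(θ ▸ t) (there x)   = θ x

lift : ∀ {L Γ Δ σ} → Sub L Γ Δ → Sub L (σ ∷ Γ) (σ ∷ Δ)
lift θ = (λ x → wkTm (θ x)) ▸ v0

subFm : ∀ {L Γ Δ} → Sub L Γ Δ → Fm L Γ → Fm L Δ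
subFm θ (t ≐ u)  = subTm θ t ≐ subTm θ u
subFm θ (st t)   = st (subTm θ t)
subFm θ ⊥̇        = ⊥̇
subFm θ (A ∧̇ B)  = subFm θ A ∧̇ subFm θ B
subFm θ (A ∨̇ B)  = subFm θ A ∨̇ subFm θ B
subFm θ (A ⊃ B)  = subFm θ A ⊃ subFm θ B
subFm θ (∀̇ σ A)  = ∀̇ σ (subFm (lift θ) A)
subFm θ (∃̇ σ A)  = ∃̇ σ (subFm (lift θ) A)
subFm θ (∀<̇ t A) = ∀<̇ (subTm θ t) (subFm (lift θ) A)
subFm θ (∃<̇ t A) = ∃<̇ (subTm θ t) (subFm (lift θ) A)

renFm : ∀ {L Γ Δ} → Ren Γ Δ → Fm L Γ → Fm L Δ
renFm r = subFm (λ x → var (r x))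

wkFm : ∀ {L Γ τ} → Fm L Γ → Fm L (τ ∷ Γ)
wkFm = renFm there

_[_] : ∀ {L Γ σ} → Fm L (σ ∷ Γ) → Tm L Γ σ → Fm L Γ
A [ t ] = subFm (var ▸ t) A

expandTm : ∀ {L Γ σ} → Tm ω-language Γ σ → Tm L Γ σ
expandTm (var x) = var x
expandTm (t · u) = expandTm t · expandTm u
expandTm K       = K
expandTm S       = S
expandTm zero    = zero
expandTm suc     = suc
expandTm R₀      = R₀
expandTm len     = len
expandTm elt     = elt
expandTm seq     = seq

expandFm : ∀ {L Γ} → Fm ω-language Γ → Fm L Γ
expandFm (t ≐ u)  = expandTm t ≐ expandTm u
expandFm (st t)   = st (expandTm t)
expandFm ⊥̇        = ⊥̇
expandFm (A ∧̇ B)  = expandFm A ∧̇ expandFm B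
expandFm (A ∨̇ B)  = expandFm A ∨̇ expandFm B
expandFm (A ⊃ B)  = expandFm A ⊃ expandFm B
expandFm (∀̇ σ A)  = ∀̇ σ (expandFm A)
expandFm (∃̇ σ A)  = ∃̇ σ (expandFm A)
expandFm (∀<̇ t A) = ∀<̇ (expandTm t) (expandFm A)
expandFm (∃<̇ t A) = ∃<̇ (expandTm t) (expandFm A)

-- Bracket abstraction: ƛ t is the combinatory term for λx.t.  Subterms in which
-- x does not occur are abstracted as a whole, which keeps closed terms small.
distribute : ∀ {L Γ ρ σ τ} → Tm L Γ (ρ ⇒ σ ⇒ τ) → Tm L Γ (ρ ⇒ σ) → Tm L Γ (ρ ⇒ τ)
distribute (K · t) (K · u) = K · (t · u)
distribute t       u       = S · t · u

ƛ : ∀ {L Γ σ τ} → Tm L (σ ∷ Γ) τ → Tm L Γ (σ ⇒ τ)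
ƛ {σ = σ} (var (here refl)) = S · K · K {τ = σ}
ƛ (var (there x)) = K · var x
ƛ (t · u) = distribute (ƛ t) (ƛ u)
ƛ K       = K · K
ƛ S       = K · S
ƛ zero    = K · zero
ƛ suc     = K · suc
ƛ R₀      = K · R₀
ƛ len     = K · len
ƛ elt     = K · elt
ƛ seq     = K · seq
ƛ (con c) = K · con c

add monus triangle pair : ∀ {L Γ} → Tm L Γ (nat ⇒ nat ⇒ nat)

one : ∀ {L Γ} → Tm L Γ nat
one = suc · zero

pred : ∀ {L Γ} → Tm L Γ (nat ⇒ nat)
pred = R₀ · zero · K

add   = ƛ (ƛ (R₀ · v1 · (K · suc) · v0))
monus = ƛ (ƛ (R₀ · v1 · (K · pred) · v0))

-- triangle x y = (0 + 1 + … + (x + y)), and pair is Cantor's bijection.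
triangle = ƛ (ƛ (R₀ · zero · ƛ (ƛ (add · v0 · (suc · v1))) · (add · v1 · v0)))
pair     = ƛ (ƛ (add · (triangle · v1 · v0) · v0))

-- Coding of finite number sequences: the empty sequence has code 0, and
-- extending the sequence with code c by x gives code 1 + pair c x.  This is a
-- bijection between finite sequences and numbers.  (The recursor passes the
-- index as v1 and the previous value as v0.)
initial : ∀ {L Γ} → Tm L Γ (𝟙 ⇒ nat ⇒ nat)
initial = ƛ (ƛ (R₀ · zero · ƛ (ƛ (suc · (pair · v0 · (v3 · v1)))) · v0))

_≤̇_ _<̇_ : ∀ {L Γ} → Tm L Γ nat → Tm L Γ nat → Fm L Γ
t ≤̇ u = monus · t · u ≐ zero
t <̇ u = suc · t ≤̇ u

∀≤̇ ∃≤̇ : ∀ {L Γ} → Tm L Γ nat → Fm L (nat ∷ Γ) → Fm L Γ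
∀≤̇ t = ∀<̇ (suc · t)
∃≤̇ t = ∃<̇ (suc · t)

Eq : ∀ {L Γ} (σ : Ty) → Tm L Γ σ → Tm L Γ σ → Fm L Γ
Eq nat     t u = t ≐ u
Eq (σ ⇒ τ) t u = ∀̇ σ (Eq τ (wkTm t · v0) (wkTm u · v0))
Eq (σ *)   t u = (len · t ≐ len · u)
              ∧̇ ∀<̇ (len · t) (Eq σ (elt · wkTm t · v0) (elt · wkTm u · v0))

_∈̇_ : ∀ {L Γ σ} → Tm L Γ σ → Tm L Γ (σ *) → Fm L Γ
_∈̇_ {σ = σ} t s = ∃<̇ (len · s) (Eq σ (wkTm t) (elt · wkTm s · v0))

∀ˢᵗ ∃ˢᵗ : ∀ {L Γ} (σ : Ty) → Fm L (σ ∷ Γ) → Fm L Γ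
∀ˢᵗ σ A = ∀̇ σ (st v0 ⊃ A)
∃ˢᵗ σ A = ∃̇ σ (st v0 ∧̇ A)

_ˢᵗ : ∀ {L Γ} → Fm L Γ → Fm L Γ
(t ≐ u)  ˢᵗ = t ≐ u
(st t)   ˢᵗ = st t
⊥̇        ˢᵗ = ⊥̇
(A ∧̇ B)  ˢᵗ = (A ˢᵗ) ∧̇ (B ˢᵗ)
(A ∨̇ B)  ˢᵗ = (A ˢᵗ) ∨̇ (B ˢᵗ)
(A ⊃ B)  ˢᵗ = (A ˢᵗ) ⊃ (B ˢᵗ)
(∀̇ σ A)  ˢᵗ = ∀ˢᵗ σ (A ˢᵗ)
(∃̇ σ A)  ˢᵗ = ∃ˢᵗ σ (A ˢᵗ)
(∀<̇ t A) ˢᵗ = ∀<̇ t (A ˢᵗ)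
(∃<̇ t A) ˢᵗ = ∃<̇ t (A ˢᵗ)

Internal : ∀ {L Γ} → Fm L Γ → Set
Internal (t ≐ u)  = ⊤
Internal (st t)   = ⊥
Internal ⊥̇        = ⊤
Internal (A ∧̇ B)  = Internal A × Internal B
Internal (A ∨̇ B)  = Internal A × Internal B
Internal (A ⊃ B)  = Internal A × Internal B
Internal (∀̇ σ A)  = Internal A
Internal (∃̇ σ A)  = Internal A
Internal (∀<̇ t A) = Internal A
Internal (∃<̇ t A) = Internal A

-- Built from equations of type 0 by connectives; in particular internal.
QuantifierFree : ∀ {L Γ} → Fm L Γ → Set
QuantifierFree (t ≐ u)  = ⊤
QuantifierFree (st t)   = ⊥
QuantifierFree ⊥̇        = ⊤
QuantifierFree (A ∧̇ B)  = QuantifierFree A × QuantifierFree B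
QuantifierFree (A ∨̇ B)  = QuantifierFree A × QuantifierFree B
QuantifierFree (A ⊃ B)  = QuantifierFree A × QuantifierFree B
QuantifierFree (∀̇ σ A)  = ⊥
QuantifierFree (∃̇ σ A)  = ⊥
QuantifierFree (∀<̇ t A) = ⊥
QuantifierFree (∃<̇ t A) = ⊥

-- Axioms may have free variables, read as parameters.
Theory : Language → Set₁
Theory L = ∀ {Γ} → Fm L Γ → Set

data Proof {L : Language} (T : Theory L) : (Γ : Ctx) → List (Fm L Γ) → Fm L Γ → Set where
  ax  : ∀ {Γ Φ A} → T A → Proof T Γ Φ A
  hyp : ∀ {Γ Φ A} → A ∈ Φ → Proof T Γ Φ A
  raa : ∀ {Γ Φ A} → Proof T Γ ((¬̇ A) ∷ Φ) ⊥̇ → Proof T Γ Φ A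
  ⊃I  : ∀ {Γ Φ A B} → Proof T Γ (A ∷ Φ) B → Proof T Γ Φ (A ⊃ B)
  ⊃E  : ∀ {Γ Φ A B} → Proof T Γ Φ (A ⊃ B) → Proof T Γ Φ A → Proof T Γ Φ B
  ∧I  : ∀ {Γ Φ A B} → Proof T Γ Φ A → Proof T Γ Φ B → Proof T Γ Φ (A ∧̇ B)
  ∧E₁ : ∀ {Γ Φ A B} → Proof T Γ Φ (A ∧̇ B) → Proof T Γ Φ A
  ∧E₂ : ∀ {Γ Φ A B} → Proof T Γ Φ (A ∧̇ B) → Proof T Γ Φ B
  ∨I₁ : ∀ {Γ Φ A B} → Proof T Γ Φ A → Proof T Γ Φ (A ∨̇ B)
  ∨I₂ : ∀ {Γ Φ A B} → Proof T Γ Φ B → Proof T Γ Φ (A ∨̇ B)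
  ∨E  : ∀ {Γ Φ A B C} → Proof T Γ Φ (A ∨̇ B) →
        Proof T Γ (A ∷ Φ) C → Proof T Γ (B ∷ Φ) C → Proof T Γ Φ C
  ∀I  : ∀ {Γ Φ σ A} → Proof T (σ ∷ Γ) (map wkFm Φ) A → Proof T Γ Φ (∀̇ σ A)
  ∀E  : ∀ {Γ Φ σ A} → Proof T Γ Φ (∀̇ σ A) → (t : Tm L Γ σ) → Proof T Γ Φ (A [ t ])
  ∃I  : ∀ {Γ Φ σ A} (t : Tm L Γ σ) → Proof T Γ Φ (A [ t ]) → Proof T Γ Φ (∃̇ σ A)
  ∃E  : ∀ {Γ Φ σ A C} → Proof T Γ Φ (∃̇ σ A) →
        Proof T (σ ∷ Γ) (A ∷ map wkFm Φ) (wkFm C) → Proof T Γ Φ C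

  ∀<-def : ∀ {Γ Φ t A} → Proof T Γ Φ (∀<̇ t A ⇔ ∀̇ nat ((v0 <̇ wkTm t) ⊃ A))
  ∃<-def : ∀ {Γ Φ t A} → Proof T Γ Φ (∃<̇ t A ⇔ ∃̇ nat ((v0 <̇ wkTm t) ∧̇ A))

_⊢_ : ∀ {L} → Theory L → Fm L [] → Set
T ⊢ A = Proof T [] [] A

infix 3 _⊢_

data QF-AC {L : Language} (σ τ : Ty) {Γ : Ctx} : Fm L Γ → Set where
  qf-ac : (A : Fm L (τ ∷ σ ∷ Γ)) → QuantifierFree A →
          QF-AC σ τ (∀̇ σ (∃̇ τ A) ⊃
                     ∃̇ (σ ⇒ τ) (∀̇ σ (subFm (((λ x → var (there (there x))) ▸ v0) ▸ (v1 · v0)) A)))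

data RCA₀^ω {L : Language} {Γ : Ctx} : Fm L Γ → Set where
  ≐-refl  : (t : Tm L Γ nat) → RCA₀^ω (t ≐ t)
  ≐-eucl  : (t u v : Tm L Γ nat) → RCA₀^ω (t ≐ u ⊃ t ≐ v ⊃ u ≐ v)
  ext     : ∀ {ρ τ} (φ : Tm L Γ (ρ ⇒ τ)) (t u : Tm L Γ ρ) →
            RCA₀^ω (Eq ρ t u ⊃ Eq τ (φ · t) (φ · u))
  K-eq    : ∀ {σ τ} (t : Tm L Γ σ) (u : Tm L Γ τ) → RCA₀^ω (Eq σ (K · t · u) t)
  S-eq    : ∀ {ρ σ τ} (t : Tm L Γ (ρ ⇒ σ ⇒ τ)) (u : Tm L Γ (ρ ⇒ σ)) (v : Tm L Γ ρ) →
            RCA₀^ω (Eq τ (S · t · u · v) (t · v · (u · v)))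
  suc≢0   : (t : Tm L Γ nat) → RCA₀^ω (¬̇ (suc · t ≐ zero))
  suc-inj : (t u : Tm L Γ nat) → RCA₀^ω (suc · t ≐ suc · u ⊃ t ≐ u)
  R₀-zero : ∀ t f → RCA₀^ω (R₀ · t · f · zero ≐ t)
  R₀-suc  : ∀ t f n → RCA₀^ω (R₀ · t · f · (suc · n) ≐ f · n · (R₀ · t · f · n))
  len-seq : ∀ {σ} (f : Tm L Γ (nat ⇒ σ)) n → RCA₀^ω (len · (seq · f · n) ≐ n)
  elt-seq : ∀ {σ} (f : Tm L Γ (nat ⇒ σ)) n i →
            RCA₀^ω (i <̇ n ⊃ Eq σ (elt · (seq · f · n) · i) (f · i))
  qf-ind  : (A : Fm L (nat ∷ Γ)) → QuantifierFree A →
            RCA₀^ω (A [ zero ] ⊃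
                    ∀̇ nat (A ⊃ subFm ((λ x → var (there x)) ▸ (suc · v0)) A) ⊃
                    ∀̇ nat A)
  choice  : ∀ {A} → QF-AC 𝟙 nat A → RCA₀^ω A

-- A choice of constants Ξ₀, each with the internal formula D(Ξ), without
-- parameters, that specifies it uniquely.
record Specification : Set₁ where
  field
    Con      : Language
    D        : ∀ {τ} → Con τ → Fm ω-language (τ ∷ [])
    internal : ∀ {τ} (c : Con τ) → Internal (D c)
    unique   : ∀ {τ} (c : Con τ) →
               RCA₀^ω ⊢ ∀̇ τ (∀̇ τ (wkFm (D c) ⊃ renFm only (D c) ⊃ Eq τ v1 v0))

open Specification public

module _ (𝒮 : Specification) where

  data RCA₀^Ω {Γ : Ctx} : Fm (Con 𝒮) Γ → Set where
    base : ∀ {A} → RCA₀^ω A → RCA₀^Ω A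

    st-resp   : ∀ {σ} (t u : Tm (Con 𝒮) Γ σ) → RCA₀^Ω (Eq σ t u ⊃ st t ⊃ st u)
    st-closed : ∀ {σ} (t : Tm (Con 𝒮) [] σ) → RCA₀^Ω (st (renTm empty t))
    st-app    : ∀ {σ τ} (f : Tm (Con 𝒮) Γ (σ ⇒ τ)) (t : Tm (Con 𝒮) Γ σ) →
                RCA₀^Ω (st f ⊃ st t ⊃ st (f · t))
    st-below  : (t u : Tm (Con 𝒮) Γ nat) → RCA₀^Ω (st u ⊃ t ≤̇ u ⊃ st t)

    -- φ(z, y) has z as v0 and y as v1.
    idealization : ∀ {σ τ} (φ : Fm (Con 𝒮) (σ ∷ τ ∷ Γ)) → Internal φ →
      RCA₀^Ω (∀ˢᵗ (σ *) (∃̇ τ (∀̇ σ ((v0 ∈̇ v2) ⊃ renFm insert₂ φ))) ⊃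
              ∃̇ τ (∀ˢᵗ σ φ))

    -- φ(x, y) has y as v0 and x as v1.
    HAC-int : ∀ {ρ τ} (φ : Fm (Con 𝒮) (τ ∷ ρ ∷ Γ)) → Internal φ →
      RCA₀^Ω (∀ˢᵗ ρ (∃ˢᵗ τ φ) ⊃
              ∃ˢᵗ (ρ ⇒ τ *) (∀ˢᵗ ρ (∃̇ τ ((v0 ∈̇ (v2 · v1)) ∧̇ renFm insert₂ φ))))

    PF-TP∀ : ∀ {τ} (φ : Fm (Con 𝒮) (τ ∷ [])) → Internal φ →
      RCA₀^Ω (∀ˢᵗ τ (renFm only φ) ⊃ ∀̇ τ (renFm only φ))

    spec : ∀ {τ} (c : Con 𝒮 τ) →
      RCA₀^Ω (st (con c) ∧̇
              ∀ˢᵗ τ (renFm only (expandFm (D 𝒮 c) ˢᵗ) ⊃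
                     (Eq τ (con c) v0) ˢᵗ))

  data RCA₀^Ω+QF-AC²⁰ {Γ : Ctx} : Fm (Con 𝒮) Γ → Set where
    base   : ∀ {A} → RCA₀^Ω A → RCA₀^Ω+QF-AC²⁰ A
    choice : ∀ {A} → QF-AC 𝟚 nat A → RCA₀^Ω+QF-AC²⁰ A

-- α ≤₁ 1
Binary : ∀ {L Γ} → Tm L Γ 𝟙 → Fm L Γ
Binary α = ∀̇ nat (wkTm α · v0 ≤̇ one)

-- ᾱn ∈ T
_∣_∈ᵀ_ : ∀ {L Γ} → Tm L Γ 𝟙 → Tm L Γ nat → Tm L Γ 𝟙 → Fm L Γ
α ∣ n ∈ᵀ T = T · (initial · α · n) ≐ one

_∣_∉ᵀ_ : ∀ {L Γ} → Tm L Γ 𝟙 → Tm L Γ nat → Tm L Γ 𝟙 → Fm L Γ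
α ∣ n ∉ᵀ T = ¬̇ (α ∣ n ∈ᵀ T)

infix 26 _∣_∈ᵀ_ _∣_∉ᵀ_

-- T is the characteristic function of a set of finite binary sequences closed
-- under initial segments.  Every finite sequence is β̄m for some β and m.
BinaryTree : ∀ {L Γ} → Tm L Γ 𝟙 → Fm L Γ
BinaryTree T = Binary T ∧̇
  ∀̇ 𝟙 (∀̇ nat (v1 ∣ v0 ∈ᵀ wkTm (wkTm T) ⊃
    ∀<̇ v0 ((v2 · v0 ≤̇ one) ∧̇ (v2 ∣ v0 ∈ᵀ wkTm (wkTm (wkTm T))))))

FAN : ∀ {L} → Fm L []
FAN = ∀̇ 𝟙 (BinaryTree v0 ⊃
  ∀̇ 𝟙 (Binary v0 ⊃ ∃̇ nat (v1 ∣ v0 ∉ᵀ v2)) ⊃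
  ∃̇ nat (∀̇ 𝟙 (Binary v0 ⊃ ∃≤̇ v1 (v1 ∣ v0 ∉ᵀ v3))))

FAN* : ∀ {L} → Fm L []
FAN* = ∀ˢᵗ 𝟙 ((BinaryTree v0) ˢᵗ ⊃
  ∀ˢᵗ 𝟙 ((Binary v0) ˢᵗ ⊃ ∃ˢᵗ nat (v1 ∣ v0 ∉ᵀ v2)) ⊃
  ∃ˢᵗ nat (∀̇ 𝟙 (Binary v0 ⊃ ∃≤̇ v1 (v1 ∣ v0 ∉ᵀ v3))))

-- Φ is curried: Φ(T, g) is Φ · T · g.
UFAN₂ : ∀ {L} → Fm L []
UFAN₂ = ∃̇ (𝟙 ⇒ 𝟚 ⇒ nat) (∀̇ 𝟙 (BinaryTree v0 ⊃ ∀̇ 𝟚 (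
  ∀̇ 𝟙 (Binary v0 ⊃ v0 ∣ v1 · v0 ∉ᵀ v2) ⊃
  ∀̇ 𝟙 (Binary v0 ⊃ ∃≤̇ (v3 · v2 · v1) (v1 ∣ v0 ∉ᵀ v3)))))

{-# OPTIONS --safe #-}

-- Part 1.  Every initial segment α|k of standard length k of a binary α has a
-- standard code, hence extends to a standard sequence; this turns FANˢᵗ into FAN*.
-- The hypothesis of UFAN₂ˢᵗ has the form ∀ˢᵗ α, so FANˢᵗ says that for all standard
-- T and g there is a standard pair of a bound k and a purported counterexample α, and
-- HAC_int makes this choice finitely many-valued; the sum of the candidates for k is
-- Φ(T, g).  Conversely HAC_int yields a standard g from the hypothesis of FANˢᵗ.
--
-- Part 2.  A failure of FAN comes, by QF-AC¹⁰, with a modulus g, and PF-TP makes the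
-- pair (T, g) standard, so FANˢᵗ implies FAN.  From FAN one obtains a functional
-- Θ mapping (T, g) to a bound k or a counterexample α; it gives UFAN₂ at once, and
-- FANˢᵗ because PF-TP makes Θ standard.  If for all (T, g) a bound exists or an
-- eventually trivial α is a counterexample, then Θ is obtained from QF-AC²⁰, the
-- matrix being quantifier-free.  Otherwise there are a T with a path α and a g that
-- is unbounded on sequences converging to α, so Grilliot's trick yields ∃², and with
-- it the height of T or else the leftmost path of T.

module Submission where

open import Defs
open import Data.List.Base using (List; []; _∷_; map)
open import Data.List.Membership.Propositional using (_∈_)
open import Data.List.Membership.Propositional.Properties using (∈-map⁺; ∈-map⁻)
open import Data.List.Relation.Unary.Any using (here; there)
open import Data.Nat.Base using (ℕ)
import Data.Nat.Base as ℕ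
open import Data.Product.Base using (_×_; _,_; proj₁; proj₂; Σ)
open import Relation.Binary.PropositionalEquality
  using (_≡_; refl; sym; trans; cong; cong₂; subst)

-- Restrictions in the axioms shape the argument. Transfer admits no parameters, so only closed
-- statements are transferred, with T and g merged into one object of type 2. The modulus g belongs
-- to it because a bare existence statement would not make the level at which a standard α leaves a
-- standard T standard, whereas g(α) is. In the standard world the hypothesis of UFAN₂ is available
-- for standard α only, so a functional that relies on it for all α is of no direct use there. A
-- functional that answers with a bound or a counterexample relies on no hypothesis, and a
-- counterexample computed from standard T and g is standard, hence excluded. Choice over type 2
-- returns only numbers, so a counterexample can come from it only through a finite code; where no
-- finite code serves, that very failure has to be exploited. Finally, relativised binarity controls
-- standard entries only, so sequences are cut down to the values 0 and 1 by a term, and binarity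
-- need not be assumed.

-- Substitution calculus

infix 4 _≗ˢ_

_≗ˢ_ : ∀ {L Γ Δ} → Sub L Γ Δ → Sub L Γ Δ → Set
_≗ˢ_ {Γ = Γ} θ θ′ = ∀ {σ} (x : σ ∈ Γ) → θ x ≡ θ′ x

infixl 30 _⨟_
_⨟_ : ∀ {L Γ Δ Ε} → Sub L Γ Δ → Sub L Δ Ε → Sub L Γ Ε
(θ ⨟ θ′) x = subTm θ′ (θ x)

↑ : ∀ {L Γ σ} → Sub L Γ (σ ∷ Γ)
↑ x = var (there x)

subTm-cong : ∀ {L Γ Δ σ} {θ θ′ : Sub L Γ Δ} → θ ≗ˢ θ′ → (t : Tm L Γ σ) → subTm θ t ≡ subTm θ′ t
subTm-cong e (var x) = e x
subTm-cong e (t · u) = cong₂ _·_ (subTm-cong e t) (subTm-cong e u)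
subTm-cong e K       = refl
subTm-cong e S       = refl
subTm-cong e zero    = refl
subTm-cong e suc     = refl
subTm-cong e R₀      = refl
subTm-cong e len     = refl
subTm-cong e elt     = refl
subTm-cong e seq     = refl
subTm-cong e (con c) = refl

subTm-⨟ : ∀ {L Γ Δ Ε σ} (θ : Sub L Γ Δ) (θ′ : Sub L Δ Ε) (t : Tm L Γ σ) →
          subTm θ′ (subTm θ t) ≡ subTm (θ ⨟ θ′) t
subTm-⨟ θ θ′ (var x) = refl
subTm-⨟ θ θ′ (t · u) = cong₂ _·_ (subTm-⨟ θ θ′ t) (subTm-⨟ θ θ′ u)
subTm-⨟ θ θ′ K       = refl
subTm-⨟ θ θ′ S       = refl
subTm-⨟ θ θ′ zero    = refl
subTm-⨟ θ θ′ suc     = refl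
subTm-⨟ θ θ′ R₀      = refl
subTm-⨟ θ θ′ len     = refl
subTm-⨟ θ θ′ elt     = refl
subTm-⨟ θ θ′ seq     = refl
subTm-⨟ θ θ′ (con c) = refl

subTm-var : ∀ {L Γ σ} (t : Tm L Γ σ) → subTm var t ≡ t
subTm-var (var x) = refl
subTm-var (t · u) = cong₂ _·_ (subTm-var t) (subTm-var u)
subTm-var K       = refl
subTm-var S       = refl
subTm-var zero    = refl
subTm-var suc     = refl
subTm-var R₀      = refl
subTm-var len     = refl
subTm-var elt     = refl
subTm-var seq     = refl
subTm-var (con c) = refl

wkTm-▸ : ∀ {L Γ Δ σ τ} (θ : Sub L Γ Δ) (u : Tm L Δ τ) (t : Tm L Γ σ) →
         subTm (θ ▸ u) (wkTm t) ≡ subTm θ t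
wkTm-▸ θ u t = subTm-⨟ ↑ (θ ▸ u) t

wkTm-[] : ∀ {L Γ σ τ} (u : Tm L Γ τ) (t : Tm L Γ σ) → subTm (var ▸ u) (wkTm t) ≡ t
wkTm-[] u t = trans (wkTm-▸ var u t) (subTm-var t)

wkTm-lift : ∀ {L Γ Δ σ τ} (θ : Sub L Γ Δ) (t : Tm L Γ σ) →
            subTm (lift {σ = τ} θ) (wkTm t) ≡ wkTm (subTm θ t)
wkTm-lift θ t = trans (subTm-⨟ ↑ (lift θ) t) (sym (subTm-⨟ θ ↑ t))

lift-cong : ∀ {L Γ Δ τ} {θ θ′ : Sub L Γ Δ} → θ ≗ˢ θ′ → lift {σ = τ} θ ≗ˢ lift θ′
lift-cong e (here refl) = refl
lift-cong e (there x)   = cong wkTm (e x)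

lift-⨟ : ∀ {L Γ Δ Ε τ} (θ : Sub L Γ Δ) (θ′ : Sub L Δ Ε) → lift {σ = τ} θ ⨟ lift θ′ ≗ˢ lift (θ ⨟ θ′)
lift-⨟ θ θ′ (here refl) = refl
lift-⨟ θ θ′ (there x)   = wkTm-lift θ′ (θ x)

lift-var : ∀ {L Γ τ} → lift {L} {Γ} {Γ} {τ} var ≗ˢ var
lift-var (here refl) = refl
lift-var (there x)   = refl

lift-▸ : ∀ {L Γ Δ Ε τ} (θ : Sub L Γ Δ) (θ′ : Sub L Δ Ε) (u : Tm L Ε τ) → lift θ ⨟ (θ′ ▸ u) ≗ˢ (θ ⨟ θ′) ▸ u
lift-▸ θ θ′ u (here refl) = refl
lift-▸ θ θ′ u (there x)   = wkTm-▸ θ′ u (θ x)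

subFm-cong : ∀ {L Γ Δ} {θ θ′ : Sub L Γ Δ} → θ ≗ˢ θ′ → (A : Fm L Γ) → subFm θ A ≡ subFm θ′ A
subFm-cong e (t ≐ u)  = cong₂ _≐_ (subTm-cong e t) (subTm-cong e u)
subFm-cong e (st t)   = cong st (subTm-cong e t)
subFm-cong e ⊥̇        = refl
subFm-cong e (A ∧̇ B)  = cong₂ _∧̇_ (subFm-cong e A) (subFm-cong e B)
subFm-cong e (A ∨̇ B)  = cong₂ _∨̇_ (subFm-cong e A) (subFm-cong e B)
subFm-cong e (A ⊃ B)  = cong₂ _⊃_ (subFm-cong e A) (subFm-cong e B)
subFm-cong e (∀̇ σ A)  = cong (∀̇ σ) (subFm-cong (lift-cong e) A)
subFm-cong e (∃̇ σ A)  = cong (∃̇ σ) (subFm-cong (lift-cong e) A)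
subFm-cong e (∀<̇ t A) = cong₂ ∀<̇ (subTm-cong e t) (subFm-cong (lift-cong e) A)
subFm-cong e (∃<̇ t A) = cong₂ ∃<̇ (subTm-cong e t) (subFm-cong (lift-cong e) A)

subFm-⨟ : ∀ {L Γ Δ Ε} (θ : Sub L Γ Δ) (θ′ : Sub L Δ Ε) (A : Fm L Γ) →
          subFm θ′ (subFm θ A) ≡ subFm (θ ⨟ θ′) A
subFm-⨟-lift : ∀ {L Γ Δ Ε τ} (θ : Sub L Γ Δ) (θ′ : Sub L Δ Ε) (A : Fm L (τ ∷ Γ)) →
               subFm (lift θ′) (subFm (lift θ) A) ≡ subFm (lift (θ ⨟ θ′)) A
subFm-⨟ θ θ′ (t ≐ u)  = cong₂ _≐_ (subTm-⨟ θ θ′ t) (subTm-⨟ θ θ′ u)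
subFm-⨟ θ θ′ (st t)   = cong st (subTm-⨟ θ θ′ t)
subFm-⨟ θ θ′ ⊥̇        = refl
subFm-⨟ θ θ′ (A ∧̇ B)  = cong₂ _∧̇_ (subFm-⨟ θ θ′ A) (subFm-⨟ θ θ′ B)
subFm-⨟ θ θ′ (A ∨̇ B)  = cong₂ _∨̇_ (subFm-⨟ θ θ′ A) (subFm-⨟ θ θ′ B)
subFm-⨟ θ θ′ (A ⊃ B)  = cong₂ _⊃_ (subFm-⨟ θ θ′ A) (subFm-⨟ θ θ′ B)
subFm-⨟ θ θ′ (∀̇ σ A)  = cong (∀̇ σ) (subFm-⨟-lift θ θ′ A)
subFm-⨟ θ θ′ (∃̇ σ A)  = cong (∃̇ σ) (subFm-⨟-lift θ θ′ A)
subFm-⨟ θ θ′ (∀<̇ t A) = cong₂ ∀<̇ (subTm-⨟ θ θ′ t) (subFm-⨟-lift θ θ′ A)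
subFm-⨟ θ θ′ (∃<̇ t A) = cong₂ ∃<̇ (subTm-⨟ θ θ′ t) (subFm-⨟-lift θ θ′ A)
subFm-⨟-lift θ θ′ A = trans (subFm-⨟ (lift θ) (lift θ′) A) (subFm-cong (lift-⨟ θ θ′) A)

subFm-var : ∀ {L Γ} (A : Fm L Γ) → subFm var A ≡ A
subFm-var-lift : ∀ {L Γ τ} (A : Fm L (τ ∷ Γ)) → subFm (lift var) A ≡ A
subFm-var (t ≐ u)  = cong₂ _≐_ (subTm-var t) (subTm-var u)
subFm-var (st t)   = cong st (subTm-var t)
subFm-var ⊥̇        = refl
subFm-var (A ∧̇ B)  = cong₂ _∧̇_ (subFm-var A) (subFm-var B)
subFm-var (A ∨̇ B)  = cong₂ _∨̇_ (subFm-var A) (subFm-var B)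
subFm-var (A ⊃ B)  = cong₂ _⊃_ (subFm-var A) (subFm-var B)
subFm-var (∀̇ σ A)  = cong (∀̇ σ) (subFm-var-lift A)
subFm-var (∃̇ σ A)  = cong (∃̇ σ) (subFm-var-lift A)
subFm-var (∀<̇ t A) = cong₂ ∀<̇ (subTm-var t) (subFm-var-lift A)
subFm-var (∃<̇ t A) = cong₂ ∃<̇ (subTm-var t) (subFm-var-lift A)
subFm-var-lift A = trans (subFm-cong lift-var A) (subFm-var A)

subFm-lift-▸ : ∀ {L Γ Δ Ε τ} (θ : Sub L Γ Δ) (θ′ : Sub L Δ Ε) (u : Tm L Ε τ) (A : Fm L (τ ∷ Γ)) →
               subFm (θ′ ▸ u) (subFm (lift θ) A) ≡ subFm ((θ ⨟ θ′) ▸ u) A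
subFm-lift-▸ θ θ′ u A = trans (subFm-⨟ (lift θ) (θ′ ▸ u) A) (subFm-cong (lift-▸ θ θ′ u) A)

subFm-lift-[] : ∀ {L Γ Δ τ} (θ : Sub L Γ Δ) (u : Tm L Δ τ) (A : Fm L (τ ∷ Γ)) →
                subFm (lift θ) A [ u ] ≡ subFm (θ ▸ u) A
subFm-lift-[] θ u A = trans (subFm-lift-▸ θ var u A) (subFm-cong (λ
  { (here refl) → refl
  ; (there x)   → subTm-var (θ x) }) A)

wkFm-[v0] : ∀ {L Γ τ} (A : Fm L (τ ∷ Γ)) → subFm (lift ↑) A [ v0 ] ≡ A
wkFm-[v0] A = trans (subFm-lift-[] ↑ v0 A) (trans (subFm-cong (λ
  { (here refl) → refl
  ; (there x)   → refl }) A) (subFm-var A))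

subFm-Eq : ∀ {L Γ Δ} (θ : Sub L Γ Δ) σ (t u : Tm L Γ σ) →
           subFm θ (Eq σ t u) ≡ Eq σ (subTm θ t) (subTm θ u)
subFm-Eq θ nat     t u = refl
subFm-Eq θ (σ ⇒ τ) t u = cong (∀̇ σ) (trans (subFm-Eq (lift θ) τ _ _)
  (cong₂ (λ a b → Eq τ (a · v0) (b · v0)) (wkTm-lift θ t) (wkTm-lift θ u)))
subFm-Eq θ (σ *)   t u = cong (λ B → (len · subTm θ t ≐ len · subTm θ u) ∧̇ ∀<̇ (len · subTm θ t) B) (trans (subFm-Eq (lift θ) σ _ _)
  (cong₂ (λ a b → Eq σ (elt · a · v0) (elt · b · v0)) (wkTm-lift θ t) (wkTm-lift θ u)))

-- Derived rules of natural deduction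

module Logic {L : Language} {T : Theory L} where

  weaken : ∀ {Γ Φ Ψ} {A : Fm L Γ} → (∀ {B} → B ∈ Φ → B ∈ Ψ) → Proof T Γ Φ A → Proof T Γ Ψ A
  weaken-∷ : ∀ {Γ Φ Ψ} {A B : Fm L Γ} → (∀ {C} → C ∈ Φ → C ∈ Ψ) →
             Proof T Γ (B ∷ Φ) A → Proof T Γ (B ∷ Ψ) A
  weaken-map : ∀ {Γ σ Φ Ψ} {A : Fm L (σ ∷ Γ)} → (∀ {B} → B ∈ Φ → B ∈ Ψ) →
               Proof T (σ ∷ Γ) (map wkFm Φ) A → Proof T (σ ∷ Γ) (map wkFm Ψ) A
  weaken r (ax a)     = ax a
  weaken r (hyp x)    = hyp (r x)
  weaken r (raa p)    = raa (weaken-∷ r p)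
  weaken r (⊃I p)     = ⊃I (weaken-∷ r p)
  weaken r (⊃E p q)   = ⊃E (weaken r p) (weaken r q)
  weaken r (∧I p q)   = ∧I (weaken r p) (weaken r q)
  weaken r (∧E₁ p)    = ∧E₁ (weaken r p)
  weaken r (∧E₂ p)    = ∧E₂ (weaken r p)
  weaken r (∨I₁ p)    = ∨I₁ (weaken r p)
  weaken r (∨I₂ p)    = ∨I₂ (weaken r p)
  weaken r (∨E p q s) = ∨E (weaken r p) (weaken-∷ r q) (weaken-∷ r s)
  weaken r (∀I p)     = ∀I (weaken-map r p)
  weaken r (∀E p t)   = ∀E (weaken r p) t
  weaken r (∃I t p)   = ∃I t (weaken r p)
  weaken {Φ = Φ} {Ψ} r (∃E {A = A} p q) = ∃E (weaken r p) (weaken r′ q)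
    where
    r′ : ∀ {B} → B ∈ (A ∷ map wkFm Φ) → B ∈ (A ∷ map wkFm Ψ)
    r′ (here e)  = here e
    r′ (there x) with ∈-map⁻ wkFm x
    ... | _ , y , refl = there (∈-map⁺ wkFm (r y))
  weaken r ∀<-def     = ∀<-def
  weaken r ∃<-def     = ∃<-def
  weaken-∷ r = weaken (λ { (here e) → here e ; (there x) → there (r x) })
  weaken-map {Φ = Φ} {Ψ} r = weaken r′
    where
    r′ : ∀ {B} → B ∈ map wkFm Φ → B ∈ map wkFm Ψ
    r′ x with ∈-map⁻ wkFm x
    ... | _ , y , refl = ∈-map⁺ wkFm (r y)

  weak : ∀ {Γ Φ} {A B : Fm L Γ} → Proof T Γ Φ A → Proof T Γ (B ∷ Φ) A
  weak = weaken there

  h0 : ∀ {Γ Φ} {A : Fm L Γ} → Proof T Γ (A ∷ Φ) A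
  h0 = hyp (here refl)
  h1 : ∀ {Γ Φ} {A B : Fm L Γ} → Proof T Γ (B ∷ A ∷ Φ) A
  h1 = weak h0
  h2 : ∀ {Γ Φ} {A B C : Fm L Γ} → Proof T Γ (C ∷ B ∷ A ∷ Φ) A
  h2 = weak h1
  h3 : ∀ {Γ Φ} {A B C D : Fm L Γ} → Proof T Γ (D ∷ C ∷ B ∷ A ∷ Φ) A
  h3 = weak h2
  h4 : ∀ {Γ Φ} {A B C D E : Fm L Γ} → Proof T Γ (E ∷ D ∷ C ∷ B ∷ A ∷ Φ) A
  h4 = weak h3
  h5 : ∀ {Γ Φ} {A B C D E F : Fm L Γ} → Proof T Γ (F ∷ E ∷ D ∷ C ∷ B ∷ A ∷ Φ) A
  h5 = weak h4
  h6 : ∀ {Γ Φ} {A B C D E F G : Fm L Γ} → Proof T Γ (G ∷ F ∷ E ∷ D ∷ C ∷ B ∷ A ∷ Φ) A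
  h6 = weak h5
  h7 : ∀ {Γ Φ} {A B C D E F G H : Fm L Γ} → Proof T Γ (H ∷ G ∷ F ∷ E ∷ D ∷ C ∷ B ∷ A ∷ Φ) A
  h7 = weak h6
  h8 : ∀ {Γ Φ} {A B C D E F G H I : Fm L Γ} → Proof T Γ (I ∷ H ∷ G ∷ F ∷ E ∷ D ∷ C ∷ B ∷ A ∷ Φ) A
  h8 = weak h7

  infixl 4 _$_ _∙_
  _$_ : ∀ {Γ Φ} {A B : Fm L Γ} → Proof T Γ Φ (A ⊃ B) → Proof T Γ Φ A → Proof T Γ Φ B
  _$_ = ⊃E
  _∙_ : ∀ {Γ Φ σ} {A : Fm L (σ ∷ Γ)} → Proof T Γ Φ (∀̇ σ A) → (t : Tm L Γ σ) → Proof T Γ Φ (A [ t ])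
  _∙_ = ∀E

  infixr 4 _⨾_
  _⨾_ : ∀ {Γ Φ} {A B C : Fm L Γ} → Proof T Γ Φ (A ⊃ B) → Proof T Γ Φ (B ⊃ C) → Proof T Γ Φ (A ⊃ C)
  p ⨾ q = ⊃I (⊃E (weak q) (⊃E (weak p) h0))

  cut : ∀ {Γ Φ} {A B : Fm L Γ} → Proof T Γ Φ A → Proof T Γ (A ∷ Φ) B → Proof T Γ Φ B
  cut p q = ⊃E (⊃I q) p

  absurd : ∀ {Γ Φ} {A : Fm L Γ} → Proof T Γ Φ ⊥̇ → Proof T Γ Φ A
  absurd p = raa (weak p)

  em : ∀ {Γ Φ} (A : Fm L Γ) → Proof T Γ Φ (A ∨̇ ¬̇ A)
  em A = raa (⊃E h0 (∨I₂ (⊃I (⊃E h1 (∨I₁ h0)))))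

  cases : ∀ {Γ Φ} (A : Fm L Γ) {B : Fm L Γ} →
          Proof T Γ (A ∷ Φ) B → Proof T Γ (¬̇ A ∷ Φ) B → Proof T Γ Φ B
  cases A = ∨E (em A)

  module _ {Γ : Ctx} {Φ : List (Fm L Γ)} where

    -- In `p ∙ s ∙ t` the term `s` occurs weakened and then substituted back, which does not compute
    -- for an unknown `s`. After fusion into one simultaneous substitution, the instance of a
    -- concrete formula reduces to the expected one.
    inst₂ : ∀ {σ τ A} → Proof T Γ Φ (∀̇ σ (∀̇ τ A)) → ∀ s t → Proof T Γ Φ (subFm (var ▸ s ▸ t) A)
    inst₂ {A = A} p s t = subst (Proof T Γ Φ) (subFm-lift-[] _ t A) (p ∙ s ∙ t)

    inst₃ : ∀ {σ τ ρ A} → Proof T Γ Φ (∀̇ σ (∀̇ τ (∀̇ ρ A))) → ∀ s t u →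
            Proof T Γ Φ (subFm (var ▸ s ▸ t ▸ u) A)
    inst₃ {A = A} p s t u = subst (Proof T Γ Φ) (subFm-lift-[] _ u A) (inst₂ p s t ∙ u)

    inst₄ : ∀ {σ τ ρ ν A} → Proof T Γ Φ (∀̇ σ (∀̇ τ (∀̇ ρ (∀̇ ν A)))) → ∀ s t u v →
            Proof T Γ Φ (subFm (var ▸ s ▸ t ▸ u ▸ v) A)
    inst₄ {A = A} p s t u v = subst (Proof T Γ Φ) (subFm-lift-[] _ v A) (inst₃ p s t u ∙ v)

    inst₅ : ∀ {σ τ ρ ν κ A} → Proof T Γ Φ (∀̇ σ (∀̇ τ (∀̇ ρ (∀̇ ν (∀̇ κ A))))) → ∀ s t u v w →
            Proof T Γ Φ (subFm (var ▸ s ▸ t ▸ u ▸ v ▸ w) A)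
    inst₅ {A = A} p s t u v w = subst (Proof T Γ Φ) (subFm-lift-[] _ w A) (inst₄ p s t u v ∙ w)

    ∀<I : ∀ {t A} → Proof T (nat ∷ Γ) (v0 <̇ wkTm t ∷ map wkFm Φ) A → Proof T Γ Φ (∀<̇ t A)
    ∀<I p = ∧E₂ ∀<-def $ ∀I (⊃I p)

    ∀<E : ∀ {t A} → Proof T Γ Φ (∀<̇ t A) → ∀ i → Proof T Γ Φ (i <̇ t) → Proof T Γ Φ (A [ i ])
    ∀<E {t} p i q = ∧E₁ ∀<-def $ p ∙ i $ subst (λ u → Proof T Γ Φ (i <̇ u)) (sym (wkTm-[] i t)) q

    ∃<I : ∀ {t A} i → Proof T Γ Φ (i <̇ t) → Proof T Γ Φ (A [ i ]) → Proof T Γ Φ (∃<̇ t A)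
    ∃<I {t} i q p = ∧E₂ ∃<-def $ ∃I i (∧I (subst (λ u → Proof T Γ Φ (i <̇ u)) (sym (wkTm-[] i t)) q) p)

    ∃<E : ∀ {t A C} → Proof T Γ Φ (∃<̇ t A) →
          Proof T (nat ∷ Γ) (A ∷ v0 <̇ wkTm t ∷ map wkFm Φ) (wkFm C) → Proof T Γ Φ C
    ∃<E {A = A} p q = ∃E (∧E₁ ∃<-def $ p)
      (⊃I (⊃I (weaken r q)) $ ∧E₁ h0 $ ∧E₂ h0)
      where
      r : ∀ {B D B′} → B ∈ (A ∷ D ∷ map wkFm Φ) → B ∈ (A ∷ D ∷ B′ ∷ map wkFm Φ)
      r (here e)          = here e
      r (there (here e))  = there (here e)
      r (there (there x)) = there (there (there x))

-- Equality in all finite types and normalisation of combinatory terms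

module Equality {L : Language} {T : Theory L} (base : ∀ {Γ} {A : Fm L Γ} → RCA₀^ω A → T A) where
  open Logic {L} {T}

  rca : ∀ {Γ Φ} {A : Fm L Γ} → RCA₀^ω A → Proof T Γ Φ A
  rca a = ax (base a)

  Eq-cong₁ : ∀ {Γ Φ σ τ} {f g : Tm L Γ (σ ⇒ τ)} → Proof T Γ Φ (Eq (σ ⇒ τ) f g) →
             ∀ t → Proof T Γ Φ (Eq τ (f · t) (g · t))
  Eq-cong₁ {τ = τ} {f} {g} p t = subst (Proof T _ _)
    (trans (subFm-Eq (var ▸ t) τ _ _)
           (cong₂ (λ a b → Eq τ (a · t) (b · t)) (wkTm-[] t f) (wkTm-[] t g))) (p ∙ t)

  Eq-cong₂ : ∀ {Γ Φ σ τ} (f : Tm L Γ (σ ⇒ τ)) {t u} → Proof T Γ Φ (Eq σ t u) →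
             Proof T Γ Φ (Eq τ (f · t) (f · u))
  Eq-cong₂ f p = rca (ext f _ _) $ p

  wkHyp-Eq : ∀ {Γ σ τ Φ} {t u : Tm L Γ τ} → Proof T (σ ∷ Γ) Φ (wkFm (Eq τ t u)) →
             Proof T (σ ∷ Γ) Φ (Eq τ (wkTm t) (wkTm u))
  wkHyp-Eq {τ = τ} = subst (Proof T _ _) (subFm-Eq ↑ τ _ _)

  elt-Eq : ∀ {Γ Φ σ} {t u : Tm L Γ (σ *)} i → Proof T Γ Φ (Eq (σ *) t u) → Proof T Γ Φ (i <̇ len · t) →
           Proof T Γ Φ (Eq σ (elt · t · i) (elt · u · i))
  elt-Eq {σ = σ} {t} {u} i p q = subst (Proof T _ _)
    (trans (subFm-Eq (var ▸ i) σ _ _)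
           (cong₂ (λ a b → Eq σ (elt · a · i) (elt · b · i)) (wkTm-[] i t) (wkTm-[] i u)))
    (∀<E (∧E₂ p) i q)

  nat-sym : ∀ {Γ Φ} {t u : Tm L Γ nat} → Proof T Γ Φ (t ≐ u) → Proof T Γ Φ (u ≐ t)
  nat-sym p = rca (≐-eucl _ _ _) $ p $ rca (≐-refl _)

  nat-trans : ∀ {Γ Φ} {t u v : Tm L Γ nat} → Proof T Γ Φ (t ≐ u) → Proof T Γ Φ (u ≐ v) → Proof T Γ Φ (t ≐ v)
  nat-trans p q = rca (≐-eucl _ _ _) $ nat-sym p $ q

  <-congʳ : ∀ {Γ Φ} {i t u : Tm L Γ nat} → Proof T Γ Φ (t ≐ u) → Proof T Γ Φ (i <̇ t) → Proof T Γ Φ (i <̇ u)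
  <-congʳ {i = i} p q = nat-trans (nat-sym (Eq-cong₂ (monus · (suc · i)) p)) q

  Eq-refl : ∀ {Γ Φ} σ (t : Tm L Γ σ) → Proof T Γ Φ (Eq σ t t)
  Eq-refl nat     t = rca (≐-refl t)
  Eq-refl (σ ⇒ τ) t = ∀I (Eq-refl τ _)
  Eq-refl (σ *)   t = ∧I (rca (≐-refl _)) (∀<I (Eq-refl σ _))

  Eq-sym⊃ : ∀ {Γ Φ} σ (t u : Tm L Γ σ) → Proof T Γ Φ (Eq σ t u ⊃ Eq σ u t)
  Eq-sym⊃ nat     t u = ⊃I (nat-sym h0)
  Eq-sym⊃ (σ ⇒ τ) t u = ⊃I (∀I (Eq-sym⊃ τ _ _ $ Eq-cong₁ (wkHyp-Eq {τ = σ ⇒ τ} {t = t} {u} h0) v0))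
  Eq-sym⊃ (σ *)   t u = ⊃I (∧I (nat-sym (∧E₁ h0)) (∀<I (Eq-sym⊃ σ _ _ $
    elt-Eq v0 h (<-congʳ (nat-sym (∧E₁ h)) h0))))
    where
    h : Proof T _ _ (Eq (σ *) (wkTm t) (wkTm u))
    h = wkHyp-Eq {τ = σ *} {t = t} {u} h1

  Eq-sym : ∀ {Γ Φ σ} {t u : Tm L Γ σ} → Proof T Γ Φ (Eq σ t u) → Proof T Γ Φ (Eq σ u t)
  Eq-sym p = Eq-sym⊃ _ _ _ $ p

  Eq-trans⊃ : ∀ {Γ Φ} σ (t u v : Tm L Γ σ) → Proof T Γ Φ (Eq σ t u ⊃ Eq σ u v ⊃ Eq σ t v)
  Eq-trans⊃ nat     t u v = ⊃I (⊃I (nat-trans h1 h0))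
  Eq-trans⊃ (σ ⇒ τ) t u v = ⊃I (⊃I (∀I (Eq-trans⊃ τ _ _ _
    $ Eq-cong₁ {g = wkTm u} (wkHyp-Eq {τ = σ ⇒ τ} {t = t} {u} h1) v0
    $ Eq-cong₁ {f = wkTm u} (wkHyp-Eq {τ = σ ⇒ τ} {t = u} {v} h0) v0)))
  Eq-trans⊃ (σ *)   t u v = ⊃I (⊃I (∧I (nat-trans (∧E₁ h1) (∧E₁ h0)) (∀<I (Eq-trans⊃ σ _ _ _
    $ elt-Eq v0 h h0 $ elt-Eq v0 h′ (<-congʳ (∧E₁ h) h0)))))
    where
    h : Proof T _ _ (Eq (σ *) (wkTm t) (wkTm u))
    h = wkHyp-Eq {τ = σ *} {t = t} {u} h2
    h′ : Proof T _ _ (Eq (σ *) (wkTm u) (wkTm v))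
    h′ = wkHyp-Eq {τ = σ *} {t = u} {v} h1

  Eq-trans : ∀ {Γ Φ σ} {t u v : Tm L Γ σ} → Proof T Γ Φ (Eq σ t u) → Proof T Γ Φ (Eq σ u v) →
             Proof T Γ Φ (Eq σ t v)
  Eq-trans p q = Eq-trans⊃ _ _ _ _ $ p $ q

  Eq-cong : ∀ {Γ Φ σ τ} {f g : Tm L Γ (σ ⇒ τ)} {t u} → Proof T Γ Φ (Eq (σ ⇒ τ) f g) →
            Proof T Γ Φ (Eq σ t u) → Proof T Γ Φ (Eq τ (f · t) (g · u))
  Eq-cong {f = f} {g} {t} {u} p q = Eq-trans (Eq-cong₁ {f = f} {g} p t) (Eq-cong₂ g q)

  -- Weak normal forms with respect to the equations of K, S and R₀.  By conv, formulas
  -- whose terms have the same normal forms are interchangeable, so that unfolding a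
  -- combinatory term needs no proof.

  Reduct : ∀ {Γ σ} → Tm L Γ σ → Set
  Reduct {Γ} {σ} t = Σ (Tm L Γ σ) λ u → ∀ {Φ} → Proof T Γ Φ (Eq σ t u)

  infixr 5 _⟫_
  _⟫_ : ∀ {Γ σ} {t u : Tm L Γ σ} → (∀ {Φ} → Proof T Γ Φ (Eq σ t u)) → Reduct u → Reduct t
  p ⟫ (u , q) = u , Eq-trans p q

  -- The fuel stands in for a termination argument. When it runs out, the application is returned
  -- unreduced, so the result is provably equal to the input in any case; the value of `fuel` only
  -- has to exceed the depth of the reductions that occur.
  apply : ℕ → ∀ {Γ σ τ} (f : Tm L Γ (σ ⇒ τ)) (u : Tm L Γ σ) → Reduct (f · u)
  apply (ℕ.suc n) (K · t)           u         = t , rca (K-eq t u)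
  apply (ℕ.suc n) (S · f · g)       u         with apply n f u | apply n g u
  ... | a , p | b , q = rca (S-eq f g u) ⟫ Eq-cong {f = f · u} {a} p q ⟫ apply n a b
  apply (ℕ.suc n) (R₀ · t · f)      zero      = t , rca (R₀-zero t f)
  apply (ℕ.suc n) (R₀ · t · f)      (suc · m) with apply n f m | apply n (R₀ · t · f) m
  ... | a , p | b , q = rca (R₀-suc t f m) ⟫ Eq-cong {f = f · m} {a} p q ⟫ apply n a b
  apply _ f u = f · u , Eq-refl _ _

  fuel : ℕ
  fuel = 100000

  normalise : ∀ {Γ σ} (t : Tm L Γ σ) → Reduct t
  normalise (f · u) with normalise f | normalise u
  ... | f′ , p | u′ , q = Eq-cong {f = f} {f′} p q ⟫ apply fuel f′ u′
  normalise t       = t , Eq-refl _ t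

  nfTm : ∀ {Γ σ} → Tm L Γ σ → Tm L Γ σ
  nfTm t = proj₁ (normalise t)

  nfFm : ∀ {Γ} → Fm L Γ → Fm L Γ
  nfFm (t ≐ u)  = nfTm t ≐ nfTm u
  nfFm (st t)   = st t
  nfFm ⊥̇        = ⊥̇
  nfFm (A ∧̇ B)  = nfFm A ∧̇ nfFm B
  nfFm (A ∨̇ B)  = nfFm A ∨̇ nfFm B
  nfFm (A ⊃ B)  = nfFm A ⊃ nfFm B
  nfFm (∀̇ σ A)  = ∀̇ σ (nfFm A)
  nfFm (∃̇ σ A)  = ∃̇ σ (nfFm A)
  nfFm (∀<̇ t A) = ∀̇ nat (nfFm (v0 <̇ wkTm t) ⊃ nfFm A)
  nfFm (∃<̇ t A) = ∃̇ nat (nfFm (v0 <̇ wkTm t) ∧̇ nfFm A)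

  ⇔-refl : ∀ {Γ Φ} {A : Fm L Γ} → Proof T Γ Φ (A ⇔ A)
  ⇔-refl = ∧I (⊃I h0) (⊃I h0)

  ⇔-trans : ∀ {Γ Φ} {A B C : Fm L Γ} → Proof T Γ Φ (A ⇔ B) → Proof T Γ Φ (B ⇔ C) → Proof T Γ Φ (A ⇔ C)
  ⇔-trans p q = ∧I (⊃I (∧E₁ (weak q) $ (∧E₁ (weak p) $ h0))) (⊃I (∧E₂ (weak p) $ (∧E₂ (weak q) $ h0)))

  ≐-⇔ : ∀ {Γ Φ} {t t′ u u′ : Tm L Γ nat} → Proof T Γ Φ (t ≐ t′) → Proof T Γ Φ (u ≐ u′) →
        Proof T Γ Φ ((t ≐ u) ⇔ (t′ ≐ u′))
  ≐-⇔ p q = ∧I (⊃I (nat-trans (nat-sym (weak p)) (nat-trans h0 (weak q))))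
               (⊃I (nat-trans (weak p) (nat-trans h0 (nat-sym (weak q)))))

  ∧-⇔ : ∀ {Γ Φ} {A A′ B B′ : Fm L Γ} → Proof T Γ Φ (A ⇔ A′) → Proof T Γ Φ (B ⇔ B′) →
        Proof T Γ Φ ((A ∧̇ B) ⇔ (A′ ∧̇ B′))
  ∧-⇔ p q = ∧I (⊃I (∧I (∧E₁ (weak p) $ ∧E₁ h0) (∧E₁ (weak q) $ ∧E₂ h0)))
               (⊃I (∧I (∧E₂ (weak p) $ ∧E₁ h0) (∧E₂ (weak q) $ ∧E₂ h0)))

  ∨-⇔ : ∀ {Γ Φ} {A A′ B B′ : Fm L Γ} → Proof T Γ Φ (A ⇔ A′) → Proof T Γ Φ (B ⇔ B′) →
        Proof T Γ Φ ((A ∨̇ B) ⇔ (A′ ∨̇ B′))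
  ∨-⇔ p q = ∧I
    (⊃I (∨E h0 (∨I₁ (∧E₁ (weak (weak p)) $ h0)) (∨I₂ (∧E₁ (weak (weak q)) $ h0))))
    (⊃I (∨E h0 (∨I₁ (∧E₂ (weak (weak p)) $ h0)) (∨I₂ (∧E₂ (weak (weak q)) $ h0))))

  ⊃-⇔ : ∀ {Γ Φ} {A A′ B B′ : Fm L Γ} → Proof T Γ Φ (A ⇔ A′) → Proof T Γ Φ (B ⇔ B′) →
        Proof T Γ Φ ((A ⊃ B) ⇔ (A′ ⊃ B′))
  ⊃-⇔ p q = ∧I
    (⊃I (⊃I (∧E₁ (weak (weak q)) $ (h1 $ (∧E₂ (weak (weak p)) $ h0)))))
    (⊃I (⊃I (∧E₂ (weak (weak q)) $ (h1 $ (∧E₁ (weak (weak p)) $ h0)))))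

  ∀-⇔ : ∀ {Γ Φ σ} {A A′ : Fm L (σ ∷ Γ)} → Proof T (σ ∷ Γ) (map wkFm Φ) (A ⇔ A′) →
        Proof T Γ Φ (∀̇ σ A ⇔ ∀̇ σ A′)
  ∀-⇔ {A = A} {A′} p = ∧I
    (⊃I (∀I (∧E₁ (weak p) $ subst (Proof T _ _) (wkFm-[v0] A) (h0 ∙ v0))))
    (⊃I (∀I (∧E₂ (weak p) $ subst (Proof T _ _) (wkFm-[v0] A′) (h0 ∙ v0))))

  ∃-⇔ : ∀ {Γ Φ σ} {A A′ : Fm L (σ ∷ Γ)} → Proof T (σ ∷ Γ) (map wkFm Φ) (A ⇔ A′) →
        Proof T Γ Φ (∃̇ σ A ⇔ ∃̇ σ A′)
  ∃-⇔ {A = A} {A′} p = ∧I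
    (⊃I (∃E h0 (∃I v0 (subst (Proof T _ _) (sym (wkFm-[v0] A′)) (∧E₁ (weak (weak p)) $ h0)))))
    (⊃I (∃E h0 (∃I v0 (subst (Proof T _ _) (sym (wkFm-[v0] A)) (∧E₂ (weak (weak p)) $ h0)))))

  nfFm-⇔ : ∀ {Γ Φ} (A : Fm L Γ) → Proof T Γ Φ (A ⇔ nfFm A)
  nfFm-⇔ (t ≐ u)  = ≐-⇔ (proj₂ (normalise t)) (proj₂ (normalise u))
  nfFm-⇔ (st t)   = ⇔-refl
  nfFm-⇔ ⊥̇        = ⇔-refl
  nfFm-⇔ (A ∧̇ B)  = ∧-⇔ (nfFm-⇔ A) (nfFm-⇔ B)
  nfFm-⇔ (A ∨̇ B)  = ∨-⇔ (nfFm-⇔ A) (nfFm-⇔ B)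
  nfFm-⇔ (A ⊃ B)  = ⊃-⇔ (nfFm-⇔ A) (nfFm-⇔ B)
  nfFm-⇔ (∀̇ σ A)  = ∀-⇔ (nfFm-⇔ A)
  nfFm-⇔ (∃̇ σ A)  = ∃-⇔ (nfFm-⇔ A)
  nfFm-⇔ (∀<̇ t A) = ⇔-trans ∀<-def (∀-⇔ (⊃-⇔ (≐-⇔ (proj₂ (normalise _)) (proj₂ (normalise _))) (nfFm-⇔ A)))
  nfFm-⇔ (∃<̇ t A) = ⇔-trans ∃<-def (∃-⇔ (∧-⇔ (≐-⇔ (proj₂ (normalise _)) (proj₂ (normalise _))) (nfFm-⇔ A)))

  conv : ∀ {Γ Φ} {A B : Fm L Γ} → nfFm A ≡ nfFm B → Proof T Γ Φ A → Proof T Γ Φ B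
  conv {A = A} {B} e p = ∧E₂ (nfFm-⇔ B) $ subst (Proof T _ _) e (∧E₁ (nfFm-⇔ A) $ p)

  nf-≐ : ∀ {Γ Φ σ} {t u : Tm L Γ σ} → nfTm t ≡ nfTm u → Proof T Γ Φ (Eq σ t u)
  nf-≐ {σ = σ} {t} {u} e = Eq-trans (proj₂ (normalise t))
    (subst (λ w → Proof T _ _ (Eq σ w u)) (sym e) (Eq-sym (proj₂ (normalise u))))

  subTm-Eq : ∀ {Γ Δ Φ σ} {θ θ′ : Sub L Γ Δ} → (∀ {τ} (x : τ ∈ Γ) → Proof T Δ Φ (Eq τ (θ x) (θ′ x))) →
             (t : Tm L Γ σ) → Proof T Δ Φ (Eq σ (subTm θ t) (subTm θ′ t))
  subTm-Eq e (var x) = e x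
  subTm-Eq {θ = θ} {θ′} e (f · u) = Eq-cong {f = subTm θ f} {subTm θ′ f} (subTm-Eq e f) (subTm-Eq e u)
  subTm-Eq e K       = Eq-refl _ K
  subTm-Eq e S       = Eq-refl _ S
  subTm-Eq e zero    = Eq-refl _ zero
  subTm-Eq e suc     = Eq-refl _ suc
  subTm-Eq e R₀      = Eq-refl _ R₀
  subTm-Eq e len     = Eq-refl _ len
  subTm-Eq e elt     = Eq-refl _ elt
  subTm-Eq e seq     = Eq-refl _ seq
  subTm-Eq e (con c) = Eq-refl _ (con c)

  subFm-⇔ : ∀ {Γ Δ Φ} {θ θ′ : Sub L Γ Δ} → (∀ {τ} (x : τ ∈ Γ) → Proof T Δ Φ (Eq τ (θ x) (θ′ x))) →
            (A : Fm L Γ) → QuantifierFree A → Proof T Δ Φ (subFm θ A ⇔ subFm θ′ A)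
  subFm-⇔ e (t ≐ u)  _       = ≐-⇔ (subTm-Eq e t) (subTm-Eq e u)
  subFm-⇔ e ⊥̇        _       = ⇔-refl
  subFm-⇔ e (A ∧̇ B)  (a , b) = ∧-⇔ (subFm-⇔ e A a) (subFm-⇔ e B b)
  subFm-⇔ e (A ∨̇ B)  (a , b) = ∨-⇔ (subFm-⇔ e A a) (subFm-⇔ e B b)
  subFm-⇔ e (A ⊃ B)  (a , b) = ⊃-⇔ (subFm-⇔ e A a) (subFm-⇔ e B b)

  single-Eq : ∀ {Γ Φ σ} {t u : Tm L Γ σ} → Proof T Γ Φ (Eq σ t u) →
              ∀ {τ} (x : τ ∈ (σ ∷ Γ)) → Proof T Γ Φ (Eq τ ((var ▸ t) x) ((var ▸ u) x))
  single-Eq p (here refl) = p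
  single-Eq p (there x)   = Eq-refl _ _

  at : ∀ {Γ Φ σ τ} (C : Tm L (σ ∷ Γ) τ) {t u : Tm L Γ σ} → Proof T Γ Φ (Eq σ t u) →
       Proof T Γ Φ (Eq τ (subTm (var ▸ t) C) (subTm (var ▸ u) C))
  at C p = subTm-Eq (single-Eq p) C

  rewr : ∀ {Γ Φ σ} (A : Fm L (σ ∷ Γ)) {_ : QuantifierFree A} {t u : Tm L Γ σ} →
         Proof T Γ Φ (Eq σ t u) → Proof T Γ Φ (A [ t ]) → Proof T Γ Φ (A [ u ])
  rewr A {qf} p q = ∧E₁ (subFm-⇔ (single-Eq p) A qf) $ q

  ind : ∀ {Γ Φ} (A : Fm L (nat ∷ Γ)) {_ : QuantifierFree A} → Proof T Γ Φ (A [ zero ]) →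
        Proof T (nat ∷ Γ) (A ∷ map wkFm Φ) (subFm (↑ ▸ (suc · v0)) A) → Proof T Γ Φ (∀̇ nat A)
  ind A {qf} p q = rca (qf-ind A qf) $ p $ ∀I (⊃I q)

-- Arithmetic from quantifier-free induction

v4 : ∀ {L Γ ρ₁ ρ₂ ρ₃ ρ₄ σ} → Tm L (ρ₁ ∷ ρ₂ ∷ ρ₃ ∷ ρ₄ ∷ σ ∷ Γ) σ
v4 = var (there (there (there (there (here refl)))))

v5 : ∀ {L Γ ρ₁ ρ₂ ρ₃ ρ₄ ρ₅ σ} → Tm L (ρ₁ ∷ ρ₂ ∷ ρ₃ ∷ ρ₄ ∷ ρ₅ ∷ σ ∷ Γ) σ
v5 = var (there (there (there (there (there (here refl))))))

v6 : ∀ {L Γ ρ₁ ρ₂ ρ₃ ρ₄ ρ₅ ρ₆ σ} → Tm L (ρ₁ ∷ ρ₂ ∷ ρ₃ ∷ ρ₄ ∷ ρ₅ ∷ ρ₆ ∷ σ ∷ Γ) σ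
v6 = var (there (there (there (there (there (there (here refl)))))))

module Arithmetic {L : Language} {T : Theory L} (base : ∀ {Γ} {A : Fm L Γ} → RCA₀^ω A → T A) where
  open Logic {L} {T} public
  open Equality {L} {T} base public

  infix 3 _∥_⊩_
  _∥_⊩_ : (Γ : Ctx) → List (Fm L Γ) → Fm L Γ → Set
  Γ ∥ Φ ⊩ A = Proof T Γ Φ A

  infixr 2 _≐⟨_⟩_
  infix  3 _∎
  _≐⟨_⟩_ : ∀ {Γ Φ} t {u v} → Γ ∥ Φ ⊩ t ≐ u → Γ ∥ Φ ⊩ u ≐ v → Γ ∥ Φ ⊩ t ≐ v
  t ≐⟨ p ⟩ q = nat-trans p q
  _∎ : ∀ {Γ Φ} t → Γ ∥ Φ ⊩ t ≐ t
  t ∎ = rca (≐-refl t)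

  -- Substitution and `conv` compute on variables but get stuck on unknown terms. Lemmas are
  -- therefore derived for variables in an extended context and instantiated afterwards.
  prove₁ : ∀ {Γ σ Φ} (A : Fm L (σ ∷ Γ)) → σ ∷ Γ ∥ map wkFm Φ ⊩ A → ∀ s → Γ ∥ Φ ⊩ A [ s ]
  prove₁ A p = ∀E (∀I p)

  prove₂ : ∀ {Γ σ τ Φ} (A : Fm L (τ ∷ σ ∷ Γ)) → τ ∷ σ ∷ Γ ∥ map wkFm (map wkFm Φ) ⊩ A →
           ∀ s t → Γ ∥ Φ ⊩ subFm (var ▸ s ▸ t) A
  prove₂ A p = inst₂ (∀I (∀I p))

  prove₃ : ∀ {Γ σ τ ρ Φ} (A : Fm L (ρ ∷ τ ∷ σ ∷ Γ)) →
           ρ ∷ τ ∷ σ ∷ Γ ∥ map wkFm (map wkFm (map wkFm Φ)) ⊩ A →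
           ∀ s t u → Γ ∥ Φ ⊩ subFm (var ▸ s ▸ t ▸ u) A
  prove₃ A p = inst₃ (∀I (∀I (∀I p)))

  prove₄ : ∀ {Γ σ τ ρ ν Φ} (A : Fm L (ν ∷ ρ ∷ τ ∷ σ ∷ Γ)) →
           ν ∷ ρ ∷ τ ∷ σ ∷ Γ ∥ map wkFm (map wkFm (map wkFm (map wkFm Φ))) ⊩ A →
           ∀ s t u v → Γ ∥ Φ ⊩ subFm (var ▸ s ▸ t ▸ u ▸ v) A
  prove₄ A p = inst₄ (∀I (∀I (∀I (∀I p))))

  prove₅ : ∀ {Γ σ τ ρ ν κ Φ} (A : Fm L (κ ∷ ν ∷ ρ ∷ τ ∷ σ ∷ Γ)) →
           κ ∷ ν ∷ ρ ∷ τ ∷ σ ∷ Γ ∥ map wkFm (map wkFm (map wkFm (map wkFm (map wkFm Φ)))) ⊩ A →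
           ∀ s t u v w → Γ ∥ Φ ⊩ subFm (var ▸ s ▸ t ▸ u ▸ v ▸ w) A
  prove₅ A p = inst₅ (∀I (∀I (∀I (∀I (∀I p)))))

  zero-or-suc : ∀ {Γ Φ} x → Γ ∥ Φ ⊩ (x ≐ zero) ∨̇ (x ≐ suc · (pred · x))
  zero-or-suc x = ind ((v0 ≐ zero) ∨̇ (v0 ≐ suc · (pred · v0)))
    (∨I₁ (nf-≐ refl)) (∨I₂ (nf-≐ refl)) ∙ x

  zero-add : ∀ {Γ Φ} x → Γ ∥ Φ ⊩ add · zero · x ≐ x
  zero-add x = ind (add · zero · v0 ≐ v0) (nf-≐ refl) (conv refl (at (suc · v0) h0)) ∙ x

  suc-add : ∀ {Γ Φ} x y → Γ ∥ Φ ⊩ add · (suc · x) · y ≐ suc · (add · x · y)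
  suc-add = inst₂ (∀I (ind (add · (suc · v1) · v0 ≐ suc · (add · v1 · v0))
    (nf-≐ refl) (conv refl (at (suc · v0) h0))))

  add-comm : ∀ {Γ Φ} x y → Γ ∥ Φ ⊩ add · x · y ≐ add · y · x
  add-comm = inst₂ (∀I (ind (add · v1 · v0 ≐ add · v0 · v1)
    (conv refl (nat-sym (zero-add v0)))
    (nat-trans (conv refl (at (suc · v0) h0)) (nat-sym (suc-add v0 v1)))))

  add-assoc : ∀ {Γ Φ} x y z → Γ ∥ Φ ⊩ add · (add · x · y) · z ≐ add · x · (add · y · z)
  add-assoc = inst₃ (∀I (∀I (ind (add · (add · v2 · v1) · v0 ≐ add · v2 · (add · v1 · v0))
    (nf-≐ refl) (conv refl (at (suc · v0) h0)))))

  suc-monus-suc : ∀ {Γ Φ} x y → Γ ∥ Φ ⊩ monus · (suc · x) · (suc · y) ≐ monus · x · y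
  suc-monus-suc = inst₂ (∀I (ind (monus · (suc · v1) · (suc · v0) ≐ monus · v1 · v0)
    (nf-≐ refl) (conv refl (at (pred · v0) h0))))

  monus-self : ∀ {Γ Φ} x → Γ ∥ Φ ⊩ monus · x · x ≐ zero
  monus-self x = ind (monus · v0 · v0 ≐ zero) (nf-≐ refl) (nat-trans (suc-monus-suc v0 v0) h0) ∙ x

  zero-monus : ∀ {Γ Φ} x → Γ ∥ Φ ⊩ monus · zero · x ≐ zero
  zero-monus x = ind (monus · zero · v0 ≐ zero) (nf-≐ refl) (conv refl (at (pred · v0) h0)) ∙ x

  suc-monus-self : ∀ {Γ Φ} x → Γ ∥ Φ ⊩ monus · (suc · x) · x ≐ one
  suc-monus-self x = ind (monus · (suc · v0) · v0 ≐ one) (nf-≐ refl)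
    (nat-trans (suc-monus-suc (suc · v0) v0) h0) ∙ x

  add-monus : ∀ {Γ Φ} x y → Γ ∥ Φ ⊩ monus · (add · x · y) · y ≐ x
  add-monus = inst₂ (∀I (ind (monus · (add · v1 · v0) · v0 ≐ v1) (nf-≐ refl)
    (nat-trans (conv refl (suc-monus-suc (add · v1 · v0) v0)) h0)))

  ≤-addˡ : ∀ {Γ Φ} x y → Γ ∥ Φ ⊩ x ≤̇ add · y · x
  ≤-addˡ x y = inst₂ (∀I (ind (monus · v0 · (add · v1 · v0) ≐ zero) (conv refl (zero-monus v0))
    (conv refl (nat-trans (suc-monus-suc v0 (add · v1 · v0)) h0)))) y x

  ≤-addʳ : ∀ {Γ Φ} x y → Γ ∥ Φ ⊩ x ≤̇ add · x · y
  ≤-addʳ x y = nat-trans (Eq-cong₂ (monus · x) (add-comm x y)) (≤-addˡ x y)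

  Compare : ∀ {Γ} → Tm L Γ nat → Tm L Γ nat → Fm L Γ
  Compare x y = ((x ≤̇ y) ∨̇ (y <̇ x)) ∧̇ (x ≤̇ y ⊃ add · (monus · y · x) · x ≐ y)

  compare-zero : ∀ {Γ Φ} y → Γ ∥ Φ ⊩ Compare zero y
  compare-zero y = ∧I (∨I₁ (zero-monus y)) (⊃I (prove₁ (add · (monus · v0 · zero) · zero ≐ v0) (nf-≐ refl) y))

  suc≰zero : ∀ {Γ Φ} x → Γ ∥ Φ ⊩ ¬̇ (suc · x ≤̇ zero)
  suc≰zero x = ⊃I (rca (suc≢0 x) $ (prove₁ (suc · v0 ≤̇ zero ⊃ suc · v0 ≐ zero) (⊃I (conv refl h0)) x $ h0))

  compare-suc-zero : ∀ {Γ Φ} x → Γ ∥ Φ ⊩ Compare (suc · x) zero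
  compare-suc-zero x = ∧I (∨I₂ (nat-trans (suc-monus-suc zero x) (zero-monus x)))
    (⊃I (absurd (suc≰zero x $ h0)))

  compare-suc-suc : ∀ {Γ Φ} x y → Γ ∥ Φ ⊩ Compare x y ⊃ Compare (suc · x) (suc · y)
  compare-suc-suc = prove₂ (Compare v1 v0 ⊃ Compare (suc · v1) (suc · v0)) (⊃I (∧I
    (∨E (∧E₁ h0) (∨I₁ (nat-trans (suc-monus-suc v1 v0) h0))
                 (∨I₂ (nat-trans (suc-monus-suc (suc · v0) v1) h0)))
    (⊃I (
      add · (monus · (suc · v0) · (suc · v1)) · (suc · v1) ≐⟨ conv refl (at (suc · (add · v0 · v2)) (suc-monus-suc v0 v1)) ⟩
      suc · (add · (monus · v0 · v1) · v1) ≐⟨ at (suc · v0) (∧E₂ h1 $ nat-trans (nat-sym (suc-monus-suc v1 v0)) h0) ⟩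
      suc · v0 ∎))))

  -- The usual double induction generalises over `y`, which quantifier-free induction forbids.
  -- Instead a failure at `x`, `y` is propagated to `x ∸ k`, `y ∸ k` for every `k`, and at `k = x`
  -- it contradicts `compare-zero`.
  compare : ∀ {Γ Φ} x y → Γ ∥ Φ ⊩ Compare x y
  compare = prove₂ (Compare v1 v0) (raa (rewr (Compare v0 (monus · v1 · v2)) (nat-sym (monus-self v1)) (compare-zero _)
     ▹ (ind (¬̇ Compare (monus · v2 · v0) (monus · v1 · v0)) (conv refl h0) (⊃I (h1 $ descend)) ∙ v1)))
    where
    infixl 1 _▹_
    _▹_ : ∀ {Γ Φ} {A : Fm L Γ} → Γ ∥ Φ ⊩ A → Γ ∥ Φ ⊩ ¬̇ A → Γ ∥ Φ ⊩ ⊥̇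
    p ▹ q = ⊃E q p
    lower : ∀ {Γ Φ} x y → Γ ∥ Φ ⊩ Compare (pred · x) (pred · y) ⊃ Compare x y
    lower = prove₂ (Compare (pred · v1) (pred · v0) ⊃ Compare v1 v0) (∨E (zero-or-suc v1)
      (⊃I (rewr (Compare v0 v1) (nat-sym h1) (compare-zero v0)))
      (∨E (zero-or-suc v0)
        (⊃I (rewr (Compare v2 v0) (nat-sym h1) (rewr (Compare v0 zero) (nat-sym h2) (compare-suc-zero _))))
        (⊃I (rewr (Compare v2 v0) (nat-sym h1) (rewr (Compare v0 (suc · (pred · v1))) (nat-sym h2)
          (compare-suc-suc _ _ $ h0))))))
    descend : ∀ {Γ Φ} → nat ∷ nat ∷ nat ∷ Γ ∥ (Compare (monus · v2 · (suc · v0)) (monus · v1 · (suc · v0))) ∷ Φ ⊩ Compare (monus · v2 · v0) (monus · v1 · v0)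
    descend = lower _ _ $ conv refl h0

  ≤-or-> : ∀ {Γ Φ} x y → Γ ∥ Φ ⊩ (x ≤̇ y) ∨̇ (y <̇ x)
  ≤-or-> x y = ∧E₁ (compare x y)

  monus-add : ∀ {Γ Φ} {x y : Tm L Γ nat} → Γ ∥ Φ ⊩ x ≤̇ y → Γ ∥ Φ ⊩ add · (monus · y · x) · x ≐ y
  monus-add p = ∧E₂ (compare _ _) $ p

  ≤-refl : ∀ {Γ Φ} x → Γ ∥ Φ ⊩ x ≤̇ x
  ≤-refl = monus-self

  s≤s : ∀ {Γ Φ} {x y : Tm L Γ nat} → Γ ∥ Φ ⊩ x ≤̇ y → Γ ∥ Φ ⊩ suc · x ≤̇ suc · y
  s≤s p = nat-trans (suc-monus-suc _ _) p

  s≤s⁻¹ : ∀ {Γ Φ} {x y : Tm L Γ nat} → Γ ∥ Φ ⊩ suc · x ≤̇ suc · y → Γ ∥ Φ ⊩ x ≤̇ y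
  s≤s⁻¹ p = nat-trans (nat-sym (suc-monus-suc _ _)) p

  ≤-resp : ∀ {Γ Φ} {x x′ y y′ : Tm L Γ nat} → Γ ∥ Φ ⊩ x ≐ x′ → Γ ∥ Φ ⊩ y ≐ y′ →
           Γ ∥ Φ ⊩ x ≤̇ y → Γ ∥ Φ ⊩ x′ ≤̇ y′
  ≤-resp {x′ = x′} {y} p q r = nat-trans (nat-sym (Eq-cong {f = monus · _} {monus · x′} (Eq-cong₂ monus p) q)) r

  ≤-trans : ∀ {Γ Φ} {x y z : Tm L Γ nat} → Γ ∥ Φ ⊩ x ≤̇ y → Γ ∥ Φ ⊩ y ≤̇ z → Γ ∥ Φ ⊩ x ≤̇ z
  ≤-trans {x = x} {y} {z} p q = ≤-resp (x ∎)
    (add · (add · (monus · z · y) · (monus · y · x)) · x ≐⟨ add-assoc _ _ _ ⟩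
     add · (monus · z · y) · (add · (monus · y · x) · x) ≐⟨ Eq-cong₂ (add · (monus · z · y)) (monus-add p) ⟩
     add · (monus · z · y) · y ≐⟨ monus-add q ⟩
     z ∎)
    (≤-addˡ x _)

  ≤-suc : ∀ {Γ Φ} x → Γ ∥ Φ ⊩ x ≤̇ suc · x
  ≤-suc x = ≤-resp (x ∎) (prove₁ (add · one · v0 ≐ suc · v0)
    (nat-trans (suc-add zero v0) (at (suc · v0) (zero-add v0))) x) (≤-addˡ x one)

  <⇒≤ : ∀ {Γ Φ} {x y : Tm L Γ nat} → Γ ∥ Φ ⊩ x <̇ y → Γ ∥ Φ ⊩ x ≤̇ y
  <⇒≤ = ≤-trans (≤-suc _)

  ≤-antisym : ∀ {Γ Φ} {x y : Tm L Γ nat} → Γ ∥ Φ ⊩ x ≤̇ y → Γ ∥ Φ ⊩ y ≤̇ x → Γ ∥ Φ ⊩ x ≐ y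
  ≤-antisym {x = x} {y} p q = nat-sym
    (y ≐⟨ nat-sym (zero-add y) ⟩
     add · zero · y ≐⟨ Eq-cong₁ {f = add · zero} {add · _} (Eq-cong₂ add (nat-sym p)) y ⟩
     add · (monus · x · y) · y ≐⟨ monus-add q ⟩
     x ∎)

  <-split : ∀ {Γ Φ} {x y : Tm L Γ nat} → Γ ∥ Φ ⊩ x <̇ suc · y → Γ ∥ Φ ⊩ (x <̇ y) ∨̇ (x ≐ y)
  <-split p = ∨E (≤-or-> _ _) (∨I₂ (≤-antisym (weak (s≤s⁻¹ p)) h0)) (∨I₁ h0)

  <-irrefl : ∀ {Γ Φ} {x y : Tm L Γ nat} → Γ ∥ Φ ⊩ x <̇ y → Γ ∥ Φ ⊩ y ≤̇ x → Γ ∥ Φ ⊩ ⊥̇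
  <-irrefl p q = rca (suc≢0 zero) $ nat-trans (nat-sym (suc-monus-self _)) (≤-trans p q)

  ≤zero⇒≐zero : ∀ {Γ Φ} {x : Tm L Γ nat} → Γ ∥ Φ ⊩ x ≤̇ zero → Γ ∥ Φ ⊩ x ≐ zero
  ≤zero⇒≐zero {x = x} p = prove₁ (v0 ≤̇ zero ⊃ v0 ≐ zero) (⊃I (conv refl h0)) x $ p

  ≮zero : ∀ {Γ Φ} {x : Tm L Γ nat} {A} → Γ ∥ Φ ⊩ x <̇ zero → Γ ∥ Φ ⊩ A
  ≮zero p = absurd (suc≰zero _ $ p)

  add-mono-≤ : ∀ {Γ Φ} {x x′ y y′ : Tm L Γ nat} → Γ ∥ Φ ⊩ x ≤̇ x′ → Γ ∥ Φ ⊩ y ≤̇ y′ →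
               Γ ∥ Φ ⊩ add · x · y ≤̇ add · x′ · y′
  add-mono-≤ p q = ≤-trans (monoˡ p _) (≤-resp (add-comm _ _) (add-comm _ _) (monoˡ q _))
    where
    monoˡ : ∀ {Γ Φ} {x x′ : Tm L Γ nat} → Γ ∥ Φ ⊩ x ≤̇ x′ → ∀ y → Γ ∥ Φ ⊩ add · x · y ≤̇ add · x′ · y
    monoˡ {x = x} {x′} p y = ≤-resp (_ ∎)
      (add · (monus · x′ · x) · (add · x · y) ≐⟨ nat-sym (add-assoc _ _ _) ⟩
       add · (add · (monus · x′ · x) · x) · y ≐⟨ Eq-cong₁ {f = add · _} {add · x′} (Eq-cong₂ add (monus-add p)) y ⟩
       add · x′ · y ∎)
      (≤-addˡ (add · x · y) (monus · x′ · x))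

  monus-monus : ∀ {Γ Φ} {m n : Tm L Γ nat} → Γ ∥ Φ ⊩ m ≤̇ n → Γ ∥ Φ ⊩ monus · n · (monus · n · m) ≐ m
  monus-monus {m = m} {n} p =
    monus · n · d ≐⟨ Eq-cong₁ {f = monus · n} {monus · _} (Eq-cong₂ monus (nat-sym (nat-trans (add-comm m d) (monus-add p)))) d ⟩
    monus · (add · m · d) · d ≐⟨ add-monus m d ⟩
    m ∎
    where d = monus · n · m

  add-monus-add : ∀ {Γ Φ} x y z → Γ ∥ Φ ⊩ monus · (add · x · y) · (add · x · z) ≐ monus · y · z
  add-monus-add x y z =
    monus · (add · x · y) · (add · x · z) ≐⟨ Eq-cong {f = monus · _} {monus · _} (Eq-cong₂ monus (add-comm x y)) (add-comm x z) ⟩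
    monus · (add · y · x) · (add · z · x) ≐⟨ inst₃ (∀I (∀I (ind (monus · (add · v2 · v0) · (add · v1 · v0) ≐ monus · v2 · v1)
      (nf-≐ refl) (conv refl (nat-trans (suc-monus-suc (add · v2 · v0) (add · v1 · v0)) h0))))) y z x ⟩
    monus · y · z ∎

  if : ∀ {Γ} → Tm L Γ nat → Tm L Γ nat → Tm L Γ nat → Tm L Γ nat
  if t a b = R₀ · a · (K · (K · b)) · t

  if-zero : ∀ {Γ Φ} {t : Tm L Γ nat} a b → Γ ∥ Φ ⊩ t ≐ zero → Γ ∥ Φ ⊩ if t a b ≐ a
  if-zero a b p = nat-trans (Eq-cong₂ (R₀ · a · (K · (K · b))) p) (rca (R₀-zero _ _))

  if-suc : ∀ {Γ Φ} {t : Tm L Γ nat} a b → Γ ∥ Φ ⊩ ¬̇ (t ≐ zero) → Γ ∥ Φ ⊩ if t a b ≐ b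
  if-suc {t = t} a b p = prove₃ (¬̇ (v0 ≐ zero) ⊃ if v0 v2 v1 ≐ v1) (⊃I (∨E (zero-or-suc v0)
    (absurd (h1 $ h0))
    (nat-trans (at (if v0 v3 v2) h0) (nf-≐ refl)))) a b t $ p

-- Pairing and codes of finite sequences

iszero sg : ∀ {L Γ} → Tm L Γ (nat ⇒ nat)
iszero = R₀ · one · (K · (K · zero))
sg     = R₀ · zero · (K · (K · one))

sum : ∀ {L Γ} → Tm L Γ (𝟙 ⇒ nat ⇒ nat)
sum = ƛ (ƛ (R₀ · zero · ƛ (ƛ (add · v0 · (v3 · v1))) · v0))

tri root fst snd : ∀ {L Γ} → Tm L Γ (nat ⇒ nat)
tri  = R₀ · zero · ƛ (ƛ (add · v0 · (suc · v1)))
-- root c is the greatest s with tri s ≤ c, by recursion on c.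
root = R₀ · zero · ƛ (ƛ (R₀ · (suc · v0) · (K · (K · v0)) · (monus · (tri · (suc · v0)) · (suc · v1))))
snd  = ƛ (monus · v0 · (tri · (root · v0)))
fst  = ƛ (monus · (root · v0) · (snd · v0))

-- drop j c omits the last j entries of the sequence with code c, and decode n c
-- is the sequence with code c if that has length n (entries past n are junk).
drop : ∀ {L Γ} → Tm L Γ (nat ⇒ nat ⇒ nat)
drop = ƛ (ƛ (R₀ · v0 · (K · ƛ (fst · (pred · v0))) · v1))

decode : ∀ {L Γ} → Tm L Γ (nat ⇒ nat ⇒ 𝟙)
decode = ƛ (ƛ (ƛ (snd · (pred · (drop · (monus · v2 · (suc · v0)) · v1)))))

trunc : ∀ {L Γ} → Tm L Γ (𝟙 ⇒ 𝟙)
trunc = ƛ (ƛ (sg · (v1 · v0)))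

module Coding {L : Language} {T : Theory L} (base : ∀ {Γ} {A : Fm L Γ} → RCA₀^ω A → T A) where
  open Arithmetic {L} {T} base public

  iszero-zero : ∀ {Γ Φ} {t : Tm L Γ nat} → Γ ∥ Φ ⊩ t ≐ zero → Γ ∥ Φ ⊩ iszero · t ≐ one
  iszero-zero = if-zero one zero

  iszero-suc : ∀ {Γ Φ} {t : Tm L Γ nat} → Γ ∥ Φ ⊩ ¬̇ (t ≐ zero) → Γ ∥ Φ ⊩ iszero · t ≐ zero
  iszero-suc = if-suc one zero

  one≢zero : ∀ {Γ Φ} → Γ ∥ Φ ⊩ ¬̇ (one ≐ zero)
  one≢zero = rca (suc≢0 zero)

  iszero≐one : ∀ {Γ Φ} {t : Tm L Γ nat} → Γ ∥ Φ ⊩ iszero · t ≐ one → Γ ∥ Φ ⊩ t ≐ zero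
  iszero≐one p = raa (one≢zero $ nat-trans (nat-sym (weak p)) (iszero-suc h0))

  iszero≐zero : ∀ {Γ Φ} {t : Tm L Γ nat} → Γ ∥ Φ ⊩ iszero · t ≐ zero → Γ ∥ Φ ⊩ ¬̇ (t ≐ zero)
  iszero≐zero p = ⊃I (one≢zero $ nat-trans (nat-sym (iszero-zero h0)) (weak p))

  iszero≤one : ∀ {Γ Φ} (t : Tm L Γ nat) → Γ ∥ Φ ⊩ iszero · t ≤̇ one
  iszero≤one t = cases (t ≐ zero)
    (≤-resp (nat-sym (iszero-zero h0)) (one ∎) (≤-refl one))
    (≤-resp (nat-sym (iszero-suc h0)) (one ∎) (zero-monus one))

  sg≤one : ∀ {Γ Φ} (t : Tm L Γ nat) → Γ ∥ Φ ⊩ sg · t ≤̇ one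
  sg≤one t = cases (t ≐ zero)
    (≤-resp (nat-sym (if-zero zero one h0)) (one ∎) (zero-monus one))
    (≤-resp (nat-sym (if-suc zero one h0)) (one ∎) (≤-refl one))

  ≤one-split : ∀ {Γ Φ} {t : Tm L Γ nat} → Γ ∥ Φ ⊩ t ≤̇ one → Γ ∥ Φ ⊩ (t ≐ zero) ∨̇ (t ≐ one)
  ≤one-split p = ∨E (<-split (s≤s p)) (∨I₁ (≤zero⇒≐zero (s≤s⁻¹ h0))) (∨I₂ h0)

  sg-id : ∀ {Γ Φ} {t : Tm L Γ nat} → Γ ∥ Φ ⊩ t ≤̇ one → Γ ∥ Φ ⊩ sg · t ≐ t
  sg-id p = ∨E (≤one-split p)
    (nat-trans (if-zero zero one h0) (nat-sym h0))
    (nat-trans (if-suc zero one (⊃I (one≢zero $ nat-trans (nat-sym h1) h0))) (nat-sym h0))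

  ≤-sum : ∀ {Γ Φ} f i n → Γ ∥ Φ ⊩ i <̇ n ⊃ f · i ≤̇ sum · f · n
  ≤-sum = inst₃ (∀I (∀I (ind (v1 <̇ v0 ⊃ v2 · v1 ≤̇ sum · v2 · v0) (⊃I (≮zero h0))
    (⊃I (∨E (<-split h0)
      (conv refl (≤-trans (h2 $ h0) (≤-addʳ (sum · v2 · v0) (v2 · v0))))
      (rewr (v3 · v0 ≤̇ sum · v3 · (suc · v1)) (nat-sym h0)
        (conv refl (≤-addˡ (v2 · v0) (sum · v2 · v0)))))))))

  sum≐zero⁻ : ∀ {Γ Φ} {f n i} → Γ ∥ Φ ⊩ sum · f · n ≐ zero → Γ ∥ Φ ⊩ i <̇ n → Γ ∥ Φ ⊩ f · i ≐ zero
  sum≐zero⁻ p q = ≤zero⇒≐zero (≤-resp (_ ∎) p (≤-sum _ _ _ $ q))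

  -- The quantified hypothesis may not enter the induction formula, so it stays in the context, and
  -- the induction is confined to its range by the premise `v0 ≤̇ v1`.
  sum≐zero : ∀ {Γ Φ} {f n} → Γ ∥ Φ ⊩ ∀<̇ n (wkTm f · v0 ≐ zero) → Γ ∥ Φ ⊩ sum · f · n ≐ zero
  sum≐zero {f = f} {n} p = prove₂ (∀<̇ v0 (v2 · v0 ≐ zero) ⊃ sum · v1 · v0 ≐ zero)
    (⊃I (ind (v0 ≤̇ v1 ⊃ sum · v2 · v0 ≐ zero) (⊃I (nf-≐ refl))
      (⊃I (sum · v2 · (suc · v0) ≐⟨ nf-≐ refl ⟩
           add · (sum · v2 · v0) · (v2 · v0) ≐⟨ at (add · (sum · v3 · v1) · v0) (∀<E h2 v0 h0) ⟩
           add · (sum · v2 · v0) · zero ≐⟨ nf-≐ refl ⟩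
           sum · v2 · v0 ≐⟨ h1 $ <⇒≤ h0 ⟩
           zero ∎)) ∙ v0 $ ≤-refl v0)) f n $ p

  Bounded≐ : ∀ {Γ} → Tm L Γ 𝟙 → Tm L Γ 𝟙 → Tm L Γ nat → Fm L Γ
  Bounded≐ α β n = ∀̇ nat (v0 <̇ wkTm n ⊃ wkTm α · v0 ≐ wkTm β · v0)

  initial-suc : ∀ {Γ Φ} α n → Γ ∥ Φ ⊩ initial · α · (suc · n) ≐ suc · (pair · (initial · α · n) · (α · n))
  initial-suc = prove₂ (initial · v1 · (suc · v0) ≐ suc · (pair · (initial · v1 · v0) · (v1 · v0))) (nf-≐ refl)

  initial-cong : ∀ {Γ Φ} {α β n} → Γ ∥ Φ ⊩ Bounded≐ α β n → Γ ∥ Φ ⊩ initial · α · n ≐ initial · β · n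
  initial-cong {α = α} {β} {n} p = prove₃ (Bounded≐ v2 v1 v0 ⊃ initial · v2 · v0 ≐ initial · v1 · v0)
    (⊃I (ind (v0 ≤̇ v1 ⊃ initial · v3 · v0 ≐ initial · v2 · v0) (⊃I (nf-≐ refl))
      (⊃I (initial · v3 · (suc · v0) ≐⟨ nf-≐ refl ⟩
           suc · (pair · (initial · v3 · v0) · (v3 · v0)) ≐⟨ at (suc · (pair · (initial · v4 · v1) · v0)) (h2 ∙ v0 $ h0) ⟩
           suc · (pair · (initial · v3 · v0) · (v2 · v0)) ≐⟨ at (suc · (pair · v0 · (v3 · v1))) (h1 $ <⇒≤ h0) ⟩
           suc · (pair · (initial · v2 · v0) · (v2 · v0)) ≐⟨ nf-≐ refl ⟩
           initial · v2 · (suc · v0) ∎)) ∙ v0 $ ≤-refl v0)) α β n $ p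

  tri-mono : ∀ {Γ Φ} x y → Γ ∥ Φ ⊩ x ≤̇ y ⊃ tri · x ≤̇ tri · y
  tri-mono = inst₂ (∀I (ind (v1 ≤̇ v0 ⊃ tri · v1 ≤̇ tri · v0)
    (⊃I (rewr (tri · v0 ≤̇ tri · zero) (nat-sym (≤zero⇒≐zero h0)) (≤-refl _)))
    (⊃I (∨E (<-split (s≤s h0))
      (conv refl (≤-trans (h2 $ s≤s⁻¹ h0) (≤-addʳ (tri · v0) (suc · v0))))
      (rewr (tri · v0 ≤̇ tri · (suc · v1)) (nat-sym h0) (≤-refl _))))))

  root-tri : ∀ {Γ Φ} s → Γ ∥ Φ ⊩ root · (tri · s) ≐ s
  -- From `tri s` to `tri s + s` the next threshold `tri (s + 1)` is not reached, so the recursion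
  -- of `root` keeps its value. The premise about `tri s` avoids circularity: the induction of
  -- `root-tri` supplies it, and there the step after `tri s + s` hits the threshold.
  root-tri-add : ∀ {Γ Φ} s y → Γ ∥ Φ ⊩ root · (tri · s) ≐ s ⊃ y ≤̇ s ⊃ root · (add · (tri · s) · y) ≐ s
  root-tri-add = inst₂ (∀I (ind
    (root · (tri · v1) ≐ v1 ⊃ v0 ≤̇ v1 ⊃ root · (add · (tri · v1) · v0) ≐ v1)
    (⊃I (⊃I (conv refl h1)))
    (⊃I (⊃I (
      root · (add · (tri · v1) · (suc · v0)) ≐⟨ nf-≐ refl ⟩
      if (monus · (tri · (suc · (root · (add · (tri · v1) · v0)))) · (suc · (add · (tri · v1) · v0)))
         (suc · (root · (add · (tri · v1) · v0))) (root · (add · (tri · v1) · v0))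
        ≐⟨ at (if (monus · (tri · (suc · v0)) · (suc · (add · (tri · v2) · v1))) (suc · v0) v0)
              (h2 $ h1 $ <⇒≤ h0) ⟩
      if (monus · (tri · (suc · v1)) · (suc · (add · (tri · v1) · v0))) (suc · v1) v1
        ≐⟨ if-suc (suc · v1) v1 (⊃I (<-irrefl h1 (s≤s⁻¹
             (nat-trans (nat-sym (add-monus-add (tri · v1) (suc · v1) (suc · v0))) (conv refl h0))))) ⟩
      v1 ∎)))))
  root-tri = ∀E (ind (root · (tri · v0) ≐ v0) (nf-≐ refl)
    (root · (tri · (suc · v0)) ≐⟨ nf-≐ refl ⟩
     if (monus · (tri · (suc · (root · (add · (tri · v0) · v0)))) · (suc · (add · (tri · v0) · v0)))
        (suc · (root · (add · (tri · v0) · v0))) (root · (add · (tri · v0) · v0))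
       ≐⟨ at (if (monus · (tri · (suc · v0)) · (suc · (add · (tri · v1) · v1))) (suc · v0) v0)
             (root-tri-add _ _ $ h0 $ ≤-refl _) ⟩
     if (monus · (tri · (suc · v0)) · (suc · (add · (tri · v0) · v0))) (suc · v0) v0
       ≐⟨ if-zero (suc · v0) v0 (conv refl (monus-self (tri · (suc · v0)))) ⟩
     suc · v0 ∎))

  root-pair : ∀ {Γ Φ} x y → Γ ∥ Φ ⊩ root · (pair · x · y) ≐ add · x · y
  root-pair = prove₂ (root · (pair · v1 · v0) ≐ add · v1 · v0)
    (conv refl (root-tri-add (add · v1 · v0) v0 $ root-tri _ $ ≤-addˡ _ _))

  snd-pair : ∀ {Γ Φ} x y → Γ ∥ Φ ⊩ snd · (pair · x · y) ≐ y
  snd-pair = prove₂ (snd · (pair · v1 · v0) ≐ v0)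
    (snd · (pair · v1 · v0) ≐⟨ nf-≐ refl ⟩
     monus · (pair · v1 · v0) · (tri · (root · (pair · v1 · v0)))
       ≐⟨ at (monus · (pair · v2 · v1) · (tri · v0)) (root-pair v1 v0) ⟩
     monus · (pair · v1 · v0) · (tri · (add · v1 · v0)) ≐⟨ nf-≐ refl ⟩
     monus · (add · (tri · (add · v1 · v0)) · v0) · (tri · (add · v1 · v0))
       ≐⟨ at (monus · v0 · (tri · (add · v2 · v1))) (add-comm (tri · (add · v1 · v0)) v0) ⟩
     monus · (add · v0 · (tri · (add · v1 · v0))) · (tri · (add · v1 · v0))
       ≐⟨ add-monus v0 _ ⟩
     v0 ∎)

  fst-pair : ∀ {Γ Φ} x y → Γ ∥ Φ ⊩ fst · (pair · x · y) ≐ x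
  fst-pair = prove₂ (fst · (pair · v1 · v0) ≐ v1)
    (fst · (pair · v1 · v0) ≐⟨ nf-≐ refl ⟩
     monus · (root · (pair · v1 · v0)) · (snd · (pair · v1 · v0))
       ≐⟨ at (monus · (root · (pair · v2 · v1)) · v0) (snd-pair v1 v0) ⟩
     monus · (root · (pair · v1 · v0)) · v0
       ≐⟨ at (monus · v0 · v1) (root-pair v1 v0) ⟩
     monus · (add · v1 · v0) · v0 ≐⟨ add-monus v1 v0 ⟩
     v1 ∎)

  ≤-pair : ∀ {Γ Φ} x y → Γ ∥ Φ ⊩ x ≤̇ pair · x · y
  ≤-pair = prove₂ (v1 ≤̇ pair · v1 · v0) (conv refl (≤-trans (≤-trans (≤-addʳ v1 v0)
    (prove₁ (v0 ≤̇ tri · v0) (∨E (zero-or-suc v0)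
      (rewr (v0 ≤̇ tri · v0) (nat-sym h0) (zero-monus _))
      (rewr (v0 ≤̇ tri · v0) (nat-sym h0) (conv refl (≤-addˡ (suc · (pred · v0)) (tri · (pred · v0)))))) (add · v1 · v0)))
    (≤-addʳ (tri · (add · v1 · v0)) v0)))

  pair-mono : ∀ {Γ Φ} {x x′ y y′ : Tm L Γ nat} → Γ ∥ Φ ⊩ x ≤̇ x′ → Γ ∥ Φ ⊩ y ≤̇ y′ →
              Γ ∥ Φ ⊩ pair · x · y ≤̇ pair · x′ · y′
  pair-mono {x = x} {x′} {y} {y′} p q =
    prove₄ (v3 ≤̇ v2 ⊃ v1 ≤̇ v0 ⊃ pair · v3 · v1 ≤̇ pair · v2 · v0)
      (⊃I (⊃I (conv refl (add-mono-≤ (tri-mono (add · v3 · v1) (add · v2 · v0) $ add-mono-≤ h1 h0) h0))))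
      x x′ y y′ $ p $ q

-- Binary trees and their branches

-- The code of the sequence of `n` ones. As `pair` is monotone, no binary sequence of length `n` has
-- a larger code.
bound : ∀ {L Γ} → Tm L Γ (nat ⇒ nat)
bound = R₀ · zero · ƛ (ƛ (suc · (pair · v0 · one)))

-- bad T d vanishes iff d ∈ T and the last entry of d is at most 1, and star T is
-- the largest binary tree contained in T.
bad : ∀ {L Γ} → Tm L Γ (𝟙 ⇒ nat ⇒ nat)
bad = ƛ (ƛ (add · (add · (monus · (v1 · v0) · one) · (monus · one · (v1 · v0))) · (monus · (snd · (pred · v0)) · one)))

star : ∀ {L Γ} → Tm L Γ (𝟙 ⇒ 𝟙)
star = ƛ (ƛ (iszero · (sum · ƛ (bad · v2 · (drop · v0 · v1)) · (suc · v0))))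

module Trees {L : Language} {T : Theory L} (base : ∀ {Γ} {A : Fm L Γ} → RCA₀^ω A → T A) where
  open Coding {L} {T} base public

  fst-pred-initial : ∀ {Γ Φ} α m → Γ ∥ Φ ⊩ fst · (pred · (initial · α · m)) ≐ initial · α · (pred · m)
  fst-pred-initial = prove₂ (fst · (pred · (initial · v1 · v0)) ≐ initial · v1 · (pred · v0))
    (∨E (zero-or-suc v0)
      (rewr (fst · (pred · (initial · v2 · v0)) ≐ initial · v2 · (pred · v0)) (nat-sym h0) (nf-≐ refl))
      (rewr (fst · (pred · (initial · v2 · v0)) ≐ initial · v2 · (pred · v0)) (nat-sym h0)
        (conv refl (fst-pair (initial · v1 · (pred · v0)) (v1 · (pred · v0))))))

  snd-pred-initial : ∀ {Γ Φ} α i → Γ ∥ Φ ⊩ snd · (pred · (initial · α · (suc · i))) ≐ α · i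
  snd-pred-initial = prove₂ (snd · (pred · (initial · v1 · (suc · v0))) ≐ v1 · v0)
    (conv refl (snd-pair (initial · v1 · v0) (v1 · v0)))

  drop-initial : ∀ {Γ Φ} α n i → Γ ∥ Φ ⊩ drop · i · (initial · α · n) ≐ initial · α · (monus · n · i)
  drop-initial = inst₃ (∀I (∀I (ind (drop · v0 · (initial · v2 · v1) ≐ initial · v2 · (monus · v1 · v0))
    (nf-≐ refl)
    (drop · (suc · v0) · (initial · v2 · v1) ≐⟨ nf-≐ refl ⟩
     fst · (pred · (drop · v0 · (initial · v2 · v1))) ≐⟨ at (fst · (pred · v0)) h0 ⟩
     fst · (pred · (initial · v2 · (monus · v1 · v0))) ≐⟨ fst-pred-initial v2 (monus · v1 · v0) ⟩
     initial · v2 · (pred · (monus · v1 · v0)) ≐⟨ nf-≐ refl ⟩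
     initial · v2 · (monus · v1 · (suc · v0)) ∎))))

  decode-initial : ∀ {Γ Φ} α n i → Γ ∥ Φ ⊩ i <̇ n ⊃ decode · n · (initial · α · n) · i ≐ α · i
  decode-initial = prove₃ (v0 <̇ v1 ⊃ decode · v1 · (initial · v2 · v1) · v0 ≐ v2 · v0) (⊃I
    (decode · v1 · (initial · v2 · v1) · v0 ≐⟨ nf-≐ refl ⟩
     snd · (pred · (drop · (monus · v1 · (suc · v0)) · (initial · v2 · v1)))
       ≐⟨ at (snd · (pred · v0)) (drop-initial v2 v1 (monus · v1 · (suc · v0))) ⟩
     snd · (pred · (initial · v2 · (monus · v1 · (monus · v1 · (suc · v0)))))
       ≐⟨ at (snd · (pred · (initial · v3 · v0))) (monus-monus h0) ⟩
     snd · (pred · (initial · v2 · (suc · v0))) ≐⟨ snd-pred-initial v2 v0 ⟩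
     v2 · v0 ∎))

  trunc-≐ : ∀ {Γ Φ} α i → Γ ∥ Φ ⊩ trunc · α · i ≐ sg · (α · i)
  trunc-≐ = prove₂ (trunc · v1 · v0 ≐ sg · (v1 · v0)) (nf-≐ refl)

  trunc≤one : ∀ {Γ Φ} α i → Γ ∥ Φ ⊩ trunc · α · i ≤̇ one
  trunc≤one α i = ≤-resp (nat-sym (trunc-≐ α i)) (one ∎) (sg≤one _)

  trunc-binary : ∀ {Γ Φ} α → Γ ∥ Φ ⊩ Binary (trunc · α)
  trunc-binary α = ∀I (trunc≤one _ _)

  trunc-id : ∀ {Γ Φ} {α i} → Γ ∥ Φ ⊩ α · i ≤̇ one → Γ ∥ Φ ⊩ trunc · α · i ≐ α · i
  trunc-id p = nat-trans (trunc-≐ _ _) (sg-id p)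

  initial-trunc : ∀ {Γ Φ} α n → Γ ∥ Φ ⊩ ∀̇ nat (v0 <̇ wkTm n ⊃ wkTm α · v0 ≤̇ one) ⊃
                  initial · (trunc · α) · n ≐ initial · α · n
  initial-trunc = prove₂ (∀̇ nat (v0 <̇ v1 ⊃ v2 · v0 ≤̇ one) ⊃ initial · (trunc · v1) · v0 ≐ initial · v1 · v0)
    (⊃I (initial-cong (∀I (⊃I (trunc-id (h1 ∙ v0 $ h0))))))

  trunc-decode : ∀ {Γ Φ} α n i → Γ ∥ Φ ⊩ i <̇ n ⊃
    trunc · (decode · n · (initial · (trunc · α) · n)) · i ≐ trunc · α · i
  trunc-decode = prove₃ (v0 <̇ v1 ⊃ trunc · (decode · v1 · (initial · (trunc · v2) · v1)) · v0 ≐ trunc · v2 · v0) (⊃I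
    (trunc · (decode · v1 · (initial · (trunc · v2) · v1)) · v0 ≐⟨ trunc-≐ _ _ ⟩
     sg · (decode · v1 · (initial · (trunc · v2) · v1) · v0)
       ≐⟨ at (sg · v0) (decode-initial (trunc · v2) v1 v0 $ h0) ⟩
     sg · (trunc · v2 · v0) ≐⟨ sg-id (trunc≤one v2 v0) ⟩
     trunc · v2 · v0 ∎))

  initial-decode : ∀ {Γ Φ} α n j → Γ ∥ Φ ⊩ j ≤̇ n ⊃
    initial · (trunc · (decode · n · (initial · (trunc · α) · n))) · j ≐ initial · (trunc · α) · j
  initial-decode = prove₃
    (v0 ≤̇ v1 ⊃ initial · (trunc · (decode · v1 · (initial · (trunc · v2) · v1))) · v0 ≐ initial · (trunc · v2) · v0)
    (⊃I (initial-cong (∀I (⊃I (trunc-decode v3 v2 v0 $ ≤-trans h0 h1)))))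

  -- This limits the search in `paths`, and it makes the code of a binary sequence of standard
  -- length standard.
  initial≤bound : ∀ {Γ Φ} α n → Γ ∥ Φ ⊩ initial · (trunc · α) · n ≤̇ bound · n
  initial≤bound = inst₂ (∀I (ind (initial · (trunc · v1) · v0 ≤̇ bound · v0) (nf-≐ refl)
    (conv refl (s≤s (pair-mono h0 (trunc≤one v1 v0))))))

  -- A sequence is no longer than its code, so the sum in `star`, which runs over all `i ≤ c`, meets
  -- every initial segment of the sequence coded by `c`.
  ≤-initial : ∀ {Γ Φ} α n → Γ ∥ Φ ⊩ n ≤̇ initial · α · n
  ≤-initial = inst₂ (∀I (ind (v0 ≤̇ initial · v1 · v0) (nf-≐ refl)
    (conv refl (s≤s (≤-trans h0 (≤-pair (initial · v1 · v0) (v1 · v0)))))))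

  monus≤ : ∀ {Γ Φ} n i → Γ ∥ Φ ⊩ monus · n · i ≤̇ n
  monus≤ = inst₂ (∀I (ind (monus · v1 · v0 ≤̇ v1) (conv refl (≤-refl v0))
    (conv refl (≤-trans (pred≤ (monus · v1 · v0)) h0))))
    where
    pred≤ : ∀ {Γ Φ} x → Γ ∥ Φ ⊩ pred · x ≤̇ x
    pred≤ x = ind (pred · v0 ≤̇ v0) (nf-≐ refl) (conv refl (≤-suc v0)) ∙ x

  Good : ∀ {Γ} → Tm L Γ 𝟙 → Tm L Γ nat → Fm L Γ
  Good t d = (t · d ≐ one) ∧̇ (snd · (pred · d) ≤̇ one)

  bad⇒good : ∀ {Γ Φ} t d → Γ ∥ Φ ⊩ bad · t · d ≐ zero ⊃ Good t d
  bad⇒good = prove₂ (bad · v1 · v0 ≐ zero ⊃ Good v1 v0) (⊃I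
    (cut (conv {B = add · (add · (monus · (v1 · v0) · one) · (monus · one · (v1 · v0))) · (monus · (snd · (pred · v0)) · one) ≐ zero} refl h0)
    (cut (≤zero⇒≐zero (≤-resp (_ ∎) h0 (≤-addʳ _ _)))
    (∧I (≤-antisym (≤zero⇒≐zero (≤-resp (_ ∎) h0 (≤-addʳ _ _))) (≤zero⇒≐zero (≤-resp (_ ∎) h0 (≤-addˡ _ _))))
        (≤zero⇒≐zero (≤-resp (_ ∎) h1 (≤-addˡ _ _)))))))

  good⇒bad : ∀ {Γ Φ} t d → Γ ∥ Φ ⊩ Good t d ⊃ bad · t · d ≐ zero
  good⇒bad = prove₂ (Good v1 v0 ⊃ bad · v1 · v0 ≐ zero) (⊃I
    (bad · v1 · v0 ≐⟨ nf-≐ refl ⟩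
     add · (add · (monus · (v1 · v0) · one) · (monus · one · (v1 · v0))) · (monus · (snd · (pred · v0)) · one)
       ≐⟨ at (add · (add · (monus · v0 · one) · (monus · one · v0)) · (monus · (snd · (pred · v1)) · one)) (∧E₁ h0) ⟩
     add · (add · (monus · one · one) · (monus · one · one)) · (monus · (snd · (pred · v0)) · one)
       ≐⟨ at (add · (add · (monus · one · one) · (monus · one · one)) · v0) (∧E₂ h0) ⟩
     add · (add · (monus · one · one) · (monus · one · one)) · zero ≐⟨ nf-≐ refl ⟩
     zero ∎))

  star≤one : ∀ {Γ Φ} t c → Γ ∥ Φ ⊩ star · t · c ≤̇ one
  star≤one = prove₂ (star · v1 · v0 ≤̇ one) (conv refl (iszero≤one (sum · ƛ (bad · v2 · (drop · v0 · v1)) · (suc · v0))))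

  star⇒good : ∀ {Γ Φ} t c i → Γ ∥ Φ ⊩ star · t · c ≐ one ⊃ i ≤̇ c ⊃ Good t (drop · i · c)
  star⇒good = prove₃ (star · v2 · v1 ≐ one ⊃ v0 ≤̇ v1 ⊃ Good v2 (drop · v0 · v1)) (⊃I (⊃I
    (bad⇒good v2 (drop · v0 · v1) $ conv refl (sum≐zero⁻ {f = ƛ (bad · v3 · (drop · v0 · v2))}
      (iszero≐one (conv refl h1)) (s≤s h0)))))

  good⇒star : ∀ {Γ Φ} t c → Γ ∥ Φ ⊩ ∀̇ nat (Good (wkTm t) (drop · v0 · wkTm c)) ⊃ star · t · c ≐ one
  good⇒star = prove₂ (∀̇ nat (Good v2 (drop · v0 · v1)) ⊃ star · v1 · v0 ≐ one) (⊃I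
    (conv refl (iszero-zero (sum≐zero {f = ƛ (bad · v2 · (drop · v0 · v1))} {n = suc · v0}
      (∀<I (conv refl (good⇒bad v2 (drop · v0 · v1) $ (h1 ∙ v0))))))))

  star⊆ : ∀ {Γ Φ} t α n j → Γ ∥ Φ ⊩ α ∣ n ∈ᵀ star · t ⊃ j ≤̇ n ⊃ α ∣ j ∈ᵀ t
  star⊆ = prove₄ (v2 ∣ v1 ∈ᵀ star · v3 ⊃ v0 ≤̇ v1 ⊃ v2 ∣ v0 ∈ᵀ v3) (⊃I (⊃I
    (rewr (v4 · v0 ≐ one)
      (nat-trans (drop-initial v2 v1 (monus · v1 · v0)) (at (initial · v3 · v0) (monus-monus h0)))
      (∧E₁ (star⇒good v3 (initial · v2 · v1) (monus · v1 · v0) $ h1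
        $ ≤-trans (monus≤ v1 v0) (≤-initial v2 v1))))))

  star-binary : ∀ {Γ Φ} t α n j → Γ ∥ Φ ⊩ α ∣ n ∈ᵀ star · t ⊃ j <̇ n ⊃ α · j ≤̇ one
  star-binary = prove₄ (v2 ∣ v1 ∈ᵀ star · v3 ⊃ v0 <̇ v1 ⊃ v2 · v0 ≤̇ one) (⊃I (⊃I
    (≤-resp (nat-trans (at (snd · (pred · v0)) (nat-trans (drop-initial v2 v1 (monus · v1 · (suc · v0)))
        (at (initial · v3 · v0) (monus-monus h0)))) (snd-pred-initial v2 v0)) (one ∎)
      (∧E₂ (star⇒good v3 (initial · v2 · v1) (monus · v1 · (suc · v0)) $ h1
        $ ≤-trans (monus≤ v1 (suc · v0)) (≤-initial v2 v1))))))

  star-intro : ∀ {Γ Φ} t α n → Γ ∥ Φ ⊩ ∀̇ nat (v0 ≤̇ wkTm n ⊃ wkTm α ∣ v0 ∈ᵀ wkTm t) ⊃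
               ∀̇ nat (v0 <̇ wkTm n ⊃ wkTm α · v0 ≤̇ one) ⊃ α ∣ n ∈ᵀ star · t
  star-intro = prove₃ (∀̇ nat (v0 ≤̇ v1 ⊃ v2 ∣ v0 ∈ᵀ v3) ⊃ ∀̇ nat (v0 <̇ v1 ⊃ v2 · v0 ≤̇ one) ⊃ v1 ∣ v0 ∈ᵀ star · v2)
    (⊃I (⊃I (good⇒star v2 (initial · v1 · v0) $ ∀I
      (rewr (Good v4 v0) (nat-sym (drop-initial v2 v1 v0)) (∧I (h1 ∙ (monus · v1 · v0) $ monus≤ v1 v0)
        (cut (monus≤ v1 v0) (∨E (zero-or-suc (monus · v1 · v0))
          -- The empty sequence has no last entry; the default `snd · zero` is 0 and passes the
          -- test.
          (rewr (snd · (pred · (initial · v3 · v0)) ≤̇ one) (nat-sym h0) (nf-≐ refl))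
          (rewr (snd · (pred · (initial · v3 · v0)) ≤̇ one) (nat-sym h0)
            (≤-resp (nat-sym (snd-pred-initial v2 (pred · (monus · v1 · v0)))) (one ∎)
              (h2 ∙ (pred · (monus · v1 · v0)) $ ≤-resp h0 (v1 ∎) h1))))))))))

  star-tree : ∀ {Γ Φ} t → Γ ∥ Φ ⊩ BinaryTree (star · t)
  star-tree = prove₁ (BinaryTree (star · v0)) (∧I (∀I (star≤one v1 v0)) (∀I (∀I (⊃I (∀<I (∧I
    (star-binary v3 v2 v1 v0 $ h1 $ h0)
    (star-intro v3 v2 v0
      $ ∀I (⊃I (star⊆ v4 v3 v2 v0 $ h2 $ ≤-trans h0 (<⇒≤ h1)))
      $ ∀I (⊃I (star-binary v4 v3 v2 v0 $ h2 $ ≤-trans h0 (<⇒≤ h1))))))))))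

-- Coded pairs (T, g) and the fan theorem for truncated sequences

cons : ∀ {L Γ} → Tm L Γ (nat ⇒ 𝟙 ⇒ 𝟙)
cons = ƛ (ƛ (R₀ · v1 · ƛ (K · (v1 · v0))))

tail : ∀ {L Γ} → Tm L Γ (𝟙 ⇒ 𝟙)
tail = ƛ (ƛ (v1 · (suc · v0)))

-- An object of type 2 codes a pair of T of type 1 and g of type 2.
pack : ∀ {L Γ} → Tm L Γ (𝟙 ⇒ 𝟚 ⇒ 𝟚)
pack = ƛ (ƛ (ƛ (cons · (v1 · (tail · v0)) · v2 · (v0 · zero))))

tree : ∀ {L Γ} → Tm L Γ (𝟚 ⇒ 𝟙)
tree = ƛ (ƛ (v1 · (cons · (suc · v0) · (K · zero))))

fun : ∀ {L Γ} → Tm L Γ (𝟚 ⇒ 𝟚)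
fun = ƛ (ƛ (v1 · (cons · zero · v0)))

Out : ∀ {L Γ} → Tm L Γ 𝟙 → Tm L Γ nat → Tm L Γ 𝟙 → Fm L Γ
Out α n t = trunc · α ∣ n ∉ᵀ t

Bounded : ∀ {L Γ} → Tm L Γ nat → Tm L Γ 𝟙 → Fm L Γ
Bounded k t = ∀̇ 𝟙 (∃≤̇ (wkTm k) (Out v1 v0 (wkTm (wkTm t))))

Misses : ∀ {L Γ} → Tm L Γ 𝟙 → Tm L Γ 𝟚 → Fm L Γ
Misses α x = Out α (fun · x · (trunc · α)) (tree · x)

-- β consists of a bound on the height of the tree of x, or else of a counterexample
-- α to the hypothesis of UFAN₂.
Solution : ∀ {L Γ} → Tm L Γ 𝟚 → Tm L Γ 𝟙 → Fm L Γ
Solution x β = Misses (tail · β) x ⊃ Bounded (β · zero) (tree · x)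

-- Neither `T` nor `α` is restricted: `star` extracts a tree from any `T`, and `trunc` makes any `α`
-- binary. No side condition remains whose relativisation would differ from it.
FAN′ : ∀ {L Γ} → Fm L Γ
FAN′ = ∀̇ 𝟙 (∀̇ 𝟙 (∃̇ nat (Out v1 v0 v2)) ⊃ ∃̇ nat (Bounded v0 v1))

-- This is not the relativisation of `FAN′`: as in `FAN*`, the final quantifier over sequences,
-- inside `Bounded`, ranges over all of them, which keeps that formula internal.
FAN′ˢᵗ : ∀ {L Γ} → Fm L Γ
FAN′ˢᵗ = ∀ˢᵗ 𝟙 (∀ˢᵗ 𝟙 (∃ˢᵗ nat (Out v1 v0 v2)) ⊃ ∃ˢᵗ nat (Bounded v0 v1))

module Fans {L : Language} {T : Theory L} (base : ∀ {Γ} {A : Fm L Γ} → RCA₀^ω A → T A) where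
  open Trees {L} {T} base public

  untrunc : ∀ {Γ Φ} t α n → Γ ∥ Φ ⊩ Binary α ⊃ Out α n t ⊃ α ∣ n ∉ᵀ t
  untrunc = prove₃ (Binary v1 ⊃ Out v1 v0 v2 ⊃ v1 ∣ v0 ∉ᵀ v2)
    (⊃I (⊃I (rewr (¬̇ (v3 · v0 ≐ one)) (initial-trunc v1 v0 $ ∀I (⊃I (h2 ∙ v0))) h0)))

  -- As `trunc · α` is binary, it could leave `star · t` at a level `n ≤ k` only by leaving `t` at
  -- some level up to `n`.
  out-star : ∀ {Γ Φ} t α k → Γ ∥ Φ ⊩ ∃≤̇ k (Out (wkTm α) v0 (star · wkTm t)) ⊃ ∃≤̇ k (Out (wkTm α) v0 (wkTm t))
  out-star = prove₃ (∃≤̇ v0 (Out v2 v0 (star · v3)) ⊃ ∃≤̇ v0 (Out v2 v0 v3))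
    (⊃I (∃<E h0 (raa (h1 $ (star-intro v3 (trunc · v2) v0
      $ ∀I (⊃I (raa (h2 $ ∃<I v0 (s≤s (≤-trans h1 (s≤s⁻¹ h4))) h0)))
      $ ∀I (⊃I (trunc≤one v3 v0)))))))

  out-of-star : ∀ {Γ Φ} t α n → Γ ∥ Φ ⊩ initial · (trunc · α) · n ≐ initial · α · n ⊃ Out α n t ⊃ α ∣ n ∉ᵀ star · t
  out-of-star = prove₃ (initial · (trunc · v1) · v0 ≐ initial · v1 · v0 ⊃ Out v1 v0 v2 ⊃ v1 ∣ v0 ∉ᵀ star · v2)
    (⊃I (⊃I (⊃I (h1 $ rewr (v3 · v0 ≐ one) (nat-sym h2) (star⊆ v2 v1 v0 v0 $ h0 $ ≤-refl v0)))))

  FAN⇒FAN′ : T ⊢ FAN ⊃ FAN′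
  FAN⇒FAN′ = ⊃I (∀I (⊃I (∃E (h1 ∙ (star · v0) $ star-tree v0
    $ ∀I (⊃I (∃E (h1 ∙ v0) (∃I v0 (out-of-star v2 v1 v0 $ (initial-trunc v1 v0 $ ∀I (⊃I (h2 ∙ v0))) $ h0)))))
    (∃I v0 (∀I (out-star v2 v0 v1 $ (h0 ∙ (trunc · v0) $ trunc-binary v0)))))))

  FAN′⇒FAN : T ⊢ FAN′ ⊃ FAN
  FAN′⇒FAN = ⊃I (∀I (⊃I (⊃I (∃E (h2 ∙ v0 $ ∀I (h0 ∙ (trunc · v0) $ trunc-binary v0))
    (∃I v0 (∀I (⊃I (∃<E (h1 ∙ v0) (∃<I v0 h1 (untrunc v3 v1 v0 $ h2 $ h0))))))))))

  tail-cons : ∀ {Γ Φ} a α → Γ ∥ Φ ⊩ Eq 𝟙 (tail · (cons · a · α)) α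
  tail-cons = prove₂ (Eq 𝟙 (tail · (cons · v1 · v0)) v0) (∀I (nf-≐ refl))

  fun-pack : ∀ {Γ Φ} t g α → Γ ∥ Φ ⊩ fun · (pack · t · g) · α ≐ g · α
  fun-pack = prove₃ (fun · (pack · v2 · v1) · v0 ≐ v1 · v0)
    (fun · (pack · v2 · v1) · v0 ≐⟨ nf-≐ refl ⟩
     v1 · (tail · (cons · zero · v0)) ≐⟨ Eq-cong₂ v1 (tail-cons zero v0) ⟩
     v1 · v0 ∎)

  tree-pack : ∀ {Γ Φ} t g n → Γ ∥ Φ ⊩ tree · (pack · t · g) · n ≐ t · n
  tree-pack = prove₃ (tree · (pack · v2 · v1) · v0 ≐ v2 · v0) (nf-≐ refl)

  out-pack : ∀ {Γ Φ} t g α n → Γ ∥ Φ ⊩ Out α n (tree · (pack · t · g)) ⊃ Out α n t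
  out-pack = prove₄ (Out v1 v0 (tree · (pack · v3 · v2)) ⊃ Out v1 v0 v3)
    (⊃I (⊃I (h1 $ nat-trans (tree-pack v3 v2 _) h0)))

  misses-pack : ∀ {Γ Φ} t g α → Γ ∥ Φ ⊩ Out α (g · (trunc · α)) t ⊃ Misses α (pack · t · g)
  misses-pack = prove₃ (Out v0 (v1 · (trunc · v0)) v2 ⊃ Misses v0 (pack · v2 · v1))
    (⊃I (⊃I (h1 $ nat-trans (nat-sym (tree-pack v2 v1 _))
      (rewr (tree · (pack · v3 · v2) · (initial · (trunc · v1) · v0) ≐ one) (fun-pack v2 v1 (trunc · v0)) h0))))

  bounded-pack : ∀ {Γ Φ} t g k → Γ ∥ Φ ⊩ Bounded k (tree · (pack · t · g)) ⊃ Bounded k t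
  bounded-pack = prove₃ (Bounded v0 (tree · (pack · v2 · v1)) ⊃ Bounded v0 v2)
    (⊃I (∀I (∃<E (h0 ∙ v0) (∃<I v0 h1 (out-pack v4 v3 v1 v0 $ h0)))))

-- Grilliot's trick

-- The summand at `j` is 1 exactly as long as `f` vanishes up to and including `j`. The sum up to
-- `i` is thus the minimum of `i` and the least `n` with `f n ≠ 0`, obtained without unbounded
-- search.
counter : ∀ {L Γ} → Tm L Γ (𝟙 ⇒ nat ⇒ nat)
counter = ƛ (ƛ (sum · ƛ (iszero · (sum · v2 · (suc · v0))) · v0))

-- Suppose that d N agrees with a below N.  If n is least with f n ≠ 0, then
-- diagonal g a d f is d (g a + n); if f vanishes everywhere, then it is a.
diagonal : ∀ {L Γ} → Tm L Γ (𝟚 ⇒ 𝟙 ⇒ (nat ⇒ 𝟙) ⇒ 𝟙 ⇒ 𝟙)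
diagonal = ƛ (ƛ (ƛ (ƛ (ƛ (v2 · (add · (v4 · v3) · (counter · v1 · (suc · v0))) · v0)))))

-- If `f` vanishes everywhere, extensionality turns the diagonal into `a`, and the value is 0.
-- Otherwise the diagonal is `d (g a + n)`; if `g (d m) > m` for all `m`, its value under `g`
-- exceeds `g a`, which is what the shift by `g a` is for.
grilliot : ∀ {L Γ} → Tm L Γ (𝟚 ⇒ 𝟙 ⇒ (nat ⇒ 𝟙) ⇒ 𝟚)
grilliot = ƛ (ƛ (ƛ (ƛ (monus · (v3 · (diagonal · v3 · v2 · v1 · v0)) · (v3 · v2)))))

Exists² : ∀ {L Γ} → Tm L Γ 𝟚 → Fm L Γ
Exists² e = ∀̇ 𝟙 ((wkTm e · v0 ≐ zero) ⇔ ∀̇ nat (v1 · v0 ≐ zero))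

module Discontinuity {L : Language} {T : Theory L} (base : ∀ {Γ} {A : Fm L Γ} → RCA₀^ω A → T A) where
  open Fans {L} {T} base public

  sum≐zero-below : ∀ {Γ Φ} f n i → Γ ∥ Φ ⊩ sum · f · n ≐ zero ⊃ i ≤̇ n ⊃ sum · f · i ≐ zero
  sum≐zero-below = prove₃ (sum · v2 · v1 ≐ zero ⊃ v0 ≤̇ v1 ⊃ sum · v2 · v0 ≐ zero)
    (⊃I (⊃I (sum≐zero (∀<I (sum≐zero⁻ h2 (≤-trans h0 h1))))))

  counter-suc : ∀ {Γ Φ} f n → Γ ∥ Φ ⊩ counter · f · (suc · n) ≐ add · (counter · f · n) · (iszero · (sum · f · (suc · n)))
  counter-suc = prove₂ (counter · v1 · (suc · v0) ≐ add · (counter · v1 · v0) · (iszero · (sum · v1 · (suc · v0)))) (nf-≐ refl)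

  counter-below : ∀ {Γ Φ} f n i → Γ ∥ Φ ⊩ sum · f · n ≐ zero ⊃ i ≤̇ n ⊃ counter · f · i ≐ i
  counter-below = inst₃ (∀I (∀I (ind (sum · v2 · v1 ≐ zero ⊃ v0 ≤̇ v1 ⊃ counter · v2 · v0 ≐ v0)
    (⊃I (⊃I (nf-≐ refl)))
    (⊃I (⊃I (
      counter · v2 · (suc · v0) ≐⟨ counter-suc v2 v0 ⟩
      add · (counter · v2 · v0) · (iszero · (sum · v2 · (suc · v0)))
        ≐⟨ at (add · (counter · v3 · v1) · v0) (iszero-zero (sum≐zero-below v2 v1 (suc · v0) $ h1 $ h0)) ⟩
      add · (counter · v2 · v0) · one ≐⟨ nf-≐ refl ⟩
      suc · (counter · v2 · v0) ≐⟨ at (suc · v0) (h2 $ h1 $ <⇒≤ h0) ⟩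
      suc · v0 ∎))))))

  counter-above : ∀ {Γ Φ} f n i → Γ ∥ Φ ⊩ sum · f · n ≐ zero ⊃ ¬̇ (f · n ≐ zero) ⊃ n ≤̇ i ⊃ counter · f · i ≐ n
  counter-above = inst₃ (∀I (∀I (ind
    (sum · v2 · v1 ≐ zero ⊃ ¬̇ (v2 · v1 ≐ zero) ⊃ v1 ≤̇ v0 ⊃ counter · v2 · v0 ≐ v1)
    (⊃I (⊃I (⊃I (nat-trans (counter-below v1 v0 zero $ h2 $ zero-monus v0) (nat-sym (≤zero⇒≐zero h0))))))
    (⊃I (⊃I (⊃I (∨E (<-split (s≤s h0))
      (counter · v2 · (suc · v0) ≐⟨ counter-suc v2 v0 ⟩
       add · (counter · v2 · v0) · (iszero · (sum · v2 · (suc · v0)))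
         ≐⟨ at (add · (counter · v3 · v1) · v0) (iszero-suc (⊃I (h3 $ sum≐zero⁻ h0 h1))) ⟩
       add · (counter · v2 · v0) · zero ≐⟨ nf-≐ refl ⟩
       counter · v2 · v0 ≐⟨ h4 $ h3 $ h2 $ s≤s⁻¹ h0 ⟩
       v1 ∎)
      (nat-trans (counter-below v2 v1 (suc · v0) $ h3 $ ≤-resp h0 (v1 ∎) (≤-refl v1)) (nat-sym h0)))))))))

  least : ∀ {Γ Φ} f n → Γ ∥ Φ ⊩ ¬̇ (f · n ≐ zero) ⊃
          ∃̇ nat ((sum · wkTm f · v0 ≐ zero) ∧̇ ¬̇ (wkTm f · v0 ≐ zero))
  least = prove₂ (¬̇ (v1 · v0 ≐ zero) ⊃ ∃̇ nat ((sum · v2 · v0 ≐ zero) ∧̇ ¬̇ (v2 · v0 ≐ zero)))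
    (⊃I (raa (h1 $ sum≐zero⁻ (ind (sum · v2 · v0 ≐ zero) (nf-≐ refl)
      (sum · v2 · (suc · v0) ≐⟨ nf-≐ refl ⟩
       add · (sum · v2 · v0) · (v2 · v0)
         ≐⟨ at (add · (sum · v3 · v1) · v0) (raa (h2 $ ∃I v0 (∧I h1 h0))) ⟩
       add · (sum · v2 · v0) · zero ≐⟨ nf-≐ refl ⟩
       sum · v2 · v0 ≐⟨ h0 ⟩
       zero ∎) ∙ (suc · v0)) (≤-refl (suc · v0)))))

  Approximates : ∀ {Γ} → Tm L Γ (nat ⇒ 𝟙) → Tm L Γ 𝟙 → Fm L Γ
  Approximates d a = ∀̇ nat (∀̇ nat (v0 <̇ v1 ⊃ wkTm (wkTm d) · v1 · v0 ≐ wkTm (wkTm a) · v0))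

  -- Entry `i` consults `f` only up to `i`. If `n ≤ i`, the counter has already stopped at `n`. If
  -- `i < n`, it yields `i + 1`, and both approximations involved agree with `a` at `i`; the
  -- successor in `diagonal` ensures this for the first of them.
  diagonal-nonzero : ∀ {Γ Φ} g a d f n → Γ ∥ Φ ⊩ Approximates d a ⊃ sum · f · n ≐ zero ⊃ ¬̇ (f · n ≐ zero) ⊃
                     Eq 𝟙 (diagonal · g · a · d · f) (d · (add · (g · a) · n))
  diagonal-nonzero = prove₅ (Approximates v2 v3 ⊃ sum · v1 · v0 ≐ zero ⊃ ¬̇ (v1 · v0 ≐ zero) ⊃
                     Eq 𝟙 (diagonal · v4 · v3 · v2 · v1) (v2 · (add · (v4 · v3) · v0)))
    (⊃I (⊃I (⊃I (∀I (
      (diagonal · v5 · v4 · v3 · v2) · v0 ≐⟨ nf-≐ refl ⟩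
      v3 · (add · (v5 · v4) · (counter · v2 · (suc · v0))) · v0
        ≐⟨ ∨E (≤-or-> v1 v0)
            (at (v4 · (add · (v6 · v5) · v0) · v1)
              (counter-above v2 v1 (suc · v0) $ h2 $ h1 $ ≤-trans h0 (≤-suc v0)))
            (v3 · (add · (v5 · v4) · (counter · v2 · (suc · v0))) · v0
               ≐⟨ at (v4 · (add · (v6 · v5) · v0) · v1) (counter-below v2 v1 (suc · v0) $ h2 $ h0) ⟩
             v3 · (add · (v5 · v4) · (suc · v0)) · v0
               ≐⟨ inst₂ h3 (add · (v5 · v4) · (suc · v0)) v0 $ ≤-addˡ (suc · v0) (v5 · v4) ⟩
             v4 · v0
               ≐⟨ nat-sym (inst₂ h3 (add · (v5 · v4) · v1) v0 $ ≤-trans h0 (≤-addˡ v1 (v5 · v4))) ⟩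
             v3 · (add · (v5 · v4) · v1) · v0 ∎) ⟩
      v3 · (add · (v5 · v4) · v1) · v0 ∎)))))

  diagonal-zero : ∀ {Γ Φ} g a d f → Γ ∥ Φ ⊩ Approximates d a ⊃ ∀̇ nat (wkTm f · v0 ≐ zero) ⊃ Eq 𝟙 (diagonal · g · a · d · f) a
  diagonal-zero = prove₄ (Approximates v1 v2 ⊃ ∀̇ nat (v1 · v0 ≐ zero) ⊃ Eq 𝟙 (diagonal · v3 · v2 · v1 · v0) v2)
    (⊃I (⊃I (∀I (
      (diagonal · v4 · v3 · v2 · v1) · v0 ≐⟨ nf-≐ refl ⟩
      v2 · (add · (v4 · v3) · (counter · v1 · (suc · v0))) · v0
        ≐⟨ at (v3 · (add · (v5 · v4) · v0) · v1) (counter-below v1 (suc · v0) (suc · v0)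
             $ sum≐zero (∀<I (h1 ∙ v0)) $ ≤-refl (suc · v0)) ⟩
      v2 · (add · (v4 · v3) · (suc · v0)) · v0
        ≐⟨ inst₂ h1 (add · (v4 · v3) · (suc · v0)) v0 $ ≤-addˡ (suc · v0) (v4 · v3) ⟩
      v3 · v0 ∎))))

  -- Grilliot's trick: a functional that is not sequentially continuous yields ∃².
  exists² : ∀ {Γ Φ} g a d → Γ ∥ Φ ⊩ Approximates d a ⊃ ∀̇ nat (v0 <̇ wkTm g · (wkTm d · v0)) ⊃ ∃̇ 𝟚 (Exists² v0)
  exists² = prove₃ (Approximates v0 v1 ⊃ ∀̇ nat (v0 <̇ v3 · (v1 · v0)) ⊃ ∃̇ 𝟚 (Exists² v0))
    (⊃I (⊃I (∃I (grilliot · v2 · v1 · v0) (∀I (∧I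
      (⊃I (∀I (raa (∃E (least v1 v0 $ h0) (<-irrefl (h3 ∙ (add · (v5 · v4) · v0))
        (≤-trans
          (≤-resp (Eq-cong₂ v5 {(diagonal · v5 · v4 · v3 · v2)} {v3 · (add · (v5 · v4) · v0)}
                    (diagonal-nonzero v5 v4 v3 v2 v0 $ h4 $ ∧E₁ h0 $ ∧E₂ h0)) (v5 · v4 ∎)
            (conv {B = v5 · (diagonal · v5 · v4 · v3 · v2) ≤̇ v5 · v4} refl h2))
          (≤-addʳ (v5 · v4) v0)))))))
      (⊃I (conv {A = v3 · (diagonal · v3 · v2 · v1 · v0) ≤̇ v3 · v2} refl
        (≤-resp (nat-sym (Eq-cong₂ v3 {(diagonal · v3 · v2 · v1 · v0)} {v2} (diagonal-zero v3 v2 v1 v0 $ h2 $ h0)))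
                (v3 · v2 ∎) (≤-refl (v3 · v2))))))))))

-- Deciding the existence of branches of given length

dist : ∀ {L Γ} → Tm L Γ (nat ⇒ nat ⇒ nat)
dist = ƛ (ƛ (add · (monus · v1 · v0) · (monus · v0 · v1)))

-- deviation T n c k m vanishes iff the binary sequence coded by m extends the
-- sequence of length n coded by c and stays in T up to length k; paths T n c k
-- is the number of the relevant m with this property.
deviation : ∀ {L Γ} → Tm L Γ (𝟙 ⇒ nat ⇒ nat ⇒ nat ⇒ nat ⇒ nat)
deviation = ƛ (ƛ (ƛ (ƛ (ƛ (ƛ (add · (dist · (initial · v0 · v4) · v3)
    · (sum · ƛ (dist · (v6 · (initial · v1 · v0)) · one) · (suc · v2)))
  · (trunc · (decode · (add · v3 · v1) · v0)))))))

paths : ∀ {L Γ} → Tm L Γ (𝟙 ⇒ nat ⇒ nat ⇒ nat ⇒ nat)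
paths = ƛ (ƛ (ƛ (ƛ (sum · (S · (K · iszero) · (deviation · v3 · v2 · v1 · v0)) · (suc · (bound · (add · v2 · v0)))))))

-- The level `k` is counted from the root, not from the node `c`. Hence `n + k` entries of `α`
-- certainly suffice to decide the condition.
Through : ∀ {L Γ} → Tm L Γ 𝟙 → Tm L Γ nat → Tm L Γ nat → Tm L Γ nat → Tm L Γ 𝟙 → Fm L Γ
Through t n c k α = (initial · (trunc · α) · n ≐ c) ∧̇ ∀̇ nat (v0 ≤̇ wkTm k ⊃ trunc · wkTm α ∣ v0 ∈ᵀ wkTm t)

module Search {L : Language} {T : Theory L} (base : ∀ {Γ} {A : Fm L Γ} → RCA₀^ω A → T A) where
  open Discontinuity {L} {T} base public

  dist≐zero⁻ : ∀ {Γ Φ} {x y : Tm L Γ nat} → Γ ∥ Φ ⊩ dist · x · y ≐ zero → Γ ∥ Φ ⊩ x ≐ y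
  dist≐zero⁻ {x = x} {y} p = prove₂ (dist · v1 · v0 ≐ zero ⊃ v1 ≐ v0)
    (⊃I (cut (conv {B = add · (monus · v1 · v0) · (monus · v0 · v1) ≐ zero} refl h0)
      (≤-antisym (≤zero⇒≐zero (≤-resp (_ ∎) h0 (≤-addʳ _ _))) (≤zero⇒≐zero (≤-resp (_ ∎) h0 (≤-addˡ _ _)))))) x y $ p

  dist≐zero : ∀ {Γ Φ} {x y : Tm L Γ nat} → Γ ∥ Φ ⊩ x ≐ y → Γ ∥ Φ ⊩ dist · x · y ≐ zero
  dist≐zero {x = x} {y} p = nat-trans (Eq-cong₁ {f = dist · x} {dist · y} (Eq-cong₂ dist p) y)
    (prove₁ (dist · v0 · v0 ≐ zero)
      (dist · v0 · v0 ≐⟨ nf-≐ refl ⟩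
       add · (monus · v0 · v0) · (monus · v0 · v0) ≐⟨ at (add · v0 · v0) (monus-self v0) ⟩
       add · zero · zero ≐⟨ nf-≐ refl ⟩
       zero ∎) y)

  candidate : ∀ {Γ} → Tm L Γ nat → Tm L Γ nat → Tm L Γ nat → Tm L Γ 𝟙
  candidate n k m = decode · (add · n · k) · m

  deviation⇒through : ∀ {Γ Φ} t n c k m → Γ ∥ Φ ⊩ deviation · t · n · c · k · m ≐ zero ⊃ Through t n c k (candidate n k m)
  deviation⇒through = prove₅ (deviation · v4 · v3 · v2 · v1 · v0 ≐ zero ⊃ Through v4 v3 v2 v1 (candidate v3 v1 v0))
    (⊃I (cut (conv {B = add · (dist · (initial · (trunc · candidate v3 v1 v0) · v3) · v2)
                     · (sum · ƛ (dist · (v5 · (initial · (trunc · candidate v4 v2 v1) · v0)) · one) · (suc · v1)) ≐ zero} refl h0)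
      (∧I (dist≐zero⁻ (≤zero⇒≐zero (≤-resp (_ ∎) h0 (≤-addʳ _ _))))
        (∀I (⊃I (dist≐zero⁻ (conv refl (sum≐zero⁻ {f = ƛ (dist · (v6 · (initial · (trunc · candidate v5 v3 v2) · v0)) · one)}
          (≤zero⇒≐zero (≤-resp (_ ∎) h1 (≤-addˡ _ _))) (s≤s h0)))))))))

  through⇒deviation : ∀ {Γ Φ} t n c k m → Γ ∥ Φ ⊩ Through t n c k (candidate n k m) ⊃ deviation · t · n · c · k · m ≐ zero
  through⇒deviation = prove₅ (Through v4 v3 v2 v1 (candidate v3 v1 v0) ⊃ deviation · v4 · v3 · v2 · v1 · v0 ≐ zero)
    (⊃I (deviation · v4 · v3 · v2 · v1 · v0 ≐⟨ nf-≐ refl ⟩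
      add · (dist · (initial · (trunc · candidate v3 v1 v0) · v3) · v2)
          · (sum · ƛ (dist · (v5 · (initial · (trunc · candidate v4 v2 v1) · v0)) · one) · (suc · v1))
        ≐⟨ at (add · v0 · (sum · ƛ (dist · (v6 · (initial · (trunc · candidate v5 v3 v2) · v0)) · one) · (suc · v2)))
              (dist≐zero (∧E₁ h0)) ⟩
      add · zero · (sum · ƛ (dist · (v5 · (initial · (trunc · candidate v4 v2 v1) · v0)) · one) · (suc · v1))
        ≐⟨ at (add · zero · v0) (sum≐zero {f = ƛ (dist · (v5 · (initial · (trunc · candidate v4 v2 v1) · v0)) · one)}
              (∀<I (conv refl (dist≐zero {x = v5 · (initial · (trunc · candidate v4 v2 v1) · v0)} (∧E₂ h1 ∙ v0 $ s≤s⁻¹ h0))))) ⟩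
      add · zero · zero ≐⟨ nf-≐ refl ⟩
      zero ∎))

  paths≐zero : ∀ {Γ Φ} t n c k → Γ ∥ Φ ⊩ ∀̇ 𝟙 (¬̇ Through (wkTm t) (wkTm n) (wkTm c) (wkTm k) v0) ⊃ paths · t · n · c · k ≐ zero
  paths≐zero = prove₄ (∀̇ 𝟙 (¬̇ Through v4 v3 v2 v1 v0) ⊃ paths · v3 · v2 · v1 · v0 ≐ zero)
    (⊃I (conv {A = sum · (S · (K · iszero) · (deviation · v3 · v2 · v1 · v0)) · (suc · (bound · (add · v2 · v0))) ≐ zero} refl
      (sum≐zero (∀<I (conv {A = iszero · (deviation · v4 · v3 · v2 · v1 · v0) ≐ zero} refl
        (iszero-suc (⊃I (h2 ∙ candidate v3 v1 v0 $ (deviation⇒through v4 v3 v2 v1 v0 $ h0)))))))))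

  -- A sequence through the node would be represented in the count by the code of its first `n + k`
  -- entries, which is at most `bound · (n + k)`.
  paths≐zero⁻ : ∀ {Γ Φ} t n c k → Γ ∥ Φ ⊩ paths · t · n · c · k ≐ zero ⊃ ∀̇ 𝟙 (¬̇ Through (wkTm t) (wkTm n) (wkTm c) (wkTm k) v0)
  paths≐zero⁻ = prove₄ (paths · v3 · v2 · v1 · v0 ≐ zero ⊃ ∀̇ 𝟙 (¬̇ Through v4 v3 v2 v1 v0))
    (⊃I (∀I (⊃I (iszero≐zero (conv {B = iszero · (deviation · v4 · v3 · v2 · v1 · code) ≐ zero} refl
        (sum≐zero⁻ {f = S · (K · iszero) · (deviation · v4 · v3 · v2 · v1)} {i = code}
          (conv {B = sum · (S · (K · iszero) · (deviation · v4 · v3 · v2 · v1)) · (suc · (bound · (add · v3 · v1))) ≐ zero} refl h1)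
          (s≤s (initial≤bound v0 (add · v3 · v1)))))
      $ (through⇒deviation v4 v3 v2 v1 code $ ∧I
          (nat-trans (initial-decode v0 (add · v3 · v1) v3 $ ≤-addʳ v3 v1) (∧E₁ h0))
          (∀I (⊃I (rewr (v6 · v0 ≐ one)
            (nat-sym (initial-decode v1 (add · v4 · v2) v0 $ ≤-trans h0 (≤-addˡ v2 v4)))
            (∧E₂ h1 ∙ v0 $ h0)))))))))
    where
    code : ∀ {Γ} → Tm L (𝟙 ∷ nat ∷ nat ∷ nat ∷ 𝟙 ∷ Γ) nat
    code = initial · (trunc · v0) · (add · v3 · v1)

  bounded⇒paths : ∀ {Γ Φ} t k → Γ ∥ Φ ⊩ Bounded k t ⊃ paths · t · zero · zero · k ≐ zero
  bounded⇒paths = prove₂ (Bounded v0 v1 ⊃ paths · v1 · zero · zero · v0 ≐ zero)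
    (⊃I (paths≐zero v1 zero zero v0 $ ∀I (⊃I (∃<E (h1 ∙ v0) (h0 $ (∧E₂ h2 ∙ v0 $ s≤s⁻¹ h1))))))

  paths⇒bounded : ∀ {Γ Φ} t k → Γ ∥ Φ ⊩ paths · t · zero · zero · k ≐ zero ⊃ Bounded k t
  paths⇒bounded = prove₂ (paths · v1 · zero · zero · v0 ≐ zero ⊃ Bounded v0 v1)
    (⊃I (∀I (raa ((paths≐zero⁻ v2 zero zero v1 $ h1) ∙ v0 $ ∧I (nf-≐ refl)
      (∀I (⊃I (raa (h2 $ ∃<I v0 (s≤s h1) h0))))))))

-- The leftmost path from ∃²

-- If e decides existence of zeros, barred e p n c vanishes iff p n c has no zero.
-- It is applied to p = paths T, where this means that T has arbitrarily long
-- branches through the sequence of length n coded by c.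
barred : ∀ {L Γ} → Tm L Γ (𝟚 ⇒ (nat ⇒ nat ⇒ nat ⇒ nat) ⇒ nat ⇒ nat ⇒ nat)
barred = ƛ (ƛ (ƛ (ƛ (v3 · (S · (K · iszero) · (v2 · v1 · v0))))))

child : ∀ {L Γ} → Tm L Γ nat → Tm L Γ nat → Tm L Γ nat
child c b = suc · (pair · c · b)

-- A node counts as kept when the first argument vanishes on it. Then `sg` of the value at the left
-- child is the next entry: 0 if that child is kept, otherwise 1.
node : ∀ {L Γ} → Tm L Γ ((nat ⇒ nat ⇒ nat) ⇒ nat ⇒ nat)
node = ƛ (R₀ · zero · ƛ (ƛ (child v0 (sg · (v2 · (suc · v1) · child v0 zero)))))

leftmost : ∀ {L Γ} → Tm L Γ ((nat ⇒ nat ⇒ nat) ⇒ 𝟙)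
leftmost = ƛ (ƛ (sg · (v1 · (suc · v0) · child (node · v1 · v0) zero)))

module Leftmost {L : Language} {T : Theory L} (base : ∀ {Γ} {A : Fm L Γ} → RCA₀^ω A → T A) where
  open Search {L} {T} base public

  no-zero⇒barred : ∀ {Γ Φ} e p n c → Γ ∥ Φ ⊩ Exists² e ⊃
    ∀̇ nat (¬̇ (wkTm p · wkTm n · wkTm c · v0 ≐ zero)) ⊃ barred · e · p · n · c ≐ zero
  no-zero⇒barred = prove₄ (Exists² v3 ⊃ ∀̇ nat (¬̇ (v3 · v2 · v1 · v0 ≐ zero)) ⊃ barred · v3 · v2 · v1 · v0 ≐ zero)
    (⊃I (⊃I (conv {A = v3 · (S · (K · iszero) · (v2 · v1 · v0)) ≐ zero} refl
      (∧E₂ (h1 ∙ (S · (K · iszero) · (v2 · v1 · v0)))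
        $ ∀I (conv {A = iszero · (v3 · v2 · v1 · v0) ≐ zero} refl (iszero-suc (h0 ∙ v0)))))))

  barred⇒no-zero : ∀ {Γ Φ} e p n c → Γ ∥ Φ ⊩ Exists² e ⊃ barred · e · p · n · c ≐ zero ⊃
    ∀̇ nat (¬̇ (wkTm p · wkTm n · wkTm c · v0 ≐ zero))
  barred⇒no-zero = prove₄ (Exists² v3 ⊃ barred · v3 · v2 · v1 · v0 ≐ zero ⊃ ∀̇ nat (¬̇ (v3 · v2 · v1 · v0 ≐ zero)))
    (⊃I (⊃I (∀I (iszero≐zero (conv {B = iszero · (v3 · v2 · v1 · v0) ≐ zero} refl
      ((∧E₁ (h1 ∙ (S · (K · iszero) · (v3 · v2 · v1))) $
        conv {B = v4 · (S · (K · iszero) · (v3 · v2 · v1)) ≐ zero} refl h0) ∙ v0))))))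

  through-child : ∀ {Γ Φ} t n c k α → Γ ∥ Φ ⊩ Through t n c k α ⊃
    ∀̇ nat (∀̇ nat (v0 ≤̇ wkTm (wkTm k) ⊃ trunc · wkTm (wkTm α) · wkTm (wkTm n) ≐ v1 ⊃
      Through (wkTm (wkTm t)) (suc · wkTm (wkTm n)) (child (wkTm (wkTm c)) v1) v0 (wkTm (wkTm α))))
  through-child = prove₅ (Through v4 v3 v2 v1 v0 ⊃ ∀̇ nat (∀̇ nat (v0 ≤̇ v3 ⊃ trunc · v2 · v5 ≐ v1 ⊃
      Through v6 (suc · v5) (child v4 v1) v0 v2)))
    (⊃I (∀I (∀I (⊃I (⊃I (∧I
      (initial · (trunc · v2) · (suc · v5) ≐⟨ initial-suc (trunc · v2) v5 ⟩
       child (initial · (trunc · v2) · v5) (trunc · v2 · v5) ≐⟨ at (child v0 (trunc · v3 · v6)) (∧E₁ h2) ⟩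
       child v4 (trunc · v2 · v5) ≐⟨ at (child v5 v0) h0 ⟩
       child v4 v1 ∎)
      (∀I (⊃I (∧E₂ h3 ∙ v0 $ ≤-trans h0 h2)))))))))

  Splits : ∀ {Γ} → Tm L Γ (nat ⇒ nat ⇒ nat ⇒ nat) → Fm L Γ
  Splits p = ∀̇ nat (∀̇ nat (∀̇ nat (∀̇ nat (
    p′ · (suc · v3) · child v2 zero · v1 ≐ zero ⊃ p′ · (suc · v3) · child v2 one · v0 ≐ zero ⊃
    p′ · v3 · v2 · (add · v1 · v0) ≐ zero))))
    where p′ = wkTm (wkTm (wkTm (wkTm p)))

  -- The combinatorial step of König's lemma. A branch through a node passes through one of the two
  -- children, and the sum of the two levels is at least the level that this child excludes.
  paths-split : ∀ {Γ Φ} t → Γ ∥ Φ ⊩ Splits (paths · t)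
  paths-split = prove₁ (Splits (paths · v0)) (∀I (∀I (∀I (∀I (⊃I (⊃I (
    paths≐zero v4 v3 v2 (add · v1 · v0) $ ∀I (⊃I
      (∨E (≤one-split (trunc≤one v0 v4))
        ((paths≐zero⁻ v5 (suc · v4) (child v3 zero) v2 $ h3) ∙ v0 $
          (inst₂ (through-child v5 v4 v3 (add · v2 · v1) v0 $ h1) zero v2 $ ≤-addʳ v2 v1 $ h0))
        ((paths≐zero⁻ v5 (suc · v4) (child v3 one) v1 $ h2) ∙ v0 $
          (inst₂ (through-child v5 v4 v3 (add · v2 · v1) v0 $ h1) one v1 $ ≤-addˡ v1 v2 $ h0)))))))))))

  Descends : ∀ {Γ} → Tm L Γ (nat ⇒ nat ⇒ nat) → Fm L Γ
  Descends b = ∀̇ nat (∀̇ nat (b′ · v1 · v0 ≐ zero ⊃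
    ¬̇ (b′ · (suc · v1) · child v0 zero ≐ zero) ⊃ b′ · (suc · v1) · child v0 one ≐ zero))
    where b′ = wkTm (wkTm b)

  barred-descends : ∀ {Γ Φ} e p → Γ ∥ Φ ⊩ Exists² e ⊃ Splits p ⊃ Descends (barred · e · p)
  barred-descends = prove₂ (Exists² v1 ⊃ Splits v0 ⊃ Descends (barred · v1 · v0))
    (⊃I (⊃I (∀I (∀I (⊃I (⊃I (no-zero⇒barred v3 v2 (suc · v1) (child v0 one) $ h3 $ ∀I (⊃I
      (h1 $ (no-zero⇒barred v4 v3 (suc · v2) (child v1 zero) $ h4 $ ∀I (⊃I
        ((barred⇒no-zero v5 v4 v3 v2 $ h5 $ h3) ∙ (add · v0 · v1) $
          (inst₄ h4 v3 v2 v0 v1 $ h0 $ h1)))))))))))))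

  -- Because `b` is a functional, having arbitrarily long branches is expressed by an equation, so
  -- that quantifier-free induction along the path is enough. This is where ∃², through `barred`,
  -- replaces arithmetical induction.
  node-zero : ∀ {Γ Φ} b n → Γ ∥ Φ ⊩ Descends b ⊃ b · zero · zero ≐ zero ⊃ b · n · (node · b · n) ≐ zero
  node-zero = prove₂ (Descends v1 ⊃ v1 · zero · zero ≐ zero ⊃ v1 · v0 · (node · v1 · v0) ≐ zero)
    (⊃I (⊃I (ind (v2 · v0 · (node · v2 · v0) ≐ zero) (conv refl h0)
      (conv {A = v2 · (suc · v0) · child (node · v2 · v0) (sg · left) ≐ zero} refl
        (cases (left ≐ zero)
          (rewr (v3 · (suc · v1) · child (node · v3 · v1) v0 ≐ zero) (nat-sym (if-zero zero one h0)) h0)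
          (rewr (v3 · (suc · v1) · child (node · v3 · v1) v0 ≐ zero) (nat-sym (if-suc zero one h0))
            (inst₂ h3 v0 (node · v2 · v0) $ h1 $ h0)))) ∙ v0)))
    where
    left : ∀ {Γ} → Tm L (nat ∷ nat ∷ (nat ⇒ nat ⇒ nat) ∷ Γ) nat
    left = v2 · (suc · v0) · child (node · v2 · v0) zero

  initial-leftmost : ∀ {Γ Φ} b n → Γ ∥ Φ ⊩ initial · (trunc · (leftmost · b)) · n ≐ node · b · n
  initial-leftmost = prove₂ (initial · (trunc · (leftmost · v1)) · v0 ≐ node · v1 · v0)
    (nat-trans (initial-trunc (leftmost · v1) v0 $ ∀I (⊃I (conv refl (sg≤one
        (v2 · (suc · v0) · child (node · v2 · v0) zero)))))
      (ind (initial · (leftmost · v2) · v0 ≐ node · v2 · v0) (nf-≐ refl)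
        (conv refl (at (child v0 (leftmost · v3 · v1)) h0)) ∙ v0))

  -- The chosen node of level `n` lies on branches reaching any level. For a branch reaching level
  -- `n` itself, the node is its initial segment there, hence belongs to the tree.
  leftmost-in-tree : ∀ {Γ Φ} e t n → Γ ∥ Φ ⊩ Exists² e ⊃ barred · e · (paths · t) · zero · zero ≐ zero ⊃
                     trunc · (leftmost · (barred · e · (paths · t))) ∣ n ∈ᵀ t
  leftmost-in-tree = prove₃ (Exists² v2 ⊃ barred · v2 · (paths · v1) · zero · zero ≐ zero ⊃
      trunc · (leftmost · (barred · v2 · (paths · v1))) ∣ v0 ∈ᵀ v1)
    (⊃I (⊃I (raa ((barred⇒no-zero v2 (paths · v1) v0 (node · (barred · v2 · (paths · v1)) · v0) $ h2
        $ (node-zero (barred · v2 · (paths · v1)) v0 $ (barred-descends v2 (paths · v1) $ h2 $ paths-split v1) $ h1)) ∙ v0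
      $ (paths≐zero v1 v0 (node · (barred · v2 · (paths · v1)) · v0) v0 $ ∀I (⊃I (h1 $
          rewr (v3 · v0 ≐ one) (nat-trans (∧E₁ h0) (nat-sym (initial-leftmost (barred · v3 · (paths · v2)) v1)))
            (∧E₂ h0 ∙ v1 $ ≤-refl v1))))))))

-- A functional that returns a bound or a counterexample

solve : ∀ {L Γ} → Tm L Γ (𝟚 ⇒ (𝟙 ⇒ 𝟙) ⇒ 𝟚 ⇒ 𝟙)
solve = ƛ (ƛ (ƛ (cons · (v2 · (tree · v0)) · (v1 · (tree · v0)))))

-- The chosen number is used in both roles at once, as the bound and as the code of the
-- counterexample. So it need not be decided which alternative of `FiniteSolution` holds.
solve-finite : ∀ {L Γ} → Tm L Γ ((𝟚 ⇒ nat) ⇒ 𝟚 ⇒ 𝟙)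
solve-finite = ƛ (ƛ (cons · (v1 · v0) · (decode · (fst · (v1 · v0)) · (snd · (v1 · v0)))))

approximation : ∀ {L Γ} → Tm L Γ (𝟙 ⇒ nat ⇒ 𝟙)
approximation = ƛ (ƛ (trunc · (decode · v0 · (initial · (trunc · v1) · v0))))

-- For the number k as a solution: k bounds the height of the tree of x, or codes an
-- initial segment of a counterexample.
FiniteSolution : ∀ {L Γ} → Tm L Γ 𝟚 → Tm L Γ nat → Fm L Γ
FiniteSolution x k = (paths · (tree · x) · zero · zero · k ≐ zero) ∨̇ ¬̇ Misses (decode · (fst · k) · (snd · k)) x

Uniform : ∀ {L Γ} → Fm L Γ
Uniform = ∃̇ (𝟚 ⇒ 𝟙) (∀̇ 𝟚 (Solution v0 (v1 · v0)))

module Uniformity {L : Language} {T : Theory L} (base : ∀ {Γ} {A : Fm L Γ} → RCA₀^ω A → T A) where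
  open Leftmost {L} {T} base public

  qf-choice : ∀ {Γ Φ} (A : Fm L (nat ∷ 𝟙 ∷ Γ)) {_ : QuantifierFree A} → Γ ∥ Φ ⊩ ∀̇ 𝟙 (∃̇ nat A) →
              Γ ∥ Φ ⊩ ∃̇ 𝟚 (∀̇ 𝟙 (subFm (((λ x → var (there (there x))) ▸ v0) ▸ (v1 · v0)) A))
  qf-choice A {qf} p = rca (choice (qf-ac A qf)) $ p

  refuted⇒solution : ∀ {Γ Φ} x a α → Γ ∥ Φ ⊩ ¬̇ Misses α x ⊃ Solution x (cons · a · α)
  refuted⇒solution = prove₃ (¬̇ Misses v0 v2 ⊃ Solution v2 (cons · v1 · v0))
    (⊃I (⊃I (absurd (h1 $ rewr (Misses v0 v3) (tail-cons v1 v0) h0))))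

  bounded⇒solution : ∀ {Γ Φ} x a α → Γ ∥ Φ ⊩ Bounded a (tree · x) ⊃ Solution x (cons · a · α)
  bounded⇒solution = prove₃ (Bounded v1 (tree · v2) ⊃ Solution v2 (cons · v1 · v0)) (⊃I (⊃I (conv refl h1)))

  solve-correct : ∀ {Γ Φ} κ ζ x → Γ ∥ Φ ⊩ Solution x (cons · (κ · (tree · x)) · (ζ · (tree · x))) ⊃ Solution x (solve · κ · ζ · x)
  solve-correct = prove₃ (Solution v0 (cons · (v2 · (tree · v0)) · (v1 · (tree · v0))) ⊃ Solution v0 (solve · v2 · v1 · v0))
    (⊃I (conv refl h0))

  exists²⇒uniform : ∀ {Γ Φ} e → Γ ∥ Φ ⊩ Exists² e ⊃ Uniform
  exists²⇒uniform = prove₁ (Exists² v0 ⊃ Uniform) (⊃I (∃E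
    (qf-choice ((barred · v2 · (paths · v1) · zero · zero ≐ zero) ∨̇ (paths · v1 · zero · zero · v0 ≐ zero))
      (∀I (cases (barred · v1 · (paths · v0) · zero · zero ≐ zero)
        -- A tree with arbitrarily long branches has no bound to offer; 0 is a default, and the
        -- leftmost path will answer instead.
        (∃I zero (∨I₁ h0))
        (raa (h1 $ (no-zero⇒barred v1 (paths · v0) zero zero $ h2 $ ∀I (⊃I (h1 $ ∃I v0 (∨I₂ h0)))))))))
    (∃I (solve · v0 · branch v1) (∀I (solve-correct v1 (branch v2) v0 $ ∨E (h0 ∙ (tree · v0))
      (refuted⇒solution v0 (v1 · (tree · v0)) (branch v2 · (tree · v0))
        $ ⊃I (h0 $ conv refl (leftmost-in-tree v2 (tree · v0) (fun · v0 · (trunc · (leftmost · (barred · v2 · (paths · (tree · v0)))))) $ h3 $ h1)))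
      (bounded⇒solution v0 (v1 · (tree · v0)) (branch v2 · (tree · v0))
        $ (paths⇒bounded (tree · v0) (v1 · (tree · v0)) $ h0)))))))
    where
    branch : ∀ {Γ} → Tm L Γ 𝟚 → Tm L Γ (𝟙 ⇒ 𝟙)
    branch e = ƛ (ƛ (leftmost · (barred · v1 · (paths · v0)))) · e

  approximation-correct : ∀ {Γ Φ} α → Γ ∥ Φ ⊩ Approximates (approximation · α) (trunc · α)
  approximation-correct = prove₁ (Approximates (approximation · v0) (trunc · v0))
    (∀I (∀I (⊃I (conv {A = trunc · (decode · v1 · (initial · (trunc · v2) · v1)) · v0 ≐ trunc · v2 · v0} refl
      (trunc-decode v2 v1 v0 $ h0)))))

  -- The approximation shares its first `n` entries with a path of the tree. If its level under
  -- `fun · x` is at most `n`, it is still inside the tree at that level and so is a counterexample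
  -- with a finite code.
  path-approximation : ∀ {Γ Φ} x α n → Γ ∥ Φ ⊩ ∀̇ nat (trunc · wkTm α ∣ v0 ∈ᵀ (tree · wkTm x)) ⊃
    fun · x · (approximation · α · n) ≤̇ n ⊃ ¬̇ Misses (decode · n · (initial · (trunc · α) · n)) x
  path-approximation = prove₃ (∀̇ nat (trunc · v2 ∣ v0 ∈ᵀ (tree · v3)) ⊃
      fun · v2 · (approximation · v1 · v0) ≤̇ v0 ⊃ ¬̇ Misses (decode · v0 · (initial · (trunc · v1) · v0)) v2)
    (⊃I (⊃I (⊃I (h0 $ rewr (tree · v3 · v0 ≐ one)
      (nat-sym (initial-decode v1 v0 exit $ conv {A = fun · v2 · (approximation · v1 · v0) ≤̇ v0} refl h1))
      (h2 ∙ exit)))))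
    where
    exit : ∀ {Γ} → Tm L (nat ∷ 𝟙 ∷ 𝟚 ∷ Γ) nat
    exit = fun · v2 · (trunc · (decode · v0 · (initial · (trunc · v1) · v0)))

  finite-pair : ∀ {Γ Φ} x n c → Γ ∥ Φ ⊩ ¬̇ Misses (decode · n · c) x ⊃ FiniteSolution x (pair · n · c)
  finite-pair = prove₃ (¬̇ Misses (decode · v1 · v0) v2 ⊃ FiniteSolution v2 (pair · v1 · v0))
    (⊃I (∨I₂ (rewr (¬̇ Misses (decode · v0 · (snd · (pair · v2 · v1))) v3) (nat-sym (fst-pair v1 v0))
      (rewr (¬̇ Misses (decode · v2 · v0) v3) (nat-sym (snd-pair v1 v0)) h0))))

  unsolved⇒exists² : ∀ {Γ Φ} x → Γ ∥ Φ ⊩ FAN′ ⊃ ¬̇ ∃̇ nat (FiniteSolution (wkTm x) v0) ⊃ ∃̇ 𝟚 (Exists² v0)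
  unsolved⇒exists² = prove₁ (FAN′ ⊃ ¬̇ ∃̇ nat (FiniteSolution v1 v0) ⊃ ∃̇ 𝟚 (Exists² v0))
    (⊃I (⊃I (raa (cases (∀̇ 𝟙 (∃̇ nat (Out v1 v0 (tree · v2))))
      -- If every sequence left the tree, `FAN′` would bound its height, and that bound would be a
      -- finite solution.
      (∃E (h3 ∙ (tree · v0) $ h0) (h3 $ ∃I v0 (∨I₁ (bounded⇒paths (tree · v1) v0 $ h0))))
      (h0 $ ∀I (raa (h2 $ (exists² (fun · v1) (trunc · v0) (approximation · v0) $ approximation-correct v0
        $ ∀I (∨E (≤-or-> (fun · v2 · (approximation · v1 · v0)) v0)
            (absurd (h4 $ ∃I (pair · v0 · (initial · (trunc · v1) · v0))
              (finite-pair v2 v0 (initial · (trunc · v1) · v0) $ (path-approximation v2 v1 v0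
                $ ∀I (raa (h2 $ ∃I v0 h0)) $ h0))))
            h0)))))))))

  module _ (choice² : ∀ {Γ} {A : Fm L Γ} → QF-AC 𝟚 nat A → T A) where

    FAN′⇒uniform : T ⊢ FAN′ ⊃ Uniform
    FAN′⇒uniform = ⊃I (cases (∀̇ 𝟚 (∃̇ nat (FiniteSolution v1 v0)))
      (∃E (ax (choice² (qf-ac (FiniteSolution v1 v0) _)) $ h0)
        (∃I (solve-finite · v0) (∀I (∨E (h0 ∙ v0)
          (conv refl (bounded⇒solution v0 (v1 · v0) counterexample $ (paths⇒bounded (tree · v0) (v1 · v0) $ h0)))
          (conv refl (refuted⇒solution v0 (v1 · v0) counterexample $ h0))))))
      (∃E (raa (h1 $ ∀I (raa (h1 $ (unsolved⇒exists² v0 $ h3 $ h0))))) (exists²⇒uniform v0 $ h0)))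
      where
      counterexample : Tm L (𝟚 ∷ (𝟚 ⇒ nat) ∷ []) 𝟙
      counterexample = decode · (fst · (v1 · v0)) · (snd · (v1 · v0))

-- Standard objects: relativisation, finitely many-valued choice and transfer

total : ∀ {L Γ} → Tm L Γ ((𝟙 ⇒ nat *) ⇒ 𝟚)
total = ƛ (ƛ (sum · (elt · (v1 · v0)) · (len · (v1 · v0))))

bounds : ∀ {L Γ} → Tm L Γ ((𝟚 ⇒ 𝟙 *) ⇒ 𝟙 ⇒ 𝟚 ⇒ nat)
bounds = ƛ (ƛ (ƛ (sum · ƛ (elt · (v3 · (pack · v2 · v1)) · v0 · zero) · (len · (v2 · (pack · v1 · v0))))))

height : ∀ {L Γ} → Tm L Γ ((𝟚 ⇒ 𝟙) ⇒ 𝟙 ⇒ 𝟚 ⇒ nat)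
height = ƛ (ƛ (ƛ (v2 · (pack · v1 · v0) · zero)))

module Standardness (𝒮 : Specification) {T : Theory (Con 𝒮)}
                    (Ω : ∀ {Γ} {A : Fm (Con 𝒮) Γ} → RCA₀^Ω 𝒮 A → T A) where
  open Uniformity {Con 𝒮} {T} (λ a → Ω (base a)) public

  private
    L : Language
    L = Con 𝒮

  standard : ∀ {Γ Φ σ} (t : Tm L [] σ) → Γ ∥ Φ ⊩ st (renTm empty t)
  standard t = ax (Ω (st-closed t))

  infixl 5 _·ˢᵗ_
  _·ˢᵗ_ : ∀ {Γ Φ σ τ} {f : Tm L Γ (σ ⇒ τ)} {t : Tm L Γ σ} → Γ ∥ Φ ⊩ st f → Γ ∥ Φ ⊩ st t → Γ ∥ Φ ⊩ st (f · t)
  p ·ˢᵗ q = ax (Ω (st-app _ _)) $ p $ q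

  below : ∀ {Γ Φ} {t u : Tm L Γ nat} → Γ ∥ Φ ⊩ st u → Γ ∥ Φ ⊩ t ≤̇ u → Γ ∥ Φ ⊩ st t
  below p q = ax (Ω (st-below _ _)) $ p $ q

  st-Eq : ∀ {Γ Φ σ} {t u : Tm L Γ σ} → Γ ∥ Φ ⊩ Eq σ t u → Γ ∥ Φ ⊩ st t → Γ ∥ Φ ⊩ st u
  st-Eq p q = ax (Ω (st-resp _ _)) $ p $ q

  tree-rel : ∀ {Γ Φ} t → Γ ∥ Φ ⊩ BinaryTree t ⊃ (BinaryTree t) ˢᵗ
  tree-rel = prove₁ (BinaryTree v0 ⊃ (BinaryTree v0) ˢᵗ) (⊃I (∧I
    (∀I (⊃I (∧E₁ h1 ∙ v0)))
    (∀I (⊃I (∀I (⊃I (inst₂ (∧E₂ h2) v1 v0)))))))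

  binary-trunc-rel : ∀ {Γ Φ} α → Γ ∥ Φ ⊩ (Binary (trunc · α)) ˢᵗ
  binary-trunc-rel α = ∀I (⊃I (trunc≤one _ _))

  -- Only entries with index below the standard number `n` matter; these indices are standard, so
  -- relativised binarity reaches them.
  initial-trunc-rel : ∀ {Γ Φ} α n → Γ ∥ Φ ⊩ st n ⊃ (Binary α) ˢᵗ ⊃ initial · (trunc · α) · n ≐ initial · α · n
  initial-trunc-rel = prove₂ (st v0 ⊃ (Binary v1) ˢᵗ ⊃ initial · (trunc · v1) · v0 ≐ initial · v1 · v0)
    (⊃I (⊃I (initial-trunc v1 v0 $ ∀I (⊃I (h1 ∙ v0 $ below h2 (<⇒≤ h0))))))

  untrunc-rel : ∀ {Γ Φ} t α k k′ → Γ ∥ Φ ⊩ st k ⊃ k ≤̇ k′ ⊃ (Binary α) ˢᵗ ⊃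
    ∃≤̇ k (Out (wkTm α) v0 (wkTm t)) ⊃ ∃≤̇ k′ (wkTm α ∣ v0 ∉ᵀ wkTm t)
  untrunc-rel = prove₄ (st v1 ⊃ v1 ≤̇ v0 ⊃ (Binary v2) ˢᵗ ⊃ ∃≤̇ v1 (Out v3 v0 v4) ⊃ ∃≤̇ v0 (v3 ∣ v0 ∉ᵀ v4))
    (⊃I (⊃I (⊃I (⊃I (∃<E h0 (∃<I v0 (s≤s (≤-trans (s≤s⁻¹ h1) h4))
      (rewr (¬̇ (v5 · v0 ≐ one)) (initial-trunc-rel v3 v0 $ below h5 (s≤s⁻¹ h1) $ h3) h0)))))))

  FANˢᵗ⇒FAN′ˢᵗ : T ⊢ FAN ˢᵗ ⊃ FAN′ˢᵗ
  FANˢᵗ⇒FAN′ˢᵗ = ⊃I (∀I (⊃I (⊃I (∃E (h2 ∙ (star · v0) $ (standard star ·ˢᵗ h1) $ (tree-rel (star · v0) $ star-tree v0)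
    $ ∀I (⊃I (⊃I (∃E (h2 ∙ v0 $ h1) (∃I v0 (∧I (∧E₁ h0)
        (out-of-star v2 v1 v0 $ (initial-trunc-rel v1 v0 $ ∧E₁ h0 $ h1) $ ∧E₂ h0)))))))
    (∃I v0 (∧I (∧E₁ h0) (∀I (out-star v2 v0 v1
      $ ∃<E (∧E₂ h0 ∙ (trunc · (decode · v1 · (initial · (trunc · v0) · v1)))
          -- The code lies below the standard number `bound · k`, so it is standard even if the
          -- sequence is not.
          $ (standard trunc ·ˢᵗ (standard decode ·ˢᵗ ∧E₁ h0 ·ˢᵗ
              below (standard bound ·ˢᵗ ∧E₁ h0) (initial≤bound v0 v1)))
          $ binary-trunc-rel (decode · v1 · (initial · (trunc · v0) · v1)))
          (∃<I v0 h1 (rewr (¬̇ (star · v4 · v0 ≐ one)) (initial-decode v1 v2 v0 $ s≤s⁻¹ h1) h0))))))))))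

  FAN′ˢᵗ⇒FAN* : T ⊢ FAN′ˢᵗ ⊃ FAN*
  FAN′ˢᵗ⇒FAN* = ⊃I (∀I (⊃I (⊃I (⊃I (∃E
    (h3 ∙ v0 $ h2 $ ∀I (⊃I (h1 ∙ (trunc · v0) $ (standard trunc ·ˢᵗ h0) $ binary-trunc-rel v0)))
    (∃I v0 (∧I (∧E₁ h0) (∀I (⊃I (∃<E (∧E₂ h1 ∙ v0) (∃<I v0 h1 (untrunc v3 v1 v0 $ h2 $ h0))))))))))))

  FAN*⇒FANˢᵗ : T ⊢ FAN* ⊃ FAN ˢᵗ
  FAN*⇒FANˢᵗ = ⊃I (∀I (⊃I (⊃I (⊃I (∃E (h3 ∙ v0 $ h2 $ h1 $ h0)
    (∃I v0 (∧I (∧E₁ h0) (∀I (⊃I (⊃I (untrunc-rel v2 v0 v1 v1 $ ∧E₁ h2 $ ≤-refl v1 $ h0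
      $ (∧E₂ h2 ∙ (trunc · v0) $ trunc-binary v0))))))))))))

  hac : ∀ {Γ Φ ρ τ} (φ : Fm L (τ ∷ ρ ∷ Γ)) {_ : Internal φ} → Γ ∥ Φ ⊩ ∀ˢᵗ ρ (∃ˢᵗ τ φ) →
        Γ ∥ Φ ⊩ ∃ˢᵗ (ρ ⇒ τ *) (∀ˢᵗ ρ (∃̇ τ ((v0 ∈̇ (v2 · v1)) ∧̇ renFm insert₂ φ)))
  hac φ {i} p = ax (Ω (HAC-int φ i)) $ p

  closed-rel : ∀ {Γ Φ} t α n j → Γ ∥ Φ ⊩ (BinaryTree t) ˢᵗ ⊃ st α ⊃ st n ⊃ α ∣ n ∈ᵀ t ⊃ j ≤̇ n ⊃ α ∣ j ∈ᵀ t
  closed-rel = prove₄ ((BinaryTree v3) ˢᵗ ⊃ st v2 ⊃ st v1 ⊃ v2 ∣ v1 ∈ᵀ v3 ⊃ v0 ≤̇ v1 ⊃ v2 ∣ v0 ∈ᵀ v3)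
    (⊃I (⊃I (⊃I (⊃I (⊃I (∨E (<-split (s≤s h0))
      (∧E₂ (∀<E (∧E₂ h5 ∙ v2 $ h4 ∙ v1 $ h3 $ h2) v0 h0))
      (rewr (v4 · (initial · v3 · v0) ≐ one) (nat-sym h0) h2)))))))

  -- The sum of the finitely many candidates for n bounds the right one, and
  -- leaving a tree is preserved when n increases.
  standard-modulus : ∀ {Γ Φ} t → Γ ∥ Φ ⊩ st t ⊃ (BinaryTree t) ˢᵗ ⊃
    ∀ˢᵗ 𝟙 ((Binary v0) ˢᵗ ⊃ ∃ˢᵗ nat (v1 ∣ v0 ∉ᵀ wkTm (wkTm t))) ⊃
    ∃ˢᵗ 𝟚 (∀ˢᵗ 𝟙 ((Binary v0) ˢᵗ ⊃ v0 ∣ v1 · v0 ∉ᵀ wkTm (wkTm t)))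
  standard-modulus = prove₁ (st v0 ⊃ (BinaryTree v0) ˢᵗ ⊃
      ∀ˢᵗ 𝟙 ((Binary v0) ˢᵗ ⊃ ∃ˢᵗ nat (v1 ∣ v0 ∉ᵀ v2)) ⊃ ∃ˢᵗ 𝟚 (∀ˢᵗ 𝟙 ((Binary v0) ˢᵗ ⊃ v0 ∣ v1 · v0 ∉ᵀ v2)))
    (⊃I (⊃I (⊃I (∃E (hac (Out v1 v0 v2) (∀I (⊃I (h1 ∙ (trunc · v0) $ (standard trunc ·ˢᵗ h0) $ binary-trunc-rel v0))))
      (∃I (total · v0) (∧I (standard total ·ˢᵗ ∧E₁ h0) (∀I (⊃I (⊃I
        (∃E (∧E₂ h2 ∙ v0 $ h1) (∃<E (∧E₁ h0) (⊃I
          (cut {A = st (total · v3 · v2)} (standard total ·ˢᵗ ∧E₁ h6 ·ˢᵗ h5)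
          (cut {A = v1 ≤̇ total · v3 · v2} (≤-resp (nat-sym h2) (nf-≐ refl) (≤-sum (elt · (v3 · v2)) v0 (len · (v3 · v2)) $ h3))
          (∧E₂ h5 $ rewr (v5 · v0 ≐ one) (nat-sym (initial-trunc-rel v2 v1 $ below h1 h0 $ h6))
            (closed-rel v4 v2 (total · v3 · v2) v1 $ weak (weak h8) $ h7 $ h1 $ h2 $ h0))))))))))))))))

  solution-rel : ∀ {Γ Φ} t g β → Γ ∥ Φ ⊩ ∀ˢᵗ 𝟙 ((Binary v0) ˢᵗ ⊃ v0 ∣ wkTm g · v0 ∉ᵀ wkTm t) ⊃
    st β ⊃ Solution (pack · t · g) β ⊃ Bounded (β · zero) t
  solution-rel = prove₃ (∀ˢᵗ 𝟙 ((Binary v0) ˢᵗ ⊃ v0 ∣ v2 · v0 ∉ᵀ v3) ⊃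
      st v0 ⊃ Solution (pack · v2 · v1) v0 ⊃ Bounded (v0 · zero) v2)
    (⊃I (⊃I (⊃I (bounded-pack v2 v1 (v0 · zero) $ (h0 $ (misses-pack v2 v1 (tail · v0)
      $ (h2 ∙ (trunc · (tail · v0)) $ (standard trunc ·ˢᵗ (standard tail ·ˢᵗ h1)) $ binary-trunc-rel (tail · v0))))))))

  UFAN₂ˢᵗ⇒FANˢᵗ : T ⊢ UFAN₂ ˢᵗ ⊃ FAN ˢᵗ
  UFAN₂ˢᵗ⇒FANˢᵗ = ⊃I (∀I (⊃I (⊃I (⊃I (∃E h3 (∃E (standard-modulus v1 $ h3 $ h2 $ h1)
    (∃I (v1 · v2 · v0) (∧I (∧E₁ h1 ·ˢᵗ h4 ·ˢᵗ ∧E₁ h0)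
      (∧E₂ h1 ∙ v2 $ h4 $ h3 ∙ v0 $ ∧E₁ h0 $ ∧E₂ h0)))))))))

  standard-solution : T ⊢ FAN′ˢᵗ ⊃ ∀ˢᵗ 𝟚 (∃ˢᵗ 𝟙 (Solution v1 v0))
  standard-solution = ⊃I (∀I (⊃I (cases (∀ˢᵗ 𝟙 (Misses v0 v1))
    (∃E (h2 ∙ (tree · v0) $ (standard tree ·ˢᵗ h1) $ ∀I (⊃I (∃I (fun · v1 · (trunc · v0))
          (∧I (standard fun ·ˢᵗ h2 ·ˢᵗ (standard trunc ·ˢᵗ h0)) (h1 ∙ v0 $ h0)))))
      -- With a correct bound in front, any standard sequence may follow; the constant 0 serves.
      (∃I (cons · v0 · (K · zero)) (∧I (standard cons ·ˢᵗ ∧E₁ h0 ·ˢᵗ standard (K · zero))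
        (⊃I (conv refl (∧E₂ h1))))))
    (raa (h1 $ ∀I (⊃I (raa (h2 $ ∃I (cons · zero · v0) (∧I (standard (cons · zero) ·ˢᵗ h1)
      (⊃I (absurd (h1 $ rewr (Misses v0 v2) (tail-cons zero v0) h0))))))))))))

  FAN′ˢᵗ⇒UFAN₂ˢᵗ : T ⊢ FAN′ˢᵗ ⊃ UFAN₂ ˢᵗ
  FAN′ˢᵗ⇒UFAN₂ˢᵗ = ⊃I (∃E (hac (Solution v1 v0) (weak standard-solution $ h0))
    (∃I (bounds · v0) (∧I (standard bounds ·ˢᵗ ∧E₁ h0)
      (∀I (⊃I (⊃I (∀I (⊃I (⊃I (∀I (⊃I (⊃I
        (∃E (∧E₂ h6 ∙ (pack · v2 · v1) $ (standard pack ·ˢᵗ h5 ·ˢᵗ h3)) (∃<E (∧E₁ h0)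
          (cut {A = st (v5 · (pack · v4 · v3))} (∧E₁ (weak h8) ·ˢᵗ (standard pack ·ˢᵗ weak h7 ·ˢᵗ h6))
          -- Finitely many-valued choice does not assert that the selected candidate is standard. It
          -- is so because it equals an entry of a standard finite sequence, with an index below the
          -- standard length.
          (cut {A = st v1} (st-Eq (Eq-sym {t = v1} {elt · (v5 · (pack · v4 · v3)) · v0} h1)
              (standard elt ·ˢᵗ h0 ·ˢᵗ below (standard len ·ˢᵗ h0) (<⇒≤ h2)))
          (untrunc-rel v4 v2 (v1 · zero) (bounds · v5 · v4 · v3) $ (h0 ·ˢᵗ standard zero)
            $ ≤-resp (nat-sym (Eq-cong₁ {f = v1} {elt · (v5 · (pack · v4 · v3)) · v0} h2 zero)) (_ ∎)
                (conv {B = elt · (v5 · (pack · v4 · v3)) · v0 · zero ≤̇ bounds · v5 · v4 · v3} refl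
                  (≤-sum (ƛ (elt · (v6 · (pack · v5 · v4)) · v0 · zero)) v0 (len · (v5 · (pack · v4 · v3))) $ h3))
            $ h5 $ ((solution-rel v4 v3 v1 $ h7 $ h0 $ ∧E₂ h4) ∙ v2))))))))))))))))))

  FAN′ˢᵗ⇒FAN′ : T ⊢ FAN′ˢᵗ ⊃ FAN′
  FAN′ˢᵗ⇒FAN′ = ⊃I (cut (ax (Ω (PF-TP∀ (∀̇ 𝟙 (Misses v0 v1) ⊃ ∃̇ nat (Bounded v0 (tree · v1))) _)) $
      ∀I (⊃I (⊃I (∃E (h2 ∙ (tree · v0) $ (standard tree ·ˢᵗ h1) $ ∀I (⊃I (∃I (fun · v1 · (trunc · v0))
          (∧I (standard fun ·ˢᵗ h2 ·ˢᵗ (standard trunc ·ˢᵗ h0)) (h1 ∙ v0)))))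
        (∃I v0 (∧E₂ h0))))))
    (∀I (⊃I (∃E (qf-choice (Out v1 v0 v2) h0)
      (∃E (h2 ∙ (pack · v1 · v0) $ ∀I (misses-pack v2 v1 v0 $
            (untrunc v2 (trunc · v0) (v1 · (trunc · v0)) $ trunc-binary v0 $ (h0 ∙ (trunc · v0)))))
        (∃I v0 (bounded-pack v2 v1 v0 $ h0)))))))

  UFAN₂⇒FAN : T ⊢ UFAN₂ ⊃ FAN
  UFAN₂⇒FAN = ⊃I (∀I (⊃I (⊃I (∃E h2 (∃E
    (qf-choice (Out v1 v0 v3) (∀I (h1 ∙ (trunc · v0) $ trunc-binary v0)))
    (∃I (v1 · v2 · v0) (h1 ∙ v2 $ h3 ∙ v0 $ ∀I (⊃I (untrunc v3 v0 (v1 · v0) $ h0 $ (h1 ∙ v0))))))))))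

  solution : ∀ {Γ Φ} t g β → Γ ∥ Φ ⊩ ∀̇ 𝟙 (Binary v0 ⊃ v0 ∣ wkTm g · v0 ∉ᵀ wkTm t) ⊃
    Solution (pack · t · g) β ⊃ Bounded (β · zero) t
  solution = prove₃ (∀̇ 𝟙 (Binary v0 ⊃ v0 ∣ v2 · v0 ∉ᵀ v3) ⊃ Solution (pack · v2 · v1) v0 ⊃ Bounded (v0 · zero) v2)
    (⊃I (⊃I (bounded-pack v2 v1 (v0 · zero) $ (h0 $ (misses-pack v2 v1 (tail · v0)
      $ (h1 ∙ (trunc · (tail · v0)) $ trunc-binary (tail · v0)))))))

  uniform⇒UFAN₂ : T ⊢ Uniform ⊃ UFAN₂
  uniform⇒UFAN₂ = ⊃I (∃E h0 (∃I (height · v0) (∀I (⊃I (∀I (⊃I (∀I (⊃I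
    (∃<E ((solution v2 v1 (v3 · (pack · v2 · v1)) $ h1 $ (h3 ∙ (pack · v2 · v1))) ∙ v0)
      (∃<I v0 (conv {A = v0 <̇ suc · (v4 · (pack · v3 · v2) · zero)} refl h1) (untrunc v3 v1 v0 $ h2 $ h0)))))))))))

  uniform⇒FANˢᵗ : T ⊢ Uniform ⊃ FAN ˢᵗ
  uniform⇒FANˢᵗ = ⊃I (∃E standard-witness (∀I (⊃I (⊃I (⊃I (∃E (standard-modulus v0 $ h2 $ h1 $ h0)
    (cut {A = st (v2 · (pack · v1 · v0))} (∧E₁ h4 ·ˢᵗ (standard pack ·ˢᵗ h3 ·ˢᵗ ∧E₁ h0))
    (∃I (v2 · (pack · v1 · v0) · zero) (∧I (h0 ·ˢᵗ standard zero) (∀I (⊃I (⊃I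
      (untrunc-rel v2 v0 height′ height′ $ (h2 ·ˢᵗ standard zero) $ ≤-refl height′ $ h0
        $ ((solution-rel v2 v1 (v3 · (pack · v2 · v1)) $ ∧E₂ h3 $ h2 $ (∧E₂ (weak h6) ∙ (pack · v2 · v1))) ∙ v0))))))))))))))
    where
    height′ : Tm L (𝟙 ∷ 𝟚 ∷ 𝟙 ∷ (𝟚 ⇒ 𝟙) ∷ []) nat
    height′ = v3 · (pack · v2 · v1) · zero
    -- The contrapositive of transfer: if no standard functional solved every (T, g), none would at
    -- all. This is legitimate because the matrix has no free variable besides the functional.
    standard-witness : [] ∥ Uniform ∷ [] ⊩ ∃ˢᵗ (𝟚 ⇒ 𝟙) (∀̇ 𝟚 (Solution v0 (v1 · v0)))
    standard-witness = raa (∃E h1 ((ax (Ω (PF-TP∀ (¬̇ ∀̇ 𝟚 (Solution v0 (v1 · v0))) _)) $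
      ∀I (⊃I (⊃I (h3 $ ∃I v0 (∧I h1 h0))))) ∙ v0 $ h0))

corollary5p5 : (𝒮 : Specification) →
    (RCA₀^Ω 𝒮 ⊢ ((FAN ˢᵗ) ⇔ (UFAN₂ ˢᵗ)) ∧̇ ((UFAN₂ ˢᵗ) ⇔ FAN*)) ×
    (RCA₀^Ω+QF-AC²⁰ 𝒮 ⊢ ((FAN ˢᵗ) ⇔ FAN) ∧̇ (FAN ⇔ UFAN₂))
corollary5p5 𝒮 = part₁ , part₂
  where
  module _ where
    open Standardness 𝒮 {RCA₀^Ω 𝒮} (λ a → a)

    part₁ : RCA₀^Ω 𝒮 ⊢ ((FAN ˢᵗ) ⇔ (UFAN₂ ˢᵗ)) ∧̇ ((UFAN₂ ˢᵗ) ⇔ FAN*)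
    part₁ = ∧I
      (∧I (FANˢᵗ⇒FAN′ˢᵗ ⨾ FAN′ˢᵗ⇒UFAN₂ˢᵗ) UFAN₂ˢᵗ⇒FANˢᵗ)
      (∧I (UFAN₂ˢᵗ⇒FANˢᵗ ⨾ FANˢᵗ⇒FAN′ˢᵗ ⨾ FAN′ˢᵗ⇒FAN*) (FAN*⇒FANˢᵗ ⨾ FANˢᵗ⇒FAN′ˢᵗ ⨾ FAN′ˢᵗ⇒UFAN₂ˢᵗ))

  module _ where
    open Standardness 𝒮 {RCA₀^Ω+QF-AC²⁰ 𝒮} base

    FAN⇒uniform : RCA₀^Ω+QF-AC²⁰ 𝒮 ⊢ FAN ⊃ Uniform
    FAN⇒uniform = FAN⇒FAN′ ⨾ FAN′⇒uniform choice

    part₂ : RCA₀^Ω+QF-AC²⁰ 𝒮 ⊢ ((FAN ˢᵗ) ⇔ FAN) ∧̇ (FAN ⇔ UFAN₂)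
    part₂ = ∧I
      (∧I (FANˢᵗ⇒FAN′ˢᵗ ⨾ FAN′ˢᵗ⇒FAN′ ⨾ FAN′⇒FAN) (FAN⇒uniform ⨾ uniform⇒FANˢᵗ))
      (∧I (FAN⇒uniform ⨾ uniform⇒UFAN₂) UFAN₂⇒FAN)
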